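{- The reduction relations $\longrightarrow_{\mathtt{CBV}}$ of the call-by-value $\mathrm{DC}\mu\nu$ and $\longrightarrow_{\mathtt{CBN}}$ of the call-by-name $\mathrm{DC}\mu\nu$ (on the set of expressions of $\mathrm{DC}\mu\nu$) both satisfy the Church-Rosser property.
   Context: Church-Rosser property. A relation $\to$ on a set $A$ has the diamond property if for all $a,b,c\in A$ with $a\to b$ and $a\to c$ there is $d\in A$ with $b\to d$ and $c\to d$; $\to$ satisfies the Church-Rosser property if its reflexive transitive closure $\to^*$ has the diamond property. Syntax. Type variables $X,Y,\dots$ (set $\mathrm{TyVars}$), variables $x,y,z,\dots$ and covariables $\alpha,\beta,\gamma,\dots$ are given, with a fixed involution $(-)'$ between variables and covariables ($x''=x$, $\alpha''=\alpha$). Types of $\mathrm{DC}\mu\nu$: $A::=X\mid A\land A\mid A\lor A\mid\neg A\mid\mu X.A\mid\nu X.A$, where $\mu X.A$ and $\nu X.A$ (binding $X$ in $A$) are formed only if $X\in\mathrm{Pos}(A)$; simultaneously, $\mathrm{Pos}(X)=\mathrm{TyVars}$, $\mathrm{Neg}(X)=\mathrm{TyVars}\setminus\{X\}$, $\mathrm{Pos}(A\land B)=\mathrm{Pos}(A\lor B)=\mathrm{Pos}(A)\cap\mathrm{Pos}(B)$, $\mathrm{Neg}(A\land B)=\mathrm{Neg}(A\lor B)=\mathrm{Neg}(A)\cap\mathrm{Neg}(B)$, $\mathrm{Pos}(\neg A)=\mathrm{Neg}(A)$, $\mathrm{Neg}(\neg A)=\mathrm{Pos}(A)$, $\mathrm{Pos}(\mu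 X.A)=\mathrm{Pos}(\nu X.A)=\mathrm{Pos}(A)\cup\{X\}$, $\mathrm{Neg}(\mu X.A)=\mathrm{Neg}(\nu X.A)=\mathrm{Neg}(A)\cup\{X\}$. Terms: $M::=x\mid\langle M,M\rangle\mid\langle M\rangle\mathsf{inl}\mid\langle M\rangle\mathsf{inr}\mid[K]\mathsf{not}\mid(S).\alpha\mid\mathsf{in}^{\mu X.A}\langle M\rangle\mid\mathsf{coitr}^A_x\langle M,M\rangle$. Coterms: $K::=\alpha\mid[K,K]\mid\mathsf{fst}[K]\mid\mathsf{snd}[K]\mid\mathsf{not}\langle M\rangle\mid x.(S)\mid\mathsf{out}^{\nu X.A}[K]\mid\mathsf{itr}^A_\alpha[K,K]$. Statements: $S::=M\bullet K$. An expression ($D,E,\dots$) is a term ($M,N$), a coterm ($K,L$) or a statement ($S,T$). $(S).\alpha$ binds $\alpha$ in $S$, $x.(S)$ binds $x$ in $S$, $\mathsf{itr}^A_\alpha[K,L]$ binds $\alpha$ in $K$ only, $\mathsf{coitr}^A_x\langle M,N\rangle$ binds $x$ in $M$ only. Types and expressions are identified up to renaming of bound names; substitution is capture-avoiding. Duality transformation. Types: $(X)^\circ=X$, $(\neg A)^\circ=\neg(A)^\circ$, $(A\land B)^\circ=(A)^\circ\lor(B)^\circ$, $(A\lor B)^\circ=(A)^\circ\land(B)^\circ$, $(\mu X.A)^\circ=\nu X.(A)^\circ$, $(\nu X.A)^\circ=\mu X.(A)^\circ$. Expressions: $(x)^\circ=x'$, $(\alpha)^\circ=\alpha'$, $(\langle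 M,N\rangle)^\circ=[(M)^\circ,(N)^\circ]$, $([K,L])^\circ=\langle(K)^\circ,(L)^\circ\rangle$, $(\langle M\rangle\mathsf{inl})^\circ=\mathsf{fst}[(M)^\circ]$, $(\mathsf{fst}[K])^\circ=\langle(K)^\circ\rangle\mathsf{inl}$, $(\langle M\rangle\mathsf{inr})^\circ=\mathsf{snd}[(M)^\circ]$, $(\mathsf{snd}[K])^\circ=\langle(K)^\circ\rangle\mathsf{inr}$, $([K]\mathsf{not})^\circ=\mathsf{not}\langle(K)^\circ\rangle$, $(\mathsf{not}\langle M\rangle)^\circ=[(M)^\circ]\mathsf{not}$, $((S).\alpha)^\circ=\alpha'.((S)^\circ)$, $(x.(S))^\circ=((S)^\circ).x'$, $(M\bullet K)^\circ=(K)^\circ\bullet(M)^\circ$, $(\mathsf{in}^{\mu X.A}\langle M\rangle)^\circ=\mathsf{out}^{\nu X.(A)^\circ}[(M)^\circ]$, $(\mathsf{out}^{\nu X.A}[K])^\circ=\mathsf{in}^{\mu X.(A)^\circ}\langle(K)^\circ\rangle$, $(\mathsf{itr}^A_\alpha[K,L])^\circ=\mathsf{coitr}^{(A)^\circ}_{\alpha'}\langle(K)^\circ,(L)^\circ\rangle$, $(\mathsf{coitr}^A_x\langle M,N\rangle)^\circ=\mathsf{itr}^{(A)^\circ}_{x'}[(M)^\circ,(N)^\circ]$. The operator $\mathsf{mono}$. For a type $C$ and type variable $X$ let $\|C\|_X=0$ if $X$ is not free in $C$, and otherwise $\|X\|_X=1$, $\|A\land B\|_X=\|A\lor B\|_X=\|A\|_X+\|B\|_X+1$,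 $\|\neg A\|_X=\|A\|_X+1$, $\|\mu Y.A\|_X=\|\nu Y.A\|_X=\|A\|_X+\|A\|_Y+1$. For $X$ not free in $A,B$, the term $\mathsf{mono}^{X.C}_{A,B,x.M}\{N\}$ is defined by recursion on $\|C\|_X$ (newly introduced names $y,z,\alpha,\beta,\gamma$ are fresh): $\mathsf{mono}^{X.X}_{A,B,x.M}\{N\}=(N\bullet x.(M\bullet\alpha)).\alpha$; $\mathsf{mono}^{X.C}_{A,B,x.M}\{N\}=N$ if $X$ does not occur in $C$; $\mathsf{mono}^{X.C\land D}_{A,B,x.M}\{N\}=\langle\mathsf{mono}^{X.C}_{A,B,x.M}\{(N\bullet\mathsf{fst}[\alpha]).\alpha\},\mathsf{mono}^{X.D}_{A,B,x.M}\{(N\bullet\mathsf{snd}[\beta]).\beta\}\rangle$; $\mathsf{mono}^{X.C\lor D}_{A,B,x.M}\{N\}=(N\bullet[y.(\langle\mathsf{mono}^{X.C}_{A,B,x.M}\{y\}\rangle\mathsf{inl}\bullet\gamma),z.(\langle\mathsf{mono}^{X.D}_{A,B,x.M}\{z\}\rangle\mathsf{inr}\bullet\gamma)]).\gamma$; $\mathsf{mono}^{X.\neg C}_{A,B,x.M}\{N\}=[z.(N\bullet\mathsf{not}\langle\mathsf{mono}^{X.C}_{B,A,x.M}\{z\}\rangle)]\mathsf{not}$; $\mathsf{mono}^{X.\mu Y.C}_{A,B,x.M}\{N\}=(N\bullet\mathsf{itr}^{\mu Y.C[B/X]}_\alpha[z.(\mathsf{in}^{\mu Y.C[B/X]}\langle\mathsf{mono}^{X.C[\mu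 Y.C[B/X]/Y]}_{A,B,x.M}\{z\}\rangle\bullet\alpha),\beta]).\beta$; $\mathsf{mono}^{X.\nu Y.C}_{A,B,x.M}\{N\}=\mathsf{coitr}^{\nu Y.C[A/X]}_z\langle\mathsf{mono}^{X.C[\nu Y.C[A/X]/Y]}_{A,B,x.M}\{(z\bullet\mathsf{out}^{\nu Y.C[A/X]}[\alpha]).\alpha\},N\rangle$. For coterms, $\mathsf{mono}^{X.C}_{A,B,\alpha.K}\{L\}=(\mathsf{mono}^{X.(C)^\circ}_{(B)^\circ,(A)^\circ,\alpha'.(K)^\circ}\{(L)^\circ\})^\circ$. Write $\mathsf{mono}^{X.C}_{A,B,x}\{M,N\}$ for $\mathsf{mono}^{X.C}_{A,B,x.M}\{N\}$ and $\mathsf{mono}^{X.C}_{A,B,\alpha}\{K,L\}$ for $\mathsf{mono}^{X.C}_{A,B,\alpha.K}\{L\}$. Values: $V,W::=x\mid\langle V,V\rangle\mid\langle V\rangle\mathsf{inl}\mid\langle V\rangle\mathsf{inr}\mid[K]\mathsf{not}\mid\mathsf{in}^{\mu X.A}\langle V\rangle\mid\mathsf{coitr}^A_x\langle M,V\rangle$. Covalues: $P,Q::=\alpha\mid[P,P]\mid\mathsf{fst}[P]\mid\mathsf{snd}[P]\mid\mathsf{not}\langle M\rangle\mid\mathsf{out}^{\nu X.A}[P]\mid\mathsf{itr}^A_\alpha[K,P]$ ($M$, $K$ arbitrary). Call-by-value reduction $\longrightarrow_{\mathtt{CBV}}$ is the compatible closure of ($\mathcal M$ ranges over terms that are not values):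 $\langle V,W\rangle\bullet\mathsf{fst}[K]\to V\bullet K$; $\langle V,W\rangle\bullet\mathsf{snd}[K]\to W\bullet K$; $\langle V\rangle\mathsf{inl}\bullet[K,L]\to V\bullet K$; $\langle W\rangle\mathsf{inr}\bullet[K,L]\to W\bullet L$; $[K]\mathsf{not}\bullet\mathsf{not}\langle M\rangle\to M\bullet K$; $(S).\alpha\bullet K\to S[K/\alpha]$; $V\bullet x.(S)\to S[V/x]$; $\mathsf{in}^{\mu X.C}\langle V\rangle\bullet\mathsf{itr}^A_\alpha[K,L]\to(V\bullet\mathsf{mono}^{X.C}_{\mu X.C,A,\beta}\{\mathsf{itr}^A_\alpha[K,\beta],K\}).\alpha\bullet L$; $\mathsf{coitr}^A_x\langle M,V\rangle\bullet\mathsf{out}^{\nu X.C}[K]\to V\bullet x.(\mathsf{mono}^{X.C}_{A,\nu X.C,z}\{\mathsf{coitr}^A_x\langle M,z\rangle,M\}\bullet K)$; $(M\bullet\alpha).\alpha\to M$ and $x.(x\bullet K)\to K$ ($\alpha$ not free in $M$, $x$ not free in $K$); and, with $x,\alpha$ fresh: $\langle\mathcal M,N\rangle\to(\mathcal M\bullet x.(\langle x,N\rangle\bullet\alpha)).\alpha$; $\langle V,\mathcal M\rangle\to(\mathcal M\bullet x.(\langle V,x\rangle\bullet\alpha)).\alpha$; $\langle\mathcal M\rangle\mathsf{inl}\to(\mathcal M\bullet x.(\langle x\rangle\mathsf{inl}\bullet\alpha)).\alpha$; $\langle\mathcal M\rangle\mathsf{inr}\to(\mathcal M\bullet x.(\langle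 x\rangle\mathsf{inr}\bullet\alpha)).\alpha$; $\mathsf{in}^{\mu X.C}\langle\mathcal M\rangle\to(\mathcal M\bullet x.(\mathsf{in}^{\mu X.C}\langle x\rangle\bullet\alpha)).\alpha$; $\mathsf{coitr}^A_y\langle M,\mathcal M\rangle\to(\mathcal M\bullet x.(\mathsf{coitr}^A_y\langle M,x\rangle\bullet\alpha)).\alpha$. Call-by-name reduction $\longrightarrow_{\mathtt{CBN}}$ is the compatible closure of ($\mathcal K$ ranges over coterms that are not covalues): $\langle M,N\rangle\bullet\mathsf{fst}[P]\to M\bullet P$; $\langle M,N\rangle\bullet\mathsf{snd}[P]\to N\bullet P$; $\langle M\rangle\mathsf{inl}\bullet[P,Q]\to M\bullet P$; $\langle M\rangle\mathsf{inr}\bullet[P,Q]\to M\bullet Q$; $[K]\mathsf{not}\bullet\mathsf{not}\langle M\rangle\to M\bullet K$; $(S).\alpha\bullet P\to S[P/\alpha]$; $M\bullet x.(S)\to S[M/x]$; $\mathsf{in}^{\mu X.C}\langle M\rangle\bullet\mathsf{itr}^A_\alpha[K,P]\to(M\bullet\mathsf{mono}^{X.C}_{\mu X.C,A,\beta}\{\mathsf{itr}^A_\alpha[K,\beta],K\}).\alpha\bullet P$; $\mathsf{coitr}^A_x\langle M,N\rangle\bullet\mathsf{out}^{\nu X.C}[P]\to N\bullet x.(\mathsf{mono}^{X.C}_{A,\nu X.C,z}\{\mathsf{coitr}^A_x\langle M,z\rangle,M\}\bullet P)$; $(M\bullet\alpha).\alpha\to M$ and $x.(x\bullet K)\to K$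 ($\alpha$ not free in $M$, $x$ not free in $K$); and, with $x,\alpha$ fresh: $\mathsf{fst}[\mathcal K]\to x.((x\bullet\mathsf{fst}[\alpha]).\alpha\bullet\mathcal K)$; $\mathsf{snd}[\mathcal K]\to x.((x\bullet\mathsf{snd}[\alpha]).\alpha\bullet\mathcal K)$; $[\mathcal K,L]\to x.((x\bullet[\alpha,L]).\alpha\bullet\mathcal K)$; $[P,\mathcal K]\to x.((x\bullet[P,\alpha]).\alpha\bullet\mathcal K)$; $\mathsf{itr}^A_\beta[K,\mathcal K]\to x.((x\bullet\mathsf{itr}^A_\beta[K,\alpha]).\alpha\bullet\mathcal K)$; $\mathsf{out}^{\nu X.C}[\mathcal K]\to x.((x\bullet\mathsf{out}^{\nu X.C}[\alpha]).\alpha\bullet\mathcal K)$. -}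

module Defs where

open import Data.Bool.Base using (Bool; true; false; if_then_else_) renaming (_∨_ to _or_)
open import Data.Fin.Base using (Fin; zero; suc; lift; _↑ʳ_)
open import Data.Fin.Properties using (_≟_; suc-injective)
open import Data.Nat.Base using (ℕ; zero; suc; s≤s; _+_; _<_)
open import Data.Nat.Induction using (<-wellFounded)
open import Data.Nat.Properties using (≤-reflexive; ≤-trans; +-comm; m≤m+n; m≤n+m)
open import Data.Product.Base using (_×_; _,_)
open import Data.Unit.Base using (⊤; tt)
open import Data.Vec.Functional using (_∷_)
open import Function.Base using (id; _∘_)
open import Induction.WellFounded using (Acc; acc)
open import Level using (0ℓ)
open import Relation.Binary.Core using (Rel)
open import Relation.Binary.PropositionalEquality
  using (_≡_; _≢_; refl; trans; cong; cong₂)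
open import Relation.Nullary.Decidable.Core using (does; yes; no)
open import Relation.Nullary.Negation.Core using (¬_; contradiction)

-- Bound names are de Bruijn indices, so identification up to renaming of
-- bound names is propositional equality.  Ty n has its free type variables
-- among n names; index zero of the body is the variable bound by μ or ν.
-- The positivity side condition is an irrelevant argument: a type is
-- determined by its syntax and not by how positivity was established.

infix  4 _∈Pos_ _∈Neg_
infixr 6 _∧ᵗ_ _∨ᵗ_
infix  7 ¬ᵗ_

data Ty (n : ℕ) : Set
_∈Pos_ _∈Neg_ : ∀ {n} → Fin n → Ty n → Set

data Ty n where
  tvar      : Fin n → Ty n
  _∧ᵗ_ _∨ᵗ_ : Ty n → Ty n → Ty n
  ¬ᵗ_       : Ty n → Ty n
  μ ν       : (A : Ty (suc n)) → .(zero ∈Pos A) → Ty n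

-- The clauses Pos (μX.A) = Pos A ∪ {X} and Neg (μX.A) = Neg A ∪ {X} only
-- concern names distinct from the bound one here: a free x is suc x under
-- the binder.

x ∈Pos tvar y   = ⊤
x ∈Pos (A ∧ᵗ B) = x ∈Pos A × x ∈Pos B
x ∈Pos (A ∨ᵗ B) = x ∈Pos A × x ∈Pos B
x ∈Pos (¬ᵗ A)   = x ∈Neg A
x ∈Pos μ A _    = suc x ∈Pos A
x ∈Pos ν A _    = suc x ∈Pos A

x ∈Neg tvar y   = x ≢ y
x ∈Neg (A ∧ᵗ B) = x ∈Neg A × x ∈Neg B
x ∈Neg (A ∨ᵗ B) = x ∈Neg A × x ∈Neg B
x ∈Neg (¬ᵗ A)   = x ∈Pos A
x ∈Neg μ A _    = suc x ∈Neg A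
x ∈Neg ν A _    = suc x ∈Neg A

-- ReflectsAt ρ x y: the only name that ρ can send to y is x.

ReflectsAt : ∀ {n m} → (Fin n → Fin m) → Fin n → Fin m → Set
ReflectsAt ρ x y = ∀ j → y ≡ ρ j → x ≡ j

lift-zero : ∀ {n m} (ρ : Fin n → Fin m) → ReflectsAt (lift 1 ρ) zero zero
lift-zero ρ zero _ = refl

lift-suc : ∀ {n m} {ρ : Fin n → Fin m} {x y} →
           ReflectsAt ρ x y → ReflectsAt (lift 1 ρ) (suc x) (suc y)
lift-suc r (suc j) e = cong suc (r j (suc-injective e))

renT : ∀ {n m} → (Fin n → Fin m) → Ty n → Ty m
renT-Pos : ∀ {n m} {ρ : Fin n → Fin m} {x y} → ReflectsAt ρ x y →
           ∀ A → x ∈Pos A → y ∈Pos renT ρ A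
renT-Neg : ∀ {n m} {ρ : Fin n → Fin m} {x y} → ReflectsAt ρ x y →
           ∀ A → x ∈Neg A → y ∈Neg renT ρ A

renT ρ (tvar x) = tvar (ρ x)
renT ρ (A ∧ᵗ B) = renT ρ A ∧ᵗ renT ρ B
renT ρ (A ∨ᵗ B) = renT ρ A ∨ᵗ renT ρ B
renT ρ (¬ᵗ A)   = ¬ᵗ renT ρ A
renT ρ (μ A p)  = μ (renT (lift 1 ρ) A) (renT-Pos (lift-zero ρ) A p)
renT ρ (ν A p)  = ν (renT (lift 1 ρ) A) (renT-Pos (lift-zero ρ) A p)

renT-Pos r (tvar x) _       = tt
renT-Pos r (A ∧ᵗ B) (p , q) = renT-Pos r A p , renT-Pos r B q
renT-Pos r (A ∨ᵗ B) (p , q) = renT-Pos r A p , renT-Pos r B q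
renT-Pos r (¬ᵗ A)   p       = renT-Neg r A p
renT-Pos r (μ A _)  p       = renT-Pos (lift-suc r) A p
renT-Pos r (ν A _)  p       = renT-Pos (lift-suc r) A p

renT-Neg r (tvar x) p       = p ∘ r x
renT-Neg r (A ∧ᵗ B) (p , q) = renT-Neg r A p , renT-Neg r B q
renT-Neg r (A ∨ᵗ B) (p , q) = renT-Neg r A p , renT-Neg r B q
renT-Neg r (¬ᵗ A)   p       = renT-Pos r A p
renT-Neg r (μ A _)  p       = renT-Neg (lift-suc r) A p
renT-Neg r (ν A _)  p       = renT-Neg (lift-suc r) A p

wkT : ∀ {n} → Ty n → Ty (suc n)
wkT = renT suc

fresh-Pos : ∀ {n m} {ρ : Fin n → Fin m} {y} → (∀ j → y ≢ ρ j) →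
            ∀ A → y ∈Pos renT ρ A
fresh-Neg : ∀ {n m} {ρ : Fin n → Fin m} {y} → (∀ j → y ≢ ρ j) →
            ∀ A → y ∈Neg renT ρ A

lift-fresh : ∀ {n m} {ρ : Fin n → Fin m} {y} → (∀ j → y ≢ ρ j) →
             ∀ j → suc y ≢ lift 1 ρ j
lift-fresh f (suc j) e = f j (suc-injective e)

fresh-Pos f (tvar x) = tt
fresh-Pos f (A ∧ᵗ B) = fresh-Pos f A , fresh-Pos f B
fresh-Pos f (A ∨ᵗ B) = fresh-Pos f A , fresh-Pos f B
fresh-Pos f (¬ᵗ A)   = fresh-Neg f A
fresh-Pos f (μ A _)  = fresh-Pos (lift-fresh f) A
fresh-Pos f (ν A _)  = fresh-Pos (lift-fresh f) A

fresh-Neg f (tvar x) = f x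
fresh-Neg f (A ∧ᵗ B) = fresh-Neg f A , fresh-Neg f B
fresh-Neg f (A ∨ᵗ B) = fresh-Neg f A , fresh-Neg f B
fresh-Neg f (¬ᵗ A)   = fresh-Pos f A
fresh-Neg f (μ A _)  = fresh-Neg (lift-fresh f) A
fresh-Neg f (ν A _)  = fresh-Neg (lift-fresh f) A

liftsT : ∀ {n m} → (Fin n → Ty m) → Fin (suc n) → Ty (suc m)
liftsT σ = tvar zero ∷ (wkT ∘ σ)

-- y may occur in the types substituted by σ only positively, and only in
-- the one substituted for x.

Polarised : ∀ {n m} → (Fin n → Ty m) → Fin n → Fin m → Set
Polarised σ x y = (∀ j → y ∈Pos σ j) × (∀ j → x ≢ j → y ∈Neg σ j)

liftsT-zero : ∀ {n m} (σ : Fin n → Ty m) → Polarised (liftsT σ) zero zero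
liftsT-zero σ = (λ { zero → tt ; (suc j) → fresh-Pos (λ _ ()) (σ j) })
              , (λ { zero e → contradiction refl e ; (suc j) _ → fresh-Neg (λ _ ()) (σ j) })

liftsT-suc : ∀ {n m} {σ : Fin n → Ty m} {x y} →
             Polarised σ x y → Polarised (liftsT σ) (suc x) (suc y)
liftsT-suc {σ = σ} (p , q) =
    (λ { zero → tt ; (suc j) → renT-Pos (λ _ → suc-injective) (σ j) (p j) })
  , (λ { zero _ () ; (suc j) e → renT-Neg (λ _ → suc-injective) (σ j) (q j (e ∘ cong suc)) })

subT : ∀ {n m} → (Fin n → Ty m) → Ty n → Ty m
subT-Pos : ∀ {n m} {σ : Fin n → Ty m} {x y} → Polarised σ x y →
           ∀ A → x ∈Pos A → y ∈Pos subT σ A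
subT-Neg : ∀ {n m} {σ : Fin n → Ty m} {x y} → Polarised σ x y →
           ∀ A → x ∈Neg A → y ∈Neg subT σ A

subT σ (tvar x) = σ x
subT σ (A ∧ᵗ B) = subT σ A ∧ᵗ subT σ B
subT σ (A ∨ᵗ B) = subT σ A ∨ᵗ subT σ B
subT σ (¬ᵗ A)   = ¬ᵗ subT σ A
subT σ (μ A p)  = μ (subT (liftsT σ) A) (subT-Pos (liftsT-zero σ) A p)
subT σ (ν A p)  = ν (subT (liftsT σ) A) (subT-Pos (liftsT-zero σ) A p)

subT-Pos (r , s) (tvar x) _       = r x
subT-Pos r       (A ∧ᵗ B) (p , q) = subT-Pos r A p , subT-Pos r B q
subT-Pos r       (A ∨ᵗ B) (p , q) = subT-Pos r A p , subT-Pos r B q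
subT-Pos r       (¬ᵗ A)   p       = subT-Neg r A p
subT-Pos r       (μ A _)  p       = subT-Pos (liftsT-suc r) A p
subT-Pos r       (ν A _)  p       = subT-Pos (liftsT-suc r) A p

subT-Neg (r , s) (tvar x) p       = s x p
subT-Neg r       (A ∧ᵗ B) (p , q) = subT-Neg r A p , subT-Neg r B q
subT-Neg r       (A ∨ᵗ B) (p , q) = subT-Neg r A p , subT-Neg r B q
subT-Neg r       (¬ᵗ A)   p       = subT-Pos r A p
subT-Neg r       (μ A _)  p       = subT-Neg (liftsT-suc r) A p
subT-Neg r       (ν A _)  p       = subT-Neg (liftsT-suc r) A p

infixl 8 _[_]ᵗ

_[_]ᵗ : ∀ {n} → Ty (suc n) → Ty n → Ty n
A [ B ]ᵗ = subT (B ∷ tvar) A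

dualT : ∀ {n} → Ty n → Ty n
dualT-Pos : ∀ {n} {x : Fin n} A → x ∈Pos A → x ∈Pos dualT A
dualT-Neg : ∀ {n} {x : Fin n} A → x ∈Neg A → x ∈Neg dualT A

dualT (tvar x) = tvar x
dualT (A ∧ᵗ B) = dualT A ∨ᵗ dualT B
dualT (A ∨ᵗ B) = dualT A ∧ᵗ dualT B
dualT (¬ᵗ A)   = ¬ᵗ dualT A
dualT (μ A p)  = ν (dualT A) (dualT-Pos A p)
dualT (ν A p)  = μ (dualT A) (dualT-Pos A p)

dualT-Pos (tvar x) _       = tt
dualT-Pos (A ∧ᵗ B) (p , q) = dualT-Pos A p , dualT-Pos B q
dualT-Pos (A ∨ᵗ B) (p , q) = dualT-Pos A p , dualT-Pos B q
dualT-Pos (¬ᵗ A)   p       = dualT-Neg A p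
dualT-Pos (μ A _)  p       = dualT-Pos A p
dualT-Pos (ν A _)  p       = dualT-Pos A p

dualT-Neg (tvar x) p       = p
dualT-Neg (A ∧ᵗ B) (p , q) = dualT-Neg A p , dualT-Neg B q
dualT-Neg (A ∨ᵗ B) (p , q) = dualT-Neg A p , dualT-Neg B q
dualT-Neg (¬ᵗ A)   p       = dualT-Pos A p
dualT-Neg (μ A _)  p       = dualT-Neg A p
dualT-Neg (ν A _)  p       = dualT-Neg A p

-- Expr k s n m: expressions of sort s with free type variables, variables
-- and covariables among k, n and m names respectively.  The involution
-- between variables and covariables keeps the index, so duality exchanges
-- the two scopes.

data Sort : Set where
  term coterm statement : Sort

infix 5 _•_

data Expr (k : ℕ) : Sort → ℕ → ℕ → Set

Term Coterm Statement : ℕ → ℕ → ℕ → Set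
Term k      = Expr k term
Coterm k    = Expr k coterm
Statement k = Expr k statement

-- ⟪ S ⟫·α is (S).α and x·⟪ S ⟫ is x.(S).  In coitr A M N only M is under
-- the bound variable; in itr A K L only K is under the bound covariable.

data Expr k where
  var    : ∀ {n m} → Fin n → Term k n m
  ⟨_,_⟩  : ∀ {n m} → Term k n m → Term k n m → Term k n m
  ⟨_⟩inl : ∀ {n m} → Term k n m → Term k n m
  ⟨_⟩inr : ∀ {n m} → Term k n m → Term k n m
  [_]not : ∀ {n m} → Coterm k n m → Term k n m
  ⟪_⟫·α  : ∀ {n m} → Statement k n (suc m) → Term k n m
  inμ    : ∀ {n m} (A : Ty (suc k)) → .(zero ∈Pos A) → Term k n m → Term k n m
  coitr  : ∀ {n m} → Ty k → Term k (suc n) m → Term k n m → Term k n m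

  covar  : ∀ {n m} → Fin m → Coterm k n m
  [_,_]  : ∀ {n m} → Coterm k n m → Coterm k n m → Coterm k n m
  fst[_] : ∀ {n m} → Coterm k n m → Coterm k n m
  snd[_] : ∀ {n m} → Coterm k n m → Coterm k n m
  not⟨_⟩ : ∀ {n m} → Term k n m → Coterm k n m
  x·⟪_⟫  : ∀ {n m} → Statement k (suc n) m → Coterm k n m
  outν   : ∀ {n m} (A : Ty (suc k)) → .(zero ∈Pos A) → Coterm k n m → Coterm k n m
  itr    : ∀ {n m} → Ty k → Coterm k n (suc m) → Coterm k n m → Coterm k n m

  _•_    : ∀ {n m} → Term k n m → Coterm k n m → Statement k n m

ren : ∀ {k s n m n′ m′} → (Fin n → Fin n′) → (Fin m → Fin m′) →
      Expr k s n m → Expr k s n′ m′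
ren ρ θ (var x)       = var (ρ x)
ren ρ θ ⟨ M , N ⟩     = ⟨ ren ρ θ M , ren ρ θ N ⟩
ren ρ θ ⟨ M ⟩inl      = ⟨ ren ρ θ M ⟩inl
ren ρ θ ⟨ M ⟩inr      = ⟨ ren ρ θ M ⟩inr
ren ρ θ [ K ]not      = [ ren ρ θ K ]not
ren ρ θ ⟪ S ⟫·α       = ⟪ ren ρ (lift 1 θ) S ⟫·α
ren ρ θ (inμ A p M)   = inμ A p (ren ρ θ M)
ren ρ θ (coitr A M N) = coitr A (ren (lift 1 ρ) θ M) (ren ρ θ N)
ren ρ θ (covar α)     = covar (θ α)
ren ρ θ [ K , L ]     = [ ren ρ θ K , ren ρ θ L ]
ren ρ θ fst[ K ]      = fst[ ren ρ θ K ]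
ren ρ θ snd[ K ]      = snd[ ren ρ θ K ]
ren ρ θ not⟨ M ⟩      = not⟨ ren ρ θ M ⟩
ren ρ θ x·⟪ S ⟫       = x·⟪ ren (lift 1 ρ) θ S ⟫
ren ρ θ (outν A p K)  = outν A p (ren ρ θ K)
ren ρ θ (itr A K L)   = itr A (ren ρ (lift 1 θ) K) (ren ρ θ L)
ren ρ θ (M • K)       = ren ρ θ M • ren ρ θ K

wkˣ : ∀ {k s n m} → Expr k s n m → Expr k s (suc n) m
wkˣ = ren suc id

wkᵅ : ∀ {k s n m} → Expr k s n m → Expr k s n (suc m)
wkᵅ = ren id suc

sub : ∀ {k s n m n′ m′} → (Fin n → Term k n′ m′) → (Fin m → Coterm k n′ m′) →
      Expr k s n m → Expr k s n′ m′
sub σ τ (var x)       = σ x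
sub σ τ ⟨ M , N ⟩     = ⟨ sub σ τ M , sub σ τ N ⟩
sub σ τ ⟨ M ⟩inl      = ⟨ sub σ τ M ⟩inl
sub σ τ ⟨ M ⟩inr      = ⟨ sub σ τ M ⟩inr
sub σ τ [ K ]not      = [ sub σ τ K ]not
sub σ τ ⟪ S ⟫·α       = ⟪ sub (wkᵅ ∘ σ) (covar zero ∷ (wkᵅ ∘ τ)) S ⟫·α
sub σ τ (inμ A p M)   = inμ A p (sub σ τ M)
sub σ τ (coitr A M N) = coitr A (sub (var zero ∷ (wkˣ ∘ σ)) (wkˣ ∘ τ) M) (sub σ τ N)
sub σ τ (covar α)     = τ α
sub σ τ [ K , L ]     = [ sub σ τ K , sub σ τ L ]
sub σ τ fst[ K ]      = fst[ sub σ τ K ]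
sub σ τ snd[ K ]      = snd[ sub σ τ K ]
sub σ τ not⟨ M ⟩      = not⟨ sub σ τ M ⟩
sub σ τ x·⟪ S ⟫       = x·⟪ sub (var zero ∷ (wkˣ ∘ σ)) (wkˣ ∘ τ) S ⟫
sub σ τ (outν A p K)  = outν A p (sub σ τ K)
sub σ τ (itr A K L)   = itr A (sub (wkᵅ ∘ σ) (covar zero ∷ (wkᵅ ∘ τ)) K) (sub σ τ L)
sub σ τ (M • K)       = sub σ τ M • sub σ τ K

infixl 8 _[_/x] _[_/α]

_[_/x] : ∀ {k s n m} → Expr k s (suc n) m → Term k n m → Expr k s n m
E [ M /x] = sub (M ∷ var) covar E

_[_/α] : ∀ {k s n m} → Expr k s n (suc m) → Coterm k n m → Expr k s n m
E [ K /α] = sub var (K ∷ covar) E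

dualSort : Sort → Sort
dualSort term      = coterm
dualSort coterm    = term
dualSort statement = statement

dual : ∀ {k s n m} → Expr k s n m → Expr k (dualSort s) m n
dual (var x)       = covar x
dual ⟨ M , N ⟩     = [ dual M , dual N ]
dual ⟨ M ⟩inl      = fst[ dual M ]
dual ⟨ M ⟩inr      = snd[ dual M ]
dual [ K ]not      = not⟨ dual K ⟩
dual ⟪ S ⟫·α       = x·⟪ dual S ⟫
dual (inμ A p M)   = outν (dualT A) (dualT-Pos A p) (dual M)
dual (coitr A M N) = itr (dualT A) (dual M) (dual N)
dual (covar α)     = var α
dual [ K , L ]     = ⟨ dual K , dual L ⟩
dual fst[ K ]      = ⟨ dual K ⟩inl
dual snd[ K ]      = ⟨ dual K ⟩inr
dual not⟨ M ⟩      = [ dual M ]not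
dual x·⟪ S ⟫       = ⟪ dual S ⟫·α
dual (outν A p K)  = inμ (dualT A) (dualT-Pos A p) (dual K)
dual (itr A K L)   = coitr (dualT A) (dual K) (dual L)
dual (M • K)       = dual K • dual M

occurs : ∀ {n} → Fin n → Ty n → Bool
occurs x (tvar y) = does (x ≟ y)
occurs x (A ∧ᵗ B) = occurs x A or occurs x B
occurs x (A ∨ᵗ B) = occurs x A or occurs x B
occurs x (¬ᵗ A)   = occurs x A
occurs x (μ A _)  = occurs (suc x) A
occurs x (ν A _)  = occurs (suc x) A

-- ‖ A ‖ x is zero when x is not free in A and ‖ A ‖′ x otherwise; the
-- latter is meaningful only when x is free in A.

‖_‖ ‖_‖′ : ∀ {n} → Ty n → Fin n → ℕ

‖ A ‖ x = if occurs x A then ‖ A ‖′ x else 0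

‖ tvar y ‖′ x = 1
‖ A ∧ᵗ B ‖′ x = ‖ A ‖ x + ‖ B ‖ x + 1
‖ A ∨ᵗ B ‖′ x = ‖ A ‖ x + ‖ B ‖ x + 1
‖ ¬ᵗ A ‖′   x = ‖ A ‖ x + 1
‖ μ A _ ‖′  x = ‖ A ‖ (suc x) + ‖ A ‖ zero + 1
‖ ν A _ ‖′  x = ‖ A ‖ (suc x) + ‖ A ‖ zero + 1

-- Replaces σ x y: σ sends x to the variable y, and y does not occur in
-- anything else that σ substitutes.

Replaces : ∀ {n m} → (Fin n → Ty m) → Fin n → Fin m → Set
Replaces σ x y = ∀ j → occurs y (σ j) ≡ does (x ≟ j) × (x ≡ j → σ j ≡ tvar y)

occurs-renT : ∀ {n m} {ρ : Fin n → Fin m} {x y} →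
              (∀ j → does (y ≟ ρ j) ≡ does (x ≟ j)) →
              ∀ A → occurs y (renT ρ A) ≡ occurs x A
occurs-renT r (tvar j) = r j
occurs-renT r (A ∧ᵗ B) = cong₂ _or_ (occurs-renT r A) (occurs-renT r B)
occurs-renT r (A ∨ᵗ B) = cong₂ _or_ (occurs-renT r A) (occurs-renT r B)
occurs-renT r (¬ᵗ A)   = occurs-renT r A
occurs-renT r (μ A _)  = occurs-renT (λ { zero → refl ; (suc j) → r j }) A
occurs-renT r (ν A _)  = occurs-renT (λ { zero → refl ; (suc j) → r j }) A

occurs-fresh : ∀ {n m} {ρ : Fin n → Fin m} {y} →
               (∀ j → does (y ≟ ρ j) ≡ false) →
               ∀ A → occurs y (renT ρ A) ≡ false
occurs-fresh r (tvar j) = r j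
occurs-fresh r (A ∧ᵗ B) = cong₂ _or_ (occurs-fresh r A) (occurs-fresh r B)
occurs-fresh r (A ∨ᵗ B) = cong₂ _or_ (occurs-fresh r A) (occurs-fresh r B)
occurs-fresh r (¬ᵗ A)   = occurs-fresh r A
occurs-fresh r (μ A _)  = occurs-fresh (λ { zero → refl ; (suc j) → r j }) A
occurs-fresh r (ν A _)  = occurs-fresh (λ { zero → refl ; (suc j) → r j }) A

Replaces-zero : ∀ {n m} (σ : Fin n → Ty m) → Replaces (liftsT σ) zero zero
Replaces-zero σ zero    = refl , λ _ → refl
Replaces-zero σ (suc j) = occurs-fresh (λ _ → refl) (σ j) , λ ()

Replaces-suc : ∀ {n m} {σ : Fin n → Ty m} {x y} →
               Replaces σ x y → Replaces (liftsT σ) (suc x) (suc y)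
Replaces-suc r zero = refl , λ ()
Replaces-suc {σ = σ} r (suc j) with r j
... | p , q = trans (occurs-renT (λ _ → refl) (σ j)) p , λ e → cong wkT (q (suc-injective e))

occurs-subT : ∀ {n m} {σ : Fin n → Ty m} {x y} → Replaces σ x y →
              ∀ A → occurs y (subT σ A) ≡ occurs x A
occurs-subT r (tvar j) with r j
... | p , _ = p
occurs-subT r (A ∧ᵗ B) = cong₂ _or_ (occurs-subT r A) (occurs-subT r B)
occurs-subT r (A ∨ᵗ B) = cong₂ _or_ (occurs-subT r A) (occurs-subT r B)
occurs-subT r (¬ᵗ A)   = occurs-subT r A
occurs-subT r (μ A _)  = occurs-subT (Replaces-suc r) A
occurs-subT r (ν A _)  = occurs-subT (Replaces-suc r) A

if-cong : ∀ {b c : Bool} {i j : ℕ} → b ≡ c → (c ≡ true → i ≡ j) →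
          (if b then i else 0) ≡ (if c then j else 0)
if-cong {true}  refl e = e refl
if-cong {false} refl e = refl

does-true : ∀ {n} (x j : Fin n) → does (x ≟ j) ≡ true → x ≡ j
does-true x j _  with x ≟ j
does-true x j _  | yes e = e
does-true x j () | no _

‖‖-subT  : ∀ {n m} {σ : Fin n → Ty m} {x y} → Replaces σ x y →
           ∀ A → ‖ subT σ A ‖ y ≡ ‖ A ‖ x
‖‖′-subT : ∀ {n m} {σ : Fin n → Ty m} {x y} → Replaces σ x y →
           ∀ A → occurs x A ≡ true → ‖ subT σ A ‖′ y ≡ ‖ A ‖′ x

‖‖-subT r A = if-cong (occurs-subT r A) (‖‖′-subT r A)

‖‖′-subT {x = x} {y} r (tvar j) o with r j
... | _ , q = cong (λ B → ‖ B ‖′ y) (q (does-true x j o))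
‖‖′-subT r (A ∧ᵗ B) _ = cong (_+ 1) (cong₂ _+_ (‖‖-subT r A) (‖‖-subT r B))
‖‖′-subT r (A ∨ᵗ B) _ = cong (_+ 1) (cong₂ _+_ (‖‖-subT r A) (‖‖-subT r B))
‖‖′-subT r (¬ᵗ A)   _ = cong (_+ 1) (‖‖-subT r A)
‖‖′-subT {σ = σ} r (μ A _) _ =
  cong (_+ 1) (cong₂ _+_ (‖‖-subT (Replaces-suc r) A) (‖‖-subT (Replaces-zero σ) A))
‖‖′-subT {σ = σ} r (ν A _) _ =
  cong (_+ 1) (cong₂ _+_ (‖‖-subT (Replaces-suc r) A) (‖‖-subT (Replaces-zero σ) A))

-- C [ D /Y] is C[D/Y] for X = suc zero and Y = zero in C, and X not free
-- in D; X becomes zero in the result.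

infixl 8 _[_/Y]

_[_/Y] : ∀ {k} → Ty (suc (suc k)) → Ty k → Ty (suc k)
C [ D /Y] = C [ wkT D ]ᵗ

-- (C [ B /X]) is C[B/X] under the binder of Y, for the same C, with X and Y
-- not free in B; Y remains zero in the result.

infixl 8 _[_/X]

_[_/X] : ∀ {k} → Ty (suc (suc k)) → Ty k → Ty (suc k)
C [ B /X] = subT (liftsT (B ∷ tvar)) C

[/X]-Pos : ∀ {k} (C : Ty (suc (suc k))) (B : Ty k) → zero ∈Pos C → zero ∈Pos C [ B /X]
[/X]-Pos C B = subT-Pos (liftsT-zero (B ∷ tvar)) C

<-left : ∀ i j → i < i + j + 1
<-left i j = ≤-trans (s≤s (m≤m+n i j)) (≤-reflexive (+-comm 1 (i + j)))

<-suc : ∀ i → i < i + 1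
<-suc i = ≤-reflexive (+-comm 1 i)

<-right : ∀ i j → j < i + j + 1
<-right i j = ≤-trans (s≤s (m≤n+m j i)) (≤-reflexive (+-comm 1 (i + j)))

‖‖-occurs : ∀ {n} (C : Ty n) (x : Fin n) → occurs x C ≡ true → ‖ C ‖ x ≡ ‖ C ‖′ x
‖‖-occurs C x o = cong (λ b → if b then ‖ C ‖′ x else 0) o

Replaces-/Y : ∀ {k} (D : Ty k) → Replaces (wkT D ∷ tvar) (suc zero) zero
Replaces-/Y D zero          = occurs-fresh (λ _ → refl) D , λ ()
Replaces-/Y D (suc zero)    = refl , λ _ → refl
Replaces-/Y D (suc (suc j)) = refl , λ ()

<-unfold : ∀ {k} (C : Ty (suc (suc k))) (D : Ty k) →
           ‖ C [ D /Y] ‖ zero < ‖ C ‖ (suc zero) + ‖ C ‖ zero + 1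
<-unfold C D = ≤-trans (s≤s (≤-reflexive (‖‖-subT (Replaces-/Y D) C))) (<-left _ _)

-- In C the name X is zero; A and B live in the smaller scope, so X is not
-- free in them.  The first index of the Term M is x.  The accessibility
-- argument carries the recursion on ‖ C ‖ zero; mono-occ holds the clauses
-- for X occurring in C.

mono-acc : ∀ {k n m} (C : Ty (suc k)) → Acc _<_ (‖ C ‖ zero) →
           (A B : Ty k) → Term k (suc n) m → Term k n m → Term k n m

mono-occ : ∀ {k n m} (C : Ty (suc k)) → occurs zero C ≡ true → Acc _<_ (‖ C ‖′ zero) →
           (A B : Ty k) → Term k (suc n) m → Term k n m → Term k n m

mono-acc C a A B M N with occurs zero C in o
... | false = N
... | true  = mono-occ C o a A B M N

mono-occ (tvar zero) _ _ A B M N =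
  ⟪ wkᵅ N • x·⟪ wkᵅ M • covar zero ⟫ ⟫·α
mono-occ (C ∧ᵗ D) _ (acc rs) A B M N =
  ⟨ mono-acc C (rs (<-left _ _)) A B M ⟪ wkᵅ N • fst[ covar zero ] ⟫·α
  , mono-acc D (rs (<-right _ _)) A B M ⟪ wkᵅ N • snd[ covar zero ] ⟫·α ⟩
mono-occ (C ∨ᵗ D) _ (acc rs) A B M N =
  let M↑ = ren (lift 1 suc) suc M in
  ⟪ wkᵅ N • [ x·⟪ ⟨ mono-acc C (rs (<-left _ _)) A B M↑ (var zero) ⟩inl • covar zero ⟫
            , x·⟪ ⟨ mono-acc D (rs (<-right _ _)) A B M↑ (var zero) ⟩inr • covar zero ⟫ ] ⟫·α
mono-occ (¬ᵗ C) _ (acc rs) A B M N =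
  let M↑ = ren (lift 1 suc) id M in
  [ x·⟪ wkˣ N • not⟨ mono-acc C (rs (<-suc _)) B A M↑ (var zero) ⟩ ⟫ ]not
mono-occ (μ C p) _ (acc rs) A B M N =
  let D  = μ (C [ B /X]) ([/X]-Pos C B p)
      M↑ = ren (lift 1 suc) (2 ↑ʳ_) M in
  ⟪ wkᵅ N • itr D x·⟪ inμ (C [ B /X]) ([/X]-Pos C B p)
                          (mono-acc (C [ D /Y]) (rs (<-unfold C D)) A B M↑ (var zero))
                      • covar zero ⟫
                  (covar zero) ⟫·α
mono-occ (ν C p) _ (acc rs) A B M N =
  let D  = ν (C [ A /X]) ([/X]-Pos C A p)
      M↑ = ren (lift 1 suc) id M in
  coitr D (mono-acc (C [ D /Y]) (rs (<-unfold C D)) A B M↑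
                    ⟪ var zero • outν (C [ A /X]) ([/X]-Pos C A p) (covar zero) ⟫·α)
          N

-- mono C A B M N is mono^{X.C}_{A,B,x.M}{N}, and comono C A B K L is
-- mono^{X.C}_{A,B,α.K}{L}.

mono : ∀ {k n m} (C : Ty (suc k)) (A B : Ty k) →
       Term k (suc n) m → Term k n m → Term k n m
mono C = mono-acc C (<-wellFounded (‖ C ‖ zero))

comono : ∀ {k n m} (C : Ty (suc k)) (A B : Ty k) →
         Coterm k n (suc m) → Coterm k n m → Coterm k n m
comono C A B K L = dual (mono (dualT C) (dualT B) (dualT A) (dual K) (dual L))

data Value {k n m} : Term k n m → Set where
  var    : ∀ {x} → Value (var x)
  ⟨_,_⟩  : ∀ {V W} → Value V → Value W → Value ⟨ V , W ⟩
  ⟨_⟩inl : ∀ {V} → Value V → Value ⟨ V ⟩inl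
  ⟨_⟩inr : ∀ {V} → Value V → Value ⟨ V ⟩inr
  [_]not : ∀ K → Value [ K ]not
  inμ    : ∀ A .p {V} → Value V → Value (inμ A p V)
  coitr  : ∀ A M {V} → Value V → Value (coitr A M V)

data Covalue {k n m} : Coterm k n m → Set where
  covar  : ∀ {α} → Covalue (covar α)
  [_,_]  : ∀ {P Q} → Covalue P → Covalue Q → Covalue [ P , Q ]
  fst[_] : ∀ {P} → Covalue P → Covalue fst[ P ]
  snd[_] : ∀ {P} → Covalue P → Covalue snd[ P ]
  not⟨_⟩ : ∀ M → Covalue not⟨ M ⟩
  outν   : ∀ A .p {P} → Covalue P → Covalue (outν A p P)
  itr    : ∀ A K {P} → Covalue P → Covalue (itr A K P)

-- The contracta of the redexes in⟨M⟩ • itr[K,L] and coitr⟨M,N⟩ • out[K],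
-- shared by the two strategies.

μ-contractum : ∀ {k n m} (C : Ty (suc k)) .(p : zero ∈Pos C) → Term k n m →
               Ty k → Coterm k n (suc m) → Coterm k n m → Statement k n m
μ-contractum C p M A K L =
  ⟪ wkᵅ M • comono C (μ C p) A (itr A (ren id (lift 1 (2 ↑ʳ_)) K) (covar zero)) K ⟫·α • L

ν-contractum : ∀ {k n m} (C : Ty (suc k)) .(p : zero ∈Pos C) →
               Ty k → Term k (suc n) m → Term k n m → Coterm k n m → Statement k n m
ν-contractum C p A M N K =
  N • x·⟪ mono C A (ν C p) (coitr A (ren (lift 1 (2 ↑ʳ_)) id M) (var zero)) M • wkˣ K ⟫

infix 4 _▷ᵛ_ _▷ⁿ_

data _▷ᵛ_ {k n m} : ∀ {s} → Rel (Expr k s n m) 0ℓ where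
  β-fst : ∀ {V W K} → Value V → Value W → ⟨ V , W ⟩ • fst[ K ] ▷ᵛ V • K
  β-snd : ∀ {V W K} → Value V → Value W → ⟨ V , W ⟩ • snd[ K ] ▷ᵛ W • K
  β-inl : ∀ {V K L} → Value V → ⟨ V ⟩inl • [ K , L ] ▷ᵛ V • K
  β-inr : ∀ {W K L} → Value W → ⟨ W ⟩inr • [ K , L ] ▷ᵛ W • L
  β-not : ∀ {K M} → [ K ]not • not⟨ M ⟩ ▷ᵛ M • K
  β-α   : ∀ {S K} → ⟪ S ⟫·α • K ▷ᵛ S [ K /α]
  β-x   : ∀ {V S} → Value V → V • x·⟪ S ⟫ ▷ᵛ S [ V /x]
  β-μ   : ∀ {C} .{p} {V A K L} → Value V →
          inμ C p V • itr A K L ▷ᵛ μ-contractum C p V A K L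
  β-ν   : ∀ {C} .{p} {A M V K} → Value V →
          coitr A M V • outν C p K ▷ᵛ ν-contractum C p A M V K
  η-α   : ∀ {M} → ⟪ wkᵅ M • covar zero ⟫·α ▷ᵛ M
  η-x   : ∀ {K} → x·⟪ var zero • wkˣ K ⟫ ▷ᵛ K
  ς-⟨,⟩ˡ  : ∀ {M N} → ¬ Value M →
            ⟨ M , N ⟩ ▷ᵛ ⟪ wkᵅ M • x·⟪ ⟨ var zero , wkˣ (wkᵅ N) ⟩ • covar zero ⟫ ⟫·α
  ς-⟨,⟩ʳ  : ∀ {V M} → Value V → ¬ Value M →
            ⟨ V , M ⟩ ▷ᵛ ⟪ wkᵅ M • x·⟪ ⟨ wkˣ (wkᵅ V) , var zero ⟩ • covar zero ⟫ ⟫·α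
  ς-inl   : ∀ {M} → ¬ Value M →
            ⟨ M ⟩inl ▷ᵛ ⟪ wkᵅ M • x·⟪ ⟨ var zero ⟩inl • covar zero ⟫ ⟫·α
  ς-inr   : ∀ {M} → ¬ Value M →
            ⟨ M ⟩inr ▷ᵛ ⟪ wkᵅ M • x·⟪ ⟨ var zero ⟩inr • covar zero ⟫ ⟫·α
  ς-in    : ∀ {C} .{p} {M} → ¬ Value M →
            inμ C p M ▷ᵛ ⟪ wkᵅ M • x·⟪ inμ C p (var zero) • covar zero ⟫ ⟫·α
  ς-coitr : ∀ {A M N} → ¬ Value N →
            coitr A M N ▷ᵛ
            ⟪ wkᵅ N • x·⟪ coitr A (ren (lift 1 suc) suc M) (var zero) • covar zero ⟫ ⟫·α

data _▷ⁿ_ {k n m} : ∀ {s} → Rel (Expr k s n m) 0ℓ where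
  β-fst : ∀ {M N P} → Covalue P → ⟨ M , N ⟩ • fst[ P ] ▷ⁿ M • P
  β-snd : ∀ {M N P} → Covalue P → ⟨ M , N ⟩ • snd[ P ] ▷ⁿ N • P
  β-inl : ∀ {M P Q} → Covalue P → Covalue Q → ⟨ M ⟩inl • [ P , Q ] ▷ⁿ M • P
  β-inr : ∀ {M P Q} → Covalue P → Covalue Q → ⟨ M ⟩inr • [ P , Q ] ▷ⁿ M • Q
  β-not : ∀ {K M} → [ K ]not • not⟨ M ⟩ ▷ⁿ M • K
  β-α   : ∀ {S P} → Covalue P → ⟪ S ⟫·α • P ▷ⁿ S [ P /α]
  β-x   : ∀ {M S} → M • x·⟪ S ⟫ ▷ⁿ S [ M /x]
  β-μ   : ∀ {C} .{p} {M A K P} → Covalue P →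
          inμ C p M • itr A K P ▷ⁿ μ-contractum C p M A K P
  β-ν   : ∀ {C} .{p} {A M N P} → Covalue P →
          coitr A M N • outν C p P ▷ⁿ ν-contractum C p A M N P
  η-α   : ∀ {M} → ⟪ wkᵅ M • covar zero ⟫·α ▷ⁿ M
  η-x   : ∀ {K} → x·⟪ var zero • wkˣ K ⟫ ▷ⁿ K
  ς-fst   : ∀ {K} → ¬ Covalue K →
            fst[ K ] ▷ⁿ x·⟪ ⟪ var zero • fst[ covar zero ] ⟫·α • wkˣ K ⟫
  ς-snd   : ∀ {K} → ¬ Covalue K →
            snd[ K ] ▷ⁿ x·⟪ ⟪ var zero • snd[ covar zero ] ⟫·α • wkˣ K ⟫
  ς-[,]ˡ  : ∀ {K L} → ¬ Covalue K →
            [ K , L ] ▷ⁿ x·⟪ ⟪ var zero • [ covar zero , wkᵅ (wkˣ L) ] ⟫·α • wkˣ K ⟫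
  ς-[,]ʳ  : ∀ {P K} → Covalue P → ¬ Covalue K →
            [ P , K ] ▷ⁿ x·⟪ ⟪ var zero • [ wkᵅ (wkˣ P) , covar zero ] ⟫·α • wkˣ K ⟫
  ς-itr   : ∀ {A K L} → ¬ Covalue L →
            itr A K L ▷ⁿ
            x·⟪ ⟪ var zero • itr A (ren suc (lift 1 suc) K) (covar zero) ⟫·α • wkˣ L ⟫
  ς-out   : ∀ {C} .{p} {K} → ¬ Covalue K →
            outν C p K ▷ⁿ x·⟪ ⟪ var zero • outν C p (covar zero) ⟫·α • wkˣ K ⟫

data Compatible {k} (R : ∀ {s n m} → Rel (Expr k s n m) 0ℓ) :
                ∀ {s n m} → Rel (Expr k s n m) 0ℓ where
  rule   : ∀ {s n m} {D E : Expr k s n m} → R D E → Compatible R D E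

  ⟨_,_⟩ˡ : ∀ {n m} {M M′ : Term k n m} → Compatible R M M′ → ∀ N →
           Compatible R ⟨ M , N ⟩ ⟨ M′ , N ⟩
  ⟨_,_⟩ʳ : ∀ {n m} M {N N′ : Term k n m} → Compatible R N N′ →
           Compatible R ⟨ M , N ⟩ ⟨ M , N′ ⟩
  ⟨_⟩inl : ∀ {n m} {M M′ : Term k n m} → Compatible R M M′ →
           Compatible R ⟨ M ⟩inl ⟨ M′ ⟩inl
  ⟨_⟩inr : ∀ {n m} {M M′ : Term k n m} → Compatible R M M′ →
           Compatible R ⟨ M ⟩inr ⟨ M′ ⟩inr
  [_]not : ∀ {n m} {K K′ : Coterm k n m} → Compatible R K K′ →
           Compatible R [ K ]not [ K′ ]not
  ⟪_⟫·α  : ∀ {n m} {S S′ : Statement k n (suc m)} → Compatible R S S′ →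
           Compatible R ⟪ S ⟫·α ⟪ S′ ⟫·α
  inμ    : ∀ {n m} A .p {M M′ : Term k n m} → Compatible R M M′ →
           Compatible R (inμ A p M) (inμ A p M′)
  coitrˡ : ∀ {n m} A {M M′ : Term k (suc n) m} → Compatible R M M′ → ∀ N →
           Compatible R (coitr A M N) (coitr A M′ N)
  coitrʳ : ∀ {n m} A M {N N′ : Term k n m} → Compatible R N N′ →
           Compatible R (coitr A M N) (coitr A M N′)

  [_,_]ˡ : ∀ {n m} {K K′ : Coterm k n m} → Compatible R K K′ → ∀ L →
           Compatible R [ K , L ] [ K′ , L ]
  [_,_]ʳ : ∀ {n m} K {L L′ : Coterm k n m} → Compatible R L L′ →
           Compatible R [ K , L ] [ K , L′ ]
  fst[_] : ∀ {n m} {K K′ : Coterm k n m} → Compatible R K K′ →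
           Compatible R fst[ K ] fst[ K′ ]
  snd[_] : ∀ {n m} {K K′ : Coterm k n m} → Compatible R K K′ →
           Compatible R snd[ K ] snd[ K′ ]
  not⟨_⟩ : ∀ {n m} {M M′ : Term k n m} → Compatible R M M′ →
           Compatible R not⟨ M ⟩ not⟨ M′ ⟩
  x·⟪_⟫  : ∀ {n m} {S S′ : Statement k (suc n) m} → Compatible R S S′ →
           Compatible R x·⟪ S ⟫ x·⟪ S′ ⟫
  outν   : ∀ {n m} A .p {K K′ : Coterm k n m} → Compatible R K K′ →
           Compatible R (outν A p K) (outν A p K′)
  itrˡ   : ∀ {n m} A {K K′ : Coterm k n (suc m)} → Compatible R K K′ → ∀ L →
           Compatible R (itr A K L) (itr A K′ L)
  itrʳ   : ∀ {n m} A K {L L′ : Coterm k n m} → Compatible R L L′ →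
           Compatible R (itr A K L) (itr A K L′)

  _•ˡ_   : ∀ {n m} {M M′ : Term k n m} → Compatible R M M′ → ∀ K →
           Compatible R (M • K) (M′ • K)
  _•ʳ_   : ∀ {n m} M {K K′ : Coterm k n m} → Compatible R K K′ →
           Compatible R (M • K) (M • K′)

CBV CBN : ∀ {k s n m} → Rel (Expr k s n m) 0ℓ
CBV = Compatible _▷ᵛ_
CBN = Compatible _▷ⁿ_

{-# OPTIONS --safe #-}
module Submission where

-- Call by name follows from call by value, since duality exchanges the two
-- reductions.  For call by value, the rules are split into β, η and ς, and each
-- of the three gets a parallel reduction with the diamond property.  The
-- parallel β and η reductions commute, and so do β and ς.  The delicate pair is
-- η and ς: an η-step M → V may turn a non-value into a value and so destroy the
-- redex of a ς-step, but the ς-contractum then reaches the same term by an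
-- administrative β-step followed by an η-step.  Hence ς commutes with the
-- union of β and η, and the Hindley–Rosen lemma applies.

open import Data.Bool.Base using (true; false)
open import Data.Fin.Base using (Fin; zero; suc; lift; _↑ʳ_)
open import Data.Fin.Properties using (suc-injective)
open import Data.Nat.Base using (suc)
open import Data.Product.Base using (_×_; _,_; proj₁; proj₂; ∃-syntax; Σ-syntax; map₁; map₂)
open import Data.Sum.Base using (_⊎_; inj₁; inj₂)
open import Data.Unit.Base using (⊤; tt)
open import Data.Vec.Functional using (_∷_)
open import Function.Base using (id; _∘_; case_of_)
open import Induction.WellFounded using (acc)
open import Level using (0ℓ)
open import Relation.Binary.Construct.Closure.ReflexiveTransitive using (Star; ε; _◅_; _◅◅_; gmap; kleisliStar)
open import Relation.Binary.Core using (Rel)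
open import Relation.Binary.PropositionalEquality
  using (_≡_; _≢_; refl; sym; trans; cong; cong₂; subst; subst₂; module ≡-Reasoning)
open import Relation.Binary.Rewriting using (Confluent)
open import Relation.Nullary using (¬_; Dec; yes; no; contradiction)
open import Defs

-- Substitution calculus

-- Expressions are untyped and reduction need not terminate: for the coterm
-- `K = x·⟪ var zero • not⟨ var zero ⟩ ⟫`, the statement `[ K ]not • not⟨ [ K ]not ⟩` reduces to
-- itself in two steps. Local confluence is therefore too weak, and diamonds are required. The
-- notion of value shapes them. Redexes survive substitution for variables if values are
-- substituted, and a ς-redex lives only as long as its argument is not a value. Values stay values
-- under every step, and η is the only kind of step that makes a value out of a non-value, so only η
-- needs special care against ς. The operator `mono` causes no trouble here: its recursion inspects
-- the type alone. Hence the contracta of `β-μ` and `β-ν` commute with substitution and respect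
-- every relation that is closed under the constructors and under renaming.

infix 9 _⇑ˣ _⇑ᵅ

_⇑ˣ : ∀ {k n n′ m′} → (Fin n → Term k n′ m′) → Fin (suc n) → Term k (suc n′) m′
σ ⇑ˣ = var zero ∷ (wkˣ ∘ σ)

_⇑ᵅ : ∀ {k m n′ m′} → (Fin m → Coterm k n′ m′) → Fin (suc m) → Coterm k n′ (suc m′)
τ ⇑ᵅ = covar zero ∷ (wkᵅ ∘ τ)

lift-id : ∀ {n} {ρ : Fin n → Fin n} → (∀ x → ρ x ≡ x) → ∀ x → lift 1 ρ x ≡ x
lift-id e zero    = refl
lift-id e (suc x) = cong suc (e x)

ren-id : ∀ {k s n m} {ρ : Fin n → Fin n} {θ : Fin m → Fin m} →
         (∀ x → ρ x ≡ x) → (∀ x → θ x ≡ x) → (E : Expr k s n m) → ren ρ θ E ≡ E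
ren-id e f (var x)       = cong var (e x)
ren-id e f ⟨ M , N ⟩     = cong₂ ⟨_,_⟩ (ren-id e f M) (ren-id e f N)
ren-id e f ⟨ M ⟩inl      = cong ⟨_⟩inl (ren-id e f M)
ren-id e f ⟨ M ⟩inr      = cong ⟨_⟩inr (ren-id e f M)
ren-id e f [ K ]not      = cong [_]not (ren-id e f K)
ren-id e f ⟪ S ⟫·α       = cong ⟪_⟫·α (ren-id e (lift-id f) S)
ren-id e f (inμ A p M)   = cong (inμ A p) (ren-id e f M)
ren-id e f (coitr A M N) = cong₂ (coitr A) (ren-id (lift-id e) f M) (ren-id e f N)
ren-id e f (covar α)     = cong covar (f α)
ren-id e f [ K , L ]     = cong₂ [_,_] (ren-id e f K) (ren-id e f L)
ren-id e f fst[ K ]      = cong fst[_] (ren-id e f K)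
ren-id e f snd[ K ]      = cong snd[_] (ren-id e f K)
ren-id e f not⟨ M ⟩      = cong not⟨_⟩ (ren-id e f M)
ren-id e f x·⟪ S ⟫       = cong x·⟪_⟫ (ren-id (lift-id e) f S)
ren-id e f (outν A p K)  = cong (outν A p) (ren-id e f K)
ren-id e f (itr A K L)   = cong₂ (itr A) (ren-id e (lift-id f) K) (ren-id e f L)
ren-id e f (M • K)       = cong₂ _•_ (ren-id e f M) (ren-id e f K)

ren-as-sub-⇑ˣ : ∀ {k n n′ m′} {ρ : Fin n → Fin n′} {σ : Fin n → Term k n′ m′} →
                  (∀ x → var (ρ x) ≡ σ x) → ∀ x → var (lift 1 ρ x) ≡ (σ ⇑ˣ) x
ren-as-sub-⇑ˣ e zero    = refl
ren-as-sub-⇑ˣ e (suc x) = cong wkˣ (e x)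

ren-as-sub-⇑ᵅ : ∀ {k m n′ m′} {θ : Fin m → Fin m′} {τ : Fin m → Coterm k n′ m′} →
                    (∀ x → covar (θ x) ≡ τ x) → ∀ x → covar (lift 1 θ x) ≡ (τ ⇑ᵅ) x
ren-as-sub-⇑ᵅ f zero    = refl
ren-as-sub-⇑ᵅ f (suc x) = cong wkᵅ (f x)

ren-as-sub : ∀ {k s n m n′ m′} {ρ : Fin n → Fin n′} {θ : Fin m → Fin m′} {σ τ} →
             (∀ x → var (ρ x) ≡ σ x) → (∀ x → covar (θ x) ≡ τ x) →
             (E : Expr k s n m) → ren ρ θ E ≡ sub σ τ E
ren-as-sub e f (var x)       = e x
ren-as-sub e f ⟨ M , N ⟩     = cong₂ ⟨_,_⟩ (ren-as-sub e f M) (ren-as-sub e f N)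
ren-as-sub e f ⟨ M ⟩inl      = cong ⟨_⟩inl (ren-as-sub e f M)
ren-as-sub e f ⟨ M ⟩inr      = cong ⟨_⟩inr (ren-as-sub e f M)
ren-as-sub e f [ K ]not      = cong [_]not (ren-as-sub e f K)
ren-as-sub e f ⟪ S ⟫·α       = cong ⟪_⟫·α (ren-as-sub (cong wkᵅ ∘ e) (ren-as-sub-⇑ᵅ f) S)
ren-as-sub e f (inμ A p M)   = cong (inμ A p) (ren-as-sub e f M)
ren-as-sub e f (coitr A M N) = cong₂ (coitr A) (ren-as-sub (ren-as-sub-⇑ˣ e) (cong wkˣ ∘ f) M) (ren-as-sub e f N)
ren-as-sub e f (covar α)     = f α
ren-as-sub e f [ K , L ]     = cong₂ [_,_] (ren-as-sub e f K) (ren-as-sub e f L)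
ren-as-sub e f fst[ K ]      = cong fst[_] (ren-as-sub e f K)
ren-as-sub e f snd[ K ]      = cong snd[_] (ren-as-sub e f K)
ren-as-sub e f not⟨ M ⟩      = cong not⟨_⟩ (ren-as-sub e f M)
ren-as-sub e f x·⟪ S ⟫       = cong x·⟪_⟫ (ren-as-sub (ren-as-sub-⇑ˣ e) (cong wkˣ ∘ f) S)
ren-as-sub e f (outν A p K)  = cong (outν A p) (ren-as-sub e f K)
ren-as-sub e f (itr A K L)   = cong₂ (itr A) (ren-as-sub (cong wkᵅ ∘ e) (ren-as-sub-⇑ᵅ f) K) (ren-as-sub e f L)
ren-as-sub e f (M • K)       = cong₂ _•_ (ren-as-sub e f M) (ren-as-sub e f K)

sub-ren-⇑ˣ : ∀ {k n n′ n″ m″} {ρ : Fin n → Fin n′} {σ : Fin n′ → Term k n″ m″} {σ′} →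
               (∀ x → σ (ρ x) ≡ σ′ x) → ∀ x → (σ ⇑ˣ) (lift 1 ρ x) ≡ (σ′ ⇑ˣ) x
sub-ren-⇑ˣ e zero    = refl
sub-ren-⇑ˣ e (suc x) = cong wkˣ (e x)

sub-ren-⇑ᵅ : ∀ {k m m′ n″ m″} {θ : Fin m → Fin m′} {τ : Fin m′ → Coterm k n″ m″} {τ′} →
                 (∀ x → τ (θ x) ≡ τ′ x) → ∀ x → (τ ⇑ᵅ) (lift 1 θ x) ≡ (τ′ ⇑ᵅ) x
sub-ren-⇑ᵅ f zero    = refl
sub-ren-⇑ᵅ f (suc x) = cong wkᵅ (f x)

-- The composite is a separate function with a pointwise equation, because under a binder the
-- composite of the lifted maps agrees with the lifted composite only pointwise. The order of the
-- laws matters: this one needs nothing but computation; it yields `ren-ren`, then `ren-sub`, and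
-- finally `sub-sub`.
sub-ren : ∀ {k s n m n′ m′ n″ m″} {ρ : Fin n → Fin n′} {θ : Fin m → Fin m′}
          {σ : Fin n′ → Term k n″ m″} {τ : Fin m′ → Coterm k n″ m″} {σ′ τ′} →
          (∀ x → σ (ρ x) ≡ σ′ x) → (∀ x → τ (θ x) ≡ τ′ x) →
          (E : Expr k s n m) → sub σ τ (ren ρ θ E) ≡ sub σ′ τ′ E
sub-ren e f (var x)       = e x
sub-ren e f ⟨ M , N ⟩     = cong₂ ⟨_,_⟩ (sub-ren e f M) (sub-ren e f N)
sub-ren e f ⟨ M ⟩inl      = cong ⟨_⟩inl (sub-ren e f M)
sub-ren e f ⟨ M ⟩inr      = cong ⟨_⟩inr (sub-ren e f M)
sub-ren e f [ K ]not      = cong [_]not (sub-ren e f K)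
sub-ren e f ⟪ S ⟫·α       = cong ⟪_⟫·α (sub-ren (cong wkᵅ ∘ e) (sub-ren-⇑ᵅ f) S)
sub-ren e f (inμ A p M)   = cong (inμ A p) (sub-ren e f M)
sub-ren e f (coitr A M N) = cong₂ (coitr A) (sub-ren (sub-ren-⇑ˣ e) (cong wkˣ ∘ f) M) (sub-ren e f N)
sub-ren e f (covar α)     = f α
sub-ren e f [ K , L ]     = cong₂ [_,_] (sub-ren e f K) (sub-ren e f L)
sub-ren e f fst[ K ]      = cong fst[_] (sub-ren e f K)
sub-ren e f snd[ K ]      = cong snd[_] (sub-ren e f K)
sub-ren e f not⟨ M ⟩      = cong not⟨_⟩ (sub-ren e f M)
sub-ren e f x·⟪ S ⟫       = cong x·⟪_⟫ (sub-ren (sub-ren-⇑ˣ e) (cong wkˣ ∘ f) S)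
sub-ren e f (outν A p K)  = cong (outν A p) (sub-ren e f K)
sub-ren e f (itr A K L)   = cong₂ (itr A) (sub-ren (cong wkᵅ ∘ e) (sub-ren-⇑ᵅ f) K) (sub-ren e f L)
sub-ren e f (M • K)       = cong₂ _•_ (sub-ren e f M) (sub-ren e f K)

sub-id : ∀ {k s n m} {σ : Fin n → Term k n m} {τ : Fin m → Coterm k n m} →
         (∀ x → var x ≡ σ x) → (∀ x → covar x ≡ τ x) →
         (E : Expr k s n m) → sub σ τ E ≡ E
sub-id e f E = trans (sym (ren-as-sub e f E)) (ren-id (λ _ → refl) (λ _ → refl) E)

ren-ren : ∀ {k s n m n′ m′ n″ m″} {ρ : Fin n → Fin n′} {θ : Fin m → Fin m′}
          {ρ′ : Fin n′ → Fin n″} {θ′ : Fin m′ → Fin m″} {ρ″ θ″} →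
          (∀ x → ρ′ (ρ x) ≡ ρ″ x) → (∀ x → θ′ (θ x) ≡ θ″ x) →
          (E : Expr k s n m) → ren ρ′ θ′ (ren ρ θ E) ≡ ren ρ″ θ″ E
ren-ren {ρ = ρ} {θ} e f E =
  trans (ren-as-sub (λ _ → refl) (λ _ → refl) (ren ρ θ E))
 (trans (sub-ren (λ x → cong var (e x)) (λ x → cong covar (f x)) E)
        (sym (ren-as-sub (λ _ → refl) (λ _ → refl) E)))

ren-wkˣ : ∀ {k s n m n′ m′} (ρ : Fin n → Fin n′) (θ : Fin m → Fin m′) (E : Expr k s n m) →
          ren (lift 1 ρ) θ (wkˣ E) ≡ wkˣ (ren ρ θ E)
ren-wkˣ ρ θ E = trans (ren-ren (λ _ → refl) (λ _ → refl) E)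
                      (sym (ren-ren (λ _ → refl) (λ _ → refl) E))

ren-wkᵅ : ∀ {k s n m n′ m′} (ρ : Fin n → Fin n′) (θ : Fin m → Fin m′) (E : Expr k s n m) →
          ren ρ (lift 1 θ) (wkᵅ E) ≡ wkᵅ (ren ρ θ E)
ren-wkᵅ ρ θ E = trans (ren-ren (λ _ → refl) (λ _ → refl) E)
                      (sym (ren-ren (λ _ → refl) (λ _ → refl) E))

ren-sub-⇑ˣ : ∀ {k n n′ m′ n″ m″} (σ : Fin n → Term k n′ m′) (ρ : Fin n′ → Fin n″) (θ : Fin m′ → Fin m″) {σ′} →
                (∀ x → ren ρ θ (σ x) ≡ σ′ x) → ∀ x → ren (lift 1 ρ) θ ((σ ⇑ˣ) x) ≡ (σ′ ⇑ˣ) x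
ren-sub-⇑ˣ σ ρ θ e zero    = refl
ren-sub-⇑ˣ σ ρ θ e (suc x) = trans (ren-wkˣ ρ θ (σ x)) (cong wkˣ (e x))

ren-sub-⇑ᵅ : ∀ {k m n′ m′ n″ m″} (τ : Fin m → Coterm k n′ m′) (ρ : Fin n′ → Fin n″) (θ : Fin m′ → Fin m″) {τ′} →
                  (∀ x → ren ρ θ (τ x) ≡ τ′ x) → ∀ x → ren ρ (lift 1 θ) ((τ ⇑ᵅ) x) ≡ (τ′ ⇑ᵅ) x
ren-sub-⇑ᵅ τ ρ θ f zero    = refl
ren-sub-⇑ᵅ τ ρ θ f (suc x) = trans (ren-wkᵅ ρ θ (τ x)) (cong wkᵅ (f x))

ren-sub : ∀ {k s n m n′ m′ n″ m″} {σ : Fin n → Term k n′ m′} {τ : Fin m → Coterm k n′ m′}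
          {ρ : Fin n′ → Fin n″} {θ : Fin m′ → Fin m″} {σ′ τ′} →
          (∀ x → ren ρ θ (σ x) ≡ σ′ x) → (∀ x → ren ρ θ (τ x) ≡ τ′ x) →
          (E : Expr k s n m) → ren ρ θ (sub σ τ E) ≡ sub σ′ τ′ E
ren-sub e f (var x)       = e x
ren-sub e f ⟨ M , N ⟩     = cong₂ ⟨_,_⟩ (ren-sub e f M) (ren-sub e f N)
ren-sub e f ⟨ M ⟩inl      = cong ⟨_⟩inl (ren-sub e f M)
ren-sub e f ⟨ M ⟩inr      = cong ⟨_⟩inr (ren-sub e f M)
ren-sub e f [ K ]not      = cong [_]not (ren-sub e f K)
ren-sub {σ = σ} {τ} {ρ} {θ} e f ⟪ S ⟫·α = cong ⟪_⟫·α
  (ren-sub (λ i → trans (ren-wkᵅ ρ θ (σ i)) (cong wkᵅ (e i))) (ren-sub-⇑ᵅ τ ρ θ f) S)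
ren-sub e f (inμ A p M)   = cong (inμ A p) (ren-sub e f M)
ren-sub {σ = σ} {τ} {ρ} {θ} e f (coitr A M N) = cong₂ (coitr A)
  (ren-sub (ren-sub-⇑ˣ σ ρ θ e) (λ i → trans (ren-wkˣ ρ θ (τ i)) (cong wkˣ (f i))) M)
  (ren-sub e f N)
ren-sub e f (covar α)     = f α
ren-sub e f [ K , L ]     = cong₂ [_,_] (ren-sub e f K) (ren-sub e f L)
ren-sub e f fst[ K ]      = cong fst[_] (ren-sub e f K)
ren-sub e f snd[ K ]      = cong snd[_] (ren-sub e f K)
ren-sub e f not⟨ M ⟩      = cong not⟨_⟩ (ren-sub e f M)
ren-sub {σ = σ} {τ} {ρ} {θ} e f x·⟪ S ⟫ = cong x·⟪_⟫
  (ren-sub (ren-sub-⇑ˣ σ ρ θ e) (λ i → trans (ren-wkˣ ρ θ (τ i)) (cong wkˣ (f i))) S)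
ren-sub e f (outν A p K)  = cong (outν A p) (ren-sub e f K)
ren-sub {σ = σ} {τ} {ρ} {θ} e f (itr A K L) = cong₂ (itr A)
  (ren-sub (λ i → trans (ren-wkᵅ ρ θ (σ i)) (cong wkᵅ (e i))) (ren-sub-⇑ᵅ τ ρ θ f) K)
  (ren-sub e f L)
ren-sub e f (M • K)       = cong₂ _•_ (ren-sub e f M) (ren-sub e f K)

sub-wkˣ : ∀ {k s n m n′ m′} (σ : Fin n → Term k n′ m′) (τ : Fin m → Coterm k n′ m′) →
          (E : Expr k s n m) → sub (σ ⇑ˣ) (wkˣ ∘ τ) (wkˣ E) ≡ wkˣ (sub σ τ E)
sub-wkˣ σ τ E = trans (sub-ren (λ _ → refl) (λ _ → refl) E)
                      (sym (ren-sub (λ _ → refl) (λ _ → refl) E))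

sub-wkᵅ : ∀ {k s n m n′ m′} (σ : Fin n → Term k n′ m′) (τ : Fin m → Coterm k n′ m′) →
          (E : Expr k s n m) → sub (wkᵅ ∘ σ) (τ ⇑ᵅ) (wkᵅ E) ≡ wkᵅ (sub σ τ E)
sub-wkᵅ σ τ E = trans (sub-ren (λ _ → refl) (λ _ → refl) E)
                      (sym (ren-sub (λ _ → refl) (λ _ → refl) E))

sub-sub-⇑ˣ : ∀ {k n n′ m′ n″ m″} (σ : Fin n → Term k n′ m′)
                (σ′ : Fin n′ → Term k n″ m″) (τ′ : Fin m′ → Coterm k n″ m″) {σ″} →
                (∀ x → sub σ′ τ′ (σ x) ≡ σ″ x) →
                ∀ x → sub (σ′ ⇑ˣ) (wkˣ ∘ τ′) ((σ ⇑ˣ) x) ≡ (σ″ ⇑ˣ) x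
sub-sub-⇑ˣ σ σ′ τ′ e zero    = refl
sub-sub-⇑ˣ σ σ′ τ′ e (suc x) = trans (sub-wkˣ σ′ τ′ (σ x)) (cong wkˣ (e x))

sub-sub-⇑ᵅ : ∀ {k m n′ m′ n″ m″} (τ : Fin m → Coterm k n′ m′)
                  (σ′ : Fin n′ → Term k n″ m″) (τ′ : Fin m′ → Coterm k n″ m″) {τ″} →
                  (∀ x → sub σ′ τ′ (τ x) ≡ τ″ x) →
                  ∀ x → sub (wkᵅ ∘ σ′) (τ′ ⇑ᵅ) ((τ ⇑ᵅ) x) ≡ (τ″ ⇑ᵅ) x
sub-sub-⇑ᵅ τ σ′ τ′ f zero    = refl
sub-sub-⇑ᵅ τ σ′ τ′ f (suc x) = trans (sub-wkᵅ σ′ τ′ (τ x)) (cong wkᵅ (f x))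

sub-sub : ∀ {k s n m n′ m′ n″ m″} {σ : Fin n → Term k n′ m′} {τ : Fin m → Coterm k n′ m′}
          {σ′ : Fin n′ → Term k n″ m″} {τ′ : Fin m′ → Coterm k n″ m″} {σ″ τ″} →
          (∀ x → sub σ′ τ′ (σ x) ≡ σ″ x) → (∀ x → sub σ′ τ′ (τ x) ≡ τ″ x) →
          (E : Expr k s n m) → sub σ′ τ′ (sub σ τ E) ≡ sub σ″ τ″ E
sub-sub e f (var x)       = e x
sub-sub e f ⟨ M , N ⟩     = cong₂ ⟨_,_⟩ (sub-sub e f M) (sub-sub e f N)
sub-sub e f ⟨ M ⟩inl      = cong ⟨_⟩inl (sub-sub e f M)
sub-sub e f ⟨ M ⟩inr      = cong ⟨_⟩inr (sub-sub e f M)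
sub-sub e f [ K ]not      = cong [_]not (sub-sub e f K)
sub-sub {σ = σ} {τ} {σ′} {τ′} e f ⟪ S ⟫·α = cong ⟪_⟫·α
  (sub-sub (λ i → trans (sub-wkᵅ σ′ τ′ (σ i)) (cong wkᵅ (e i))) (sub-sub-⇑ᵅ τ σ′ τ′ f) S)
sub-sub e f (inμ A p M)   = cong (inμ A p) (sub-sub e f M)
sub-sub {σ = σ} {τ} {σ′} {τ′} e f (coitr A M N) = cong₂ (coitr A)
  (sub-sub (sub-sub-⇑ˣ σ σ′ τ′ e) (λ i → trans (sub-wkˣ σ′ τ′ (τ i)) (cong wkˣ (f i))) M)
  (sub-sub e f N)
sub-sub e f (covar α)     = f α
sub-sub e f [ K , L ]     = cong₂ [_,_] (sub-sub e f K) (sub-sub e f L)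
sub-sub e f fst[ K ]      = cong fst[_] (sub-sub e f K)
sub-sub e f snd[ K ]      = cong snd[_] (sub-sub e f K)
sub-sub e f not⟨ M ⟩      = cong not⟨_⟩ (sub-sub e f M)
sub-sub {σ = σ} {τ} {σ′} {τ′} e f x·⟪ S ⟫ = cong x·⟪_⟫
  (sub-sub (sub-sub-⇑ˣ σ σ′ τ′ e) (λ i → trans (sub-wkˣ σ′ τ′ (τ i)) (cong wkˣ (f i))) S)
sub-sub e f (outν A p K)  = cong (outν A p) (sub-sub e f K)
sub-sub {σ = σ} {τ} {σ′} {τ′} e f (itr A K L) = cong₂ (itr A)
  (sub-sub (λ i → trans (sub-wkᵅ σ′ τ′ (σ i)) (cong wkᵅ (e i))) (sub-sub-⇑ᵅ τ σ′ τ′ f) K)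
  (sub-sub e f L)
sub-sub e f (M • K)       = cong₂ _•_ (sub-sub e f M) (sub-sub e f K)

wkˣ-/x : ∀ {k s n m} (M : Term k n m) (E : Expr k s n m) → wkˣ E [ M /x] ≡ E
wkˣ-/x M E = trans (sub-ren (λ _ → refl) (λ _ → refl) E) (sub-id (λ _ → refl) (λ _ → refl) E)

wkᵅ-/α : ∀ {k s n m} (K : Coterm k n m) (E : Expr k s n m) → wkᵅ E [ K /α] ≡ E
wkᵅ-/α K E = trans (sub-ren (λ _ → refl) (λ _ → refl) E) (sub-id (λ _ → refl) (λ _ → refl) E)

-- Duality

μ-cong : ∀ {n} {A B : Ty (suc n)} .{p : zero ∈Pos A} .{q : zero ∈Pos B} → A ≡ B → μ A p ≡ μ B q
μ-cong refl = refl

ν-cong : ∀ {n} {A B : Ty (suc n)} .{p : zero ∈Pos A} .{q : zero ∈Pos B} → A ≡ B → ν A p ≡ ν B q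
ν-cong refl = refl

dualT-involutive : ∀ {n} (A : Ty n) → dualT (dualT A) ≡ A
dualT-involutive (tvar x) = refl
dualT-involutive (A ∧ᵗ B) = cong₂ _∧ᵗ_ (dualT-involutive A) (dualT-involutive B)
dualT-involutive (A ∨ᵗ B) = cong₂ _∨ᵗ_ (dualT-involutive A) (dualT-involutive B)
dualT-involutive (¬ᵗ A)   = cong ¬ᵗ_ (dualT-involutive A)
dualT-involutive (μ A p)  = μ-cong (dualT-involutive A)
dualT-involutive (ν A p)  = ν-cong (dualT-involutive A)

inμ-cong : ∀ {k n m} {A B : Ty (suc k)} .{p : zero ∈Pos A} .{q : zero ∈Pos B} {M N : Term k n m} →
           A ≡ B → M ≡ N → inμ A p M ≡ inμ B q N
inμ-cong refl refl = refl

outν-cong : ∀ {k n m} {A B : Ty (suc k)} .{p : zero ∈Pos A} .{q : zero ∈Pos B} {K L : Coterm k n m} →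
            A ≡ B → K ≡ L → outν A p K ≡ outν B q L
outν-cong refl refl = refl

coitr-cong : ∀ {k n m} {A B : Ty k} {M M′ : Term k (suc n) m} {N N′} →
             A ≡ B → M ≡ M′ → N ≡ N′ → _≡_ {A = Term k n m} (coitr A M N) (coitr B M′ N′)
coitr-cong refl refl refl = refl

itr-cong : ∀ {k n m} {A B : Ty k} {K K′ : Coterm k n (suc m)} {L L′} →
           A ≡ B → K ≡ K′ → L ≡ L′ → _≡_ {A = Coterm k n m} (itr A K L) (itr B K′ L′)
itr-cong refl refl refl = refl

-- `dualSort (dualSort s)` computes to `s` only for a concrete sort, so the equation is stated once
-- per sort.
dual-involutiveᵗ : ∀ {k n m} (M : Term k n m) → dual (dual M) ≡ M
dual-involutiveᶜ : ∀ {k n m} (K : Coterm k n m) → dual (dual K) ≡ K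
dual-involutiveˢ : ∀ {k n m} (S : Statement k n m) → dual (dual S) ≡ S

dual-involutiveᵗ (var x)       = refl
dual-involutiveᵗ ⟨ M , N ⟩     = cong₂ ⟨_,_⟩ (dual-involutiveᵗ M) (dual-involutiveᵗ N)
dual-involutiveᵗ ⟨ M ⟩inl      = cong ⟨_⟩inl (dual-involutiveᵗ M)
dual-involutiveᵗ ⟨ M ⟩inr      = cong ⟨_⟩inr (dual-involutiveᵗ M)
dual-involutiveᵗ [ K ]not      = cong [_]not (dual-involutiveᶜ K)
dual-involutiveᵗ ⟪ S ⟫·α       = cong ⟪_⟫·α (dual-involutiveˢ S)
dual-involutiveᵗ (inμ A p M)   = inμ-cong (dualT-involutive A) (dual-involutiveᵗ M)
dual-involutiveᵗ (coitr A M N) = coitr-cong (dualT-involutive A) (dual-involutiveᵗ M) (dual-involutiveᵗ N)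

dual-involutiveᶜ (covar α)     = refl
dual-involutiveᶜ [ K , L ]     = cong₂ [_,_] (dual-involutiveᶜ K) (dual-involutiveᶜ L)
dual-involutiveᶜ fst[ K ]      = cong fst[_] (dual-involutiveᶜ K)
dual-involutiveᶜ snd[ K ]      = cong snd[_] (dual-involutiveᶜ K)
dual-involutiveᶜ not⟨ M ⟩      = cong not⟨_⟩ (dual-involutiveᵗ M)
dual-involutiveᶜ x·⟪ S ⟫       = cong x·⟪_⟫ (dual-involutiveˢ S)
dual-involutiveᶜ (outν A p K)  = outν-cong (dualT-involutive A) (dual-involutiveᶜ K)
dual-involutiveᶜ (itr A K L)   = itr-cong (dualT-involutive A) (dual-involutiveᶜ K) (dual-involutiveᶜ L)

dual-involutiveˢ (M • K)       = cong₂ _•_ (dual-involutiveᵗ M) (dual-involutiveᶜ K)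

dual-ren : ∀ {k s n m n′ m′} (ρ : Fin n → Fin n′) (θ : Fin m → Fin m′) (E : Expr k s n m) →
           dual (ren ρ θ E) ≡ ren θ ρ (dual E)
dual-ren ρ θ (var x)       = refl
dual-ren ρ θ ⟨ M , N ⟩     = cong₂ [_,_] (dual-ren ρ θ M) (dual-ren ρ θ N)
dual-ren ρ θ ⟨ M ⟩inl      = cong fst[_] (dual-ren ρ θ M)
dual-ren ρ θ ⟨ M ⟩inr      = cong snd[_] (dual-ren ρ θ M)
dual-ren ρ θ [ K ]not      = cong not⟨_⟩ (dual-ren ρ θ K)
dual-ren ρ θ ⟪ S ⟫·α       = cong x·⟪_⟫ (dual-ren ρ (lift 1 θ) S)
dual-ren ρ θ (inμ A p M)   = cong (outν (dualT A) (dualT-Pos A p)) (dual-ren ρ θ M)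
dual-ren ρ θ (coitr A M N) = cong₂ (itr (dualT A)) (dual-ren (lift 1 ρ) θ M) (dual-ren ρ θ N)
dual-ren ρ θ (covar α)     = refl
dual-ren ρ θ [ K , L ]     = cong₂ ⟨_,_⟩ (dual-ren ρ θ K) (dual-ren ρ θ L)
dual-ren ρ θ fst[ K ]      = cong ⟨_⟩inl (dual-ren ρ θ K)
dual-ren ρ θ snd[ K ]      = cong ⟨_⟩inr (dual-ren ρ θ K)
dual-ren ρ θ not⟨ M ⟩      = cong [_]not (dual-ren ρ θ M)
dual-ren ρ θ x·⟪ S ⟫       = cong ⟪_⟫·α (dual-ren (lift 1 ρ) θ S)
dual-ren ρ θ (outν A p K)  = cong (inμ (dualT A) (dualT-Pos A p)) (dual-ren ρ θ K)
dual-ren ρ θ (itr A K L)   = cong₂ (coitr (dualT A)) (dual-ren ρ (lift 1 θ) K) (dual-ren ρ θ L)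
dual-ren ρ θ (M • K)       = cong₂ _•_ (dual-ren ρ θ K) (dual-ren ρ θ M)

dual-⇑ᵅ : ∀ {k m n′ m′} (τ : Fin m → Coterm k n′ m′) → ∀ x → dual ((τ ⇑ᵅ) x) ≡ ((dual ∘ τ) ⇑ˣ) x
dual-⇑ᵅ τ zero    = refl
dual-⇑ᵅ τ (suc x) = dual-ren id suc (τ x)

dual-sub : ∀ {k s n m n′ m′} {σ : Fin n → Term k n′ m′} {τ : Fin m → Coterm k n′ m′} {σ′ τ′} →
           (∀ x → dual (τ x) ≡ σ′ x) → (∀ x → dual (σ x) ≡ τ′ x) →
           (E : Expr k s n m) → dual (sub σ τ E) ≡ sub σ′ τ′ (dual E)
dual-subˣ : ∀ {k s n m n′ m′} {σ : Fin n → Term k n′ m′} {τ : Fin m → Coterm k n′ m′} {σ′ τ′} →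
            (∀ x → dual (τ x) ≡ σ′ x) → (∀ x → dual (σ x) ≡ τ′ x) →
            (E : Expr k s (suc n) m) → dual (sub (σ ⇑ˣ) (wkˣ ∘ τ) E) ≡ sub (wkᵅ ∘ σ′) (τ′ ⇑ᵅ) (dual E)
dual-subᵅ : ∀ {k s n m n′ m′} {σ : Fin n → Term k n′ m′} {τ : Fin m → Coterm k n′ m′} {σ′ τ′} →
            (∀ x → dual (τ x) ≡ σ′ x) → (∀ x → dual (σ x) ≡ τ′ x) →
            (E : Expr k s n (suc m)) → dual (sub (wkᵅ ∘ σ) (τ ⇑ᵅ) E) ≡ sub (σ′ ⇑ˣ) (wkˣ ∘ τ′) (dual E)

dual-subˣ {σ = σ} {τ} e f E =
  dual-sub (λ x → trans (dual-ren suc id (τ x)) (cong wkᵅ (e x)))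
           (λ { zero → refl ; (suc x) → trans (dual-ren suc id (σ x)) (cong wkᵅ (f x)) }) E
dual-subᵅ {σ = σ} {τ} e f E =
  dual-sub (λ { zero → refl ; (suc x) → trans (dual-ren id suc (τ x)) (cong wkˣ (e x)) })
           (λ x → trans (dual-ren id suc (σ x)) (cong wkˣ (f x))) E
dual-sub e f (var x)       = f x
dual-sub e f ⟨ M , N ⟩     = cong₂ [_,_] (dual-sub e f M) (dual-sub e f N)
dual-sub e f ⟨ M ⟩inl      = cong fst[_] (dual-sub e f M)
dual-sub e f ⟨ M ⟩inr      = cong snd[_] (dual-sub e f M)
dual-sub e f [ K ]not      = cong not⟨_⟩ (dual-sub e f K)
dual-sub e f ⟪ S ⟫·α       = cong x·⟪_⟫ (dual-subᵅ e f S)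
dual-sub e f (inμ A p M)   = cong (outν (dualT A) (dualT-Pos A p)) (dual-sub e f M)
dual-sub e f (coitr A M N) = cong₂ (itr (dualT A)) (dual-subˣ e f M) (dual-sub e f N)
dual-sub e f (covar α)     = e α
dual-sub e f [ K , L ]     = cong₂ ⟨_,_⟩ (dual-sub e f K) (dual-sub e f L)
dual-sub e f fst[ K ]      = cong ⟨_⟩inl (dual-sub e f K)
dual-sub e f snd[ K ]      = cong ⟨_⟩inr (dual-sub e f K)
dual-sub e f not⟨ M ⟩      = cong [_]not (dual-sub e f M)
dual-sub e f x·⟪ S ⟫       = cong ⟪_⟫·α (dual-subˣ e f S)
dual-sub e f (outν A p K)  = cong (inμ (dualT A) (dualT-Pos A p)) (dual-sub e f K)
dual-sub e f (itr A K L)   = cong₂ (coitr (dualT A)) (dual-subᵅ e f K) (dual-sub e f L)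
dual-sub e f (M • K)       = cong₂ _•_ (dual-sub e f K) (dual-sub e f M)

-- Naturality of mono

-- One law for all the renamings `M↑` in the clauses of `mono`: a new variable is inserted below
-- `x`, while `θ` inserts no, one or two covariables depending on the clause. The same renaming
-- occurs in the rule `ς-coitr`.
sub-lift-suc : ∀ {k s n m n′ m′ m″ m‴} {σ : Fin n → Term k n′ m″} {τ : Fin m → Coterm k n′ m″}
               {σ′ : Fin n → Term k n′ m‴} {τ′ : Fin m′ → Coterm k n′ m‴}
               {θ : Fin m → Fin m′} {θ′ : Fin m″ → Fin m‴} →
               (∀ x → ren id θ′ (σ x) ≡ σ′ x) → (∀ x → ren id θ′ (τ x) ≡ τ′ (θ x)) →
               (E : Expr k s (suc n) m) →
               sub ((σ′ ⇑ˣ) ⇑ˣ) (wkˣ ∘ wkˣ ∘ τ′) (ren (lift 1 suc) θ E) ≡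
               ren (lift 1 suc) θ′ (sub (σ ⇑ˣ) (wkˣ ∘ τ) E)
sub-lift-suc {k} {n′ = n′} {m″ = m″} {σ = σ} {τ} {σ′} {θ′ = θ′} e f E =
  trans (sub-ren (λ _ → refl) (λ _ → refl) E) (sym (ren-sub eˣ (λ x → wk² (τ x) (f x)) E))
  where
  wk² : ∀ {s} (F : Expr k s n′ m″) {F′} → ren id θ′ F ≡ F′ →
        ren (lift 1 suc) θ′ (wkˣ F) ≡ wkˣ (wkˣ F′)
  wk² F e = trans (ren-wkˣ suc θ′ F)
                  (cong wkˣ (trans (sym (ren-ren (λ _ → refl) (λ _ → refl) F)) (cong wkˣ e)))
  eˣ : ∀ x → ren (lift 1 suc) θ′ ((σ ⇑ˣ) x) ≡ ((σ′ ⇑ˣ) ⇑ˣ) (lift 1 suc x)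
  eˣ zero    = refl
  eˣ (suc x) = wk² (σ x) (e x)

ren-id-≡ : ∀ {k s n m} (E : Expr k s n m) → ren id id E ≡ E
ren-id-≡ = ren-id (λ _ → refl) (λ _ → refl)

wk²ᵅ : ∀ {k s n m} (E : Expr k s n m) → ren id (2 ↑ʳ_) E ≡ wkᵅ (wkᵅ E)
wk²ᵅ E = sym (ren-ren (λ _ → refl) (λ _ → refl) E)

wkˣ-wkᵅ : ∀ {k s n m} (E : Expr k s n m) → wkˣ (wkᵅ E) ≡ wkᵅ (wkˣ E)
wkˣ-wkᵅ E = trans (ren-ren (λ _ → refl) (λ _ → refl) E) (sym (ren-ren (λ _ → refl) (λ _ → refl) E))

sub-wkˣ-wkᵅ : ∀ {k s n m n′ m′} (σ : Fin n → Term k n′ m′) (τ : Fin m → Coterm k n′ m′) →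
              (E : Expr k s (suc n) m) →
              sub ((wkᵅ ∘ σ) ⇑ˣ) (wkˣ ∘ (τ ⇑ᵅ)) (wkᵅ E) ≡ wkᵅ (sub (σ ⇑ˣ) (wkˣ ∘ τ) E)
sub-wkˣ-wkᵅ σ τ E = trans (sub-ren (λ _ → refl) (λ _ → refl) E)
  (sym (ren-sub (λ { zero → refl ; (suc x) → sym (wkˣ-wkᵅ (σ x)) }) (λ x → sym (wkˣ-wkᵅ (τ x))) E))

-- Abstracting over occurs zero C cannot expose the clauses of mono-acc, because
-- they also mention the equation o : occurs zero C ≡ b.  The points p and q of
-- ⊤ are convertible but syntactically different, so that abstracting over
-- occurs zero (g q) leaves the left-hand side of o alone.

sub-mono-acc : ∀ {k n m n′ m′} (σ : Fin n → Term k n′ m′) (τ : Fin m → Coterm k n′ m′)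
  (g : ⊤ → Ty (suc k)) (p q : ⊤) a A B {M N M′ N′} →
  sub (σ ⇑ˣ) (wkˣ ∘ τ) M ≡ M′ → sub σ τ N ≡ N′ →
  sub σ τ (mono-acc (g q) a A B M N) ≡ mono-acc (g q) a A B M′ N′
sub-mono-occ : ∀ {k n m n′ m′} (σ : Fin n → Term k n′ m′) (τ : Fin m → Coterm k n′ m′) →
  ∀ C o a A B {M N M′ N′} →
  sub (σ ⇑ˣ) (wkˣ ∘ τ) M ≡ M′ → sub σ τ N ≡ N′ →
  sub σ τ (mono-occ C o a A B M N) ≡ mono-occ C o a A B M′ N′

sub-mono-acc σ τ g p q a A B eM eN
  with occurs zero (g q) | id {A = occurs zero (g p) ≡ occurs zero (g q)} refl
... | false | _ = eN
... | true  | o = sub-mono-occ σ τ (g p) o a A B eM eN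

sub-mono-occ σ τ (tvar zero) _ _ A B {M} {N} refl refl =
  cong₂ (λ N M → ⟪ N • x·⟪ M • covar zero ⟫ ⟫·α) (sub-wkᵅ σ τ N) (sub-wkˣ-wkᵅ σ τ M)
sub-mono-occ σ τ (C ∧ᵗ D) _ (acc rs) A B {M} {N} refl refl = cong₂ ⟨_,_⟩
  (sub-mono-acc σ τ (λ _ → C) tt tt _ A B refl (cong (λ N → ⟪ N • fst[ covar zero ] ⟫·α) (sub-wkᵅ σ τ N)))
  (sub-mono-acc σ τ (λ _ → D) tt tt _ A B refl (cong (λ N → ⟪ N • snd[ covar zero ] ⟫·α) (sub-wkᵅ σ τ N)))
sub-mono-occ σ τ (C ∨ᵗ D) _ (acc rs) A B {M} {N} refl refl = cong ⟪_⟫·α (cong₂ _•_ (sub-wkᵅ σ τ N) (cong₂ [_,_]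
  (cong (λ M → x·⟪ ⟨ M ⟩inl • covar zero ⟫)
        (sub-mono-acc _ _ (λ _ → C) tt tt _ A B (sub-lift-suc (λ _ → refl) (λ _ → refl) M) refl))
  (cong (λ M → x·⟪ ⟨ M ⟩inr • covar zero ⟫)
        (sub-mono-acc _ _ (λ _ → D) tt tt _ A B (sub-lift-suc (λ _ → refl) (λ _ → refl) M) refl))))
sub-mono-occ σ τ (¬ᵗ C) _ (acc rs) A B {M} {N} refl refl =
  cong₂ (λ N M → [ x·⟪ N • not⟨ M ⟩ ⟫ ]not) (sub-wkˣ σ τ N)
        (sub-mono-acc _ _ (λ _ → C) tt tt _ B A (sub-lift-suc (ren-id-≡ ∘ σ) (ren-id-≡ ∘ τ) M) refl)
sub-mono-occ σ τ (μ C p) _ (acc rs) A B {M} {N} refl refl =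
  cong₂ (λ N M → ⟪ N • itr (μ (C [ B /X]) ([/X]-Pos C B p))
                           x·⟪ inμ (C [ B /X]) ([/X]-Pos C B p) M • covar zero ⟫ (covar zero) ⟫·α)
        (sub-wkᵅ σ τ N)
        (sub-mono-acc _ _ (λ _ → C [ μ (C [ B /X]) ([/X]-Pos C B p) /Y]) tt tt _ A B
          (sub-lift-suc (wk²ᵅ ∘ σ) (wk²ᵅ ∘ τ) M) refl)
sub-mono-occ σ τ (ν C p) _ (acc rs) A B {M} {N} refl refl =
  cong (λ M → coitr _ M (sub σ τ N))
       (sub-mono-acc _ _ (λ _ → C [ ν (C [ A /X]) ([/X]-Pos C A p) /Y]) tt tt _ A B
          (sub-lift-suc (ren-id-≡ ∘ σ) (ren-id-≡ ∘ τ) M) refl)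

sub-mono : ∀ {k n m n′ m′} (σ : Fin n → Term k n′ m′) (τ : Fin m → Coterm k n′ m′) → ∀ C A B M N →
  sub σ τ (mono C A B M N) ≡ mono C A B (sub (σ ⇑ˣ) (wkˣ ∘ τ) M) (sub σ τ N)
sub-mono σ τ C A B M N = sub-mono-acc σ τ (λ _ → C) tt tt _ A B refl refl

-- `comono` is `mono` conjugated by duality, so its naturality is that of `mono` for the
-- substitution with dualised entries and exchanged scopes.
sub-comono : ∀ {k n m n′ m′} (σ : Fin n → Term k n′ m′) (τ : Fin m → Coterm k n′ m′) → ∀ C A B K L →
  sub σ τ (comono C A B K L) ≡ comono C A B (sub (wkᵅ ∘ σ) (τ ⇑ᵅ) K) (sub σ τ L)
sub-comono {k} σ τ C A B K L = begin
  sub σ τ (dual F)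
    ≡⟨ dual-sub (dual-involutiveᵗ ∘ σ) (dual-involutiveᶜ ∘ τ) F ⟨
  dual (sub (dual ∘ τ) (dual ∘ σ) F)
    ≡⟨ cong dual (sub-mono (dual ∘ τ) (dual ∘ σ) (dualT C) (dualT B) (dualT A) (dual K) (dual L)) ⟩
  dual (mono (dualT C) (dualT B) (dualT A)
             (sub ((dual ∘ τ) ⇑ˣ) (wkˣ ∘ dual ∘ σ) (dual K)) (sub (dual ∘ τ) (dual ∘ σ) (dual L)))
    ≡⟨ cong₂ (λ K L → dual (mono (dualT C) (dualT B) (dualT A) K L))
             (dual-sub (dual-⇑ᵅ τ) (λ x → dual-ren id suc (σ x)) K)
             (dual-sub (λ _ → refl) (λ _ → refl) L) ⟨
  comono C A B (sub (wkᵅ ∘ σ) (τ ⇑ᵅ) K) (sub σ τ L) ∎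
  where
  open ≡-Reasoning
  F = mono (dualT C) (dualT B) (dualT A) (dual K) (dual L)

-- Values, redexes and substitution

value-sub : ∀ {k n m n′ m′} {σ : Fin n → Term k n′ m′} {τ : Fin m → Coterm k n′ m′} →
            (∀ x → Value (σ x)) → ∀ {V} → Value V → Value (sub σ τ V)
value-sub v (var {x})     = v x
value-sub v ⟨ V , W ⟩     = ⟨ value-sub v V , value-sub v W ⟩
value-sub v ⟨ V ⟩inl      = ⟨ value-sub v V ⟩inl
value-sub v ⟨ V ⟩inr      = ⟨ value-sub v V ⟩inr
value-sub v [ K ]not      = [ _ ]not
value-sub v (inμ A p V)   = inμ A p (value-sub v V)
value-sub v (coitr A M V) = coitr A _ (value-sub v V)

-- A variable is itself a value, and every other head constructor survives substitution. Non-values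
-- therefore stay non-values, which keeps ς-redexes alive under substitution.
value-sub⁻¹ : ∀ {k n m n′ m′} {σ : Fin n → Term k n′ m′} {τ : Fin m → Coterm k n′ m′} →
              ∀ M → Value (sub σ τ M) → Value M
value-sub⁻¹ (var x)       _             = var
value-sub⁻¹ ⟨ M , N ⟩     ⟨ V , W ⟩     = ⟨ value-sub⁻¹ M V , value-sub⁻¹ N W ⟩
value-sub⁻¹ ⟨ M ⟩inl      ⟨ V ⟩inl      = ⟨ value-sub⁻¹ M V ⟩inl
value-sub⁻¹ ⟨ M ⟩inr      ⟨ V ⟩inr      = ⟨ value-sub⁻¹ M V ⟩inr
value-sub⁻¹ [ K ]not      _             = [ K ]not
value-sub⁻¹ (inμ A p M)   (inμ _ _ V)   = inμ A p (value-sub⁻¹ M V)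
value-sub⁻¹ (coitr A M N) (coitr _ _ V) = coitr A M (value-sub⁻¹ N V)

value? : ∀ {k n m} (M : Term k n m) → Dec (Value M)
value? (var x) = yes var
value? ⟨ M , N ⟩ with value? M | value? N
... | yes V | yes W = yes ⟨ V , W ⟩
... | no ¬V | _     = no λ { ⟨ V , _ ⟩ → ¬V V }
... | yes _ | no ¬W = no λ { ⟨ _ , W ⟩ → ¬W W }
value? ⟨ M ⟩inl with value? M
... | yes V = yes ⟨ V ⟩inl
... | no ¬V = no λ { ⟨ V ⟩inl → ¬V V }
value? ⟨ M ⟩inr with value? M
... | yes V = yes ⟨ V ⟩inr
... | no ¬V = no λ { ⟨ V ⟩inr → ¬V V }
value? [ K ]not = yes [ K ]not
value? ⟪ S ⟫·α = no λ ()
value? (inμ A p M) with value? M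
... | yes V = yes (inμ A p V)
... | no ¬V = no λ { (inμ _ _ V) → ¬V V }
value? (coitr A M N) with value? N
... | yes V = yes (coitr A M V)
... | no ¬V = no λ { (coitr _ _ V) → ¬V V }

data Kind : Set where
  β η ς : Kind

kind : ∀ {k s n m} {D E : Expr k s n m} → D ▷ᵛ E → Kind
kind (β-fst _ _)  = β
kind (β-snd _ _)  = β
kind (β-inl _)    = β
kind (β-inr _)    = β
kind β-not        = β
kind β-α          = β
kind (β-x _)      = β
kind (β-μ _)      = β
kind (β-ν _)      = β
kind η-α          = η
kind η-x          = η
kind (ς-⟨,⟩ˡ _)   = ς
kind (ς-⟨,⟩ʳ _ _) = ς
kind (ς-inl _)    = ς
kind (ς-inr _)    = ς
kind (ς-in _)     = ς
kind (ς-coitr _)  = ς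

infix 4 _▷[_]_

-- The kind is attached by an equation instead of by three separate relations: stability,
-- determinism and reflection are proved once for all rules, and the equation excludes the rules of
-- the other kinds in a case analysis.
_▷[_]_ : ∀ {k s n m} → Expr k s n m → Kind → Expr k s n m → Set
D ▷[ κ ] E = Σ[ r ∈ D ▷ᵛ E ] kind r ≡ κ

▷-respˡ : ∀ {k s n m κ} {D D′ E : Expr k s n m} → D ≡ D′ → D ▷[ κ ] E → D′ ▷[ κ ] E
▷-respˡ refl r = r

▷-respʳ : ∀ {k s n m κ} {D E E′ : Expr k s n m} → E ≡ E′ → D ▷[ κ ] E → D ▷[ κ ] E′
▷-respʳ refl r = r

sub-/α : ∀ {k s n m n′ m′} (σ : Fin n → Term k n′ m′) (τ : Fin m → Coterm k n′ m′) →
         (E : Expr k s n (suc m)) (K : Coterm k n m) →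
         sub (wkᵅ ∘ σ) (τ ⇑ᵅ) E [ sub σ τ K /α] ≡ sub σ τ (E [ K /α])
sub-/α σ τ E K =
  trans (sub-sub {τ″ = sub σ τ K ∷ τ} (λ x → wkᵅ-/α _ (σ x)) (λ { zero → refl ; (suc x) → wkᵅ-/α _ (τ x) }) E)
        (sym (sub-sub (λ _ → refl) (λ { zero → refl ; (suc x) → refl }) E))

sub-/x : ∀ {k s n m n′ m′} (σ : Fin n → Term k n′ m′) (τ : Fin m → Coterm k n′ m′) →
         (E : Expr k s (suc n) m) (M : Term k n m) →
         sub (σ ⇑ˣ) (wkˣ ∘ τ) E [ sub σ τ M /x] ≡ sub σ τ (E [ M /x])
sub-/x σ τ E M =
  trans (sub-sub {σ″ = sub σ τ M ∷ σ} (λ { zero → refl ; (suc x) → wkˣ-/x _ (σ x) }) (λ x → wkˣ-/x _ (τ x)) E)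
        (sym (sub-sub (λ { zero → refl ; (suc x) → refl }) (λ _ → refl) E))

-- The `itr` inside `μ-contractum` lies under two further covariables, the one bound by the outer
-- `⟪_⟫·α` and the one abstracted in `comono`. The renaming jumps over both and keeps the covariable
-- bound by `itr`.
sub-lift-2ᵅ : ∀ {k s n m n′ m′} (σ : Fin n → Term k n′ m′) (τ : Fin m → Coterm k n′ m′) →
              (E : Expr k s n (suc m)) →
              sub (wkᵅ ∘ wkᵅ ∘ wkᵅ ∘ σ) (((τ ⇑ᵅ) ⇑ᵅ) ⇑ᵅ) (ren id (lift 1 (2 ↑ʳ_)) E) ≡
              ren id (lift 1 (2 ↑ʳ_)) (sub (wkᵅ ∘ σ) (τ ⇑ᵅ) E)
sub-lift-2ᵅ σ τ E = trans (sub-ren (λ _ → refl) (λ _ → refl) E)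
  (sym (ren-sub (wk³ ∘ σ) (λ { zero → refl ; (suc x) → wk³ (τ x) }) E))
  where
  wk³ : ∀ {k s n m} (F : Expr k s n m) → ren id (lift 1 (2 ↑ʳ_)) (wkᵅ F) ≡ wkᵅ (wkᵅ (wkᵅ F))
  wk³ F = trans (ren-wkᵅ id (2 ↑ʳ_) F) (cong wkᵅ (sym (ren-ren (λ _ → refl) (λ _ → refl) F)))

sub-lift-2ˣ : ∀ {k s n m n′ m′} (σ : Fin n → Term k n′ m′) (τ : Fin m → Coterm k n′ m′) →
              (E : Expr k s (suc n) m) →
              sub (((σ ⇑ˣ) ⇑ˣ) ⇑ˣ) (wkˣ ∘ wkˣ ∘ wkˣ ∘ τ) (ren (lift 1 (2 ↑ʳ_)) id E) ≡
              ren (lift 1 (2 ↑ʳ_)) id (sub (σ ⇑ˣ) (wkˣ ∘ τ) E)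
sub-lift-2ˣ σ τ E = trans (sub-ren (λ _ → refl) (λ _ → refl) E)
  (sym (ren-sub (λ { zero → refl ; (suc x) → wk³ (σ x) }) (wk³ ∘ τ) E))
  where
  wk³ : ∀ {k s n m} (F : Expr k s n m) → ren (lift 1 (2 ↑ʳ_)) id (wkˣ F) ≡ wkˣ (wkˣ (wkˣ F))
  wk³ F = trans (ren-wkˣ (2 ↑ʳ_) id F) (cong wkˣ (sym (ren-ren (λ _ → refl) (λ _ → refl) F)))

module _ {k n m n′ m′} (σ : Fin n → Term k n′ m′) (τ : Fin m → Coterm k n′ m′) where

  sub-μ-contractum : ∀ C .p M A K L →
    μ-contractum C p (sub σ τ M) A (sub (wkᵅ ∘ σ) (τ ⇑ᵅ) K) (sub σ τ L) ≡
    sub σ τ (μ-contractum C p M A K L)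
  sub-μ-contractum C p M A K L = sym
    (cong₂ (λ M K → ⟪ M • K ⟫·α • sub σ τ L) (sub-wkᵅ σ τ M)
      (trans (sub-comono (wkᵅ ∘ σ) (τ ⇑ᵅ) C (μ C p) A _ K)
             (cong (λ K′ → comono C (μ C p) A (itr A K′ (covar zero)) (sub (wkᵅ ∘ σ) (τ ⇑ᵅ) K))
                   (sub-lift-2ᵅ σ τ K))))

  sub-ν-contractum : ∀ C .p A M N K →
    ν-contractum C p A (sub (σ ⇑ˣ) (wkˣ ∘ τ) M) (sub σ τ N) (sub σ τ K) ≡
    sub σ τ (ν-contractum C p A M N K)
  sub-ν-contractum C p A M N K = sym
    (cong₂ (λ M K → sub σ τ N • x·⟪ M • K ⟫)
      (trans (sub-mono (σ ⇑ˣ) (wkˣ ∘ τ) C A (ν C p) _ M)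
             (cong (λ M′ → mono C A (ν C p) (coitr A M′ (var zero)) (sub (σ ⇑ˣ) (wkˣ ∘ τ) M))
                   (sub-lift-2ˣ σ τ M)))
      (sub-wkˣ σ τ K))

  sub-wkˣwkᵅ : ∀ {s} (E : Expr k s n m) →
               wkˣ (wkᵅ (sub σ τ E)) ≡ sub ((wkᵅ ∘ σ) ⇑ˣ) (wkˣ ∘ (τ ⇑ᵅ)) (wkˣ (wkᵅ E))
  sub-wkˣwkᵅ E = sym (trans (sub-wkˣ (wkᵅ ∘ σ) (τ ⇑ᵅ) (wkᵅ E)) (cong wkˣ (sub-wkᵅ σ τ E)))

  module _ (v : ∀ x → Value (σ x)) where

    nonvalue-sub : ∀ {M} → ¬ Value M → ¬ Value (sub σ τ M)
    nonvalue-sub {M} ¬V V = ¬V (value-sub⁻¹ M V)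

    sub-▷ : ∀ {s κ} {D E : Expr k s n m} → D ▷[ κ ] E → sub σ τ D ▷[ κ ] sub σ τ E
    sub-▷ (β-fst V W , e) = β-fst (value-sub v V) (value-sub v W) , e
    sub-▷ (β-snd V W , e) = β-snd (value-sub v V) (value-sub v W) , e
    sub-▷ (β-inl V , e)   = β-inl (value-sub v V) , e
    sub-▷ (β-inr V , e)   = β-inr (value-sub v V) , e
    sub-▷ (β-not , e)     = β-not , e
    sub-▷ (β-α {S} {K} , e) = ▷-respʳ (sub-/α σ τ S K) (β-α , e)
    sub-▷ (β-x {V} {S} w , e) = ▷-respʳ (sub-/x σ τ S V) (β-x (value-sub v w) , e)
    sub-▷ (β-μ {C} {p} {V} {A} {K} {L} w , e) =
      ▷-respʳ (sub-μ-contractum C p V A K L) (β-μ (value-sub v w) , e)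
    sub-▷ (β-ν {C} {p} {A} {M} {V} {K} w , e) =
      ▷-respʳ (sub-ν-contractum C p A M V K) (β-ν (value-sub v w) , e)
    -- In the η-rules the weakening sits in the redex and not in the contractum, so the equation is
    -- applied on the left.
    sub-▷ (η-α {M} , e) =
      ▷-respˡ (cong (λ M′ → ⟪ M′ • covar zero ⟫·α) (sym (sub-wkᵅ σ τ M))) (η-α , e)
    sub-▷ (η-x {K} , e) =
      ▷-respˡ (cong (λ K′ → x·⟪ var zero • K′ ⟫) (sym (sub-wkˣ σ τ K))) (η-x , e)
    sub-▷ (ς-⟨,⟩ˡ {M} {N} ¬V , e) =
      ▷-respʳ (cong₂ (λ M′ N′ → ⟪ M′ • x·⟪ ⟨ var zero , N′ ⟩ • covar zero ⟫ ⟫·α)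
                     (sym (sub-wkᵅ σ τ M)) (sub-wkˣwkᵅ N))
              (ς-⟨,⟩ˡ (nonvalue-sub ¬V) , e)
    sub-▷ (ς-⟨,⟩ʳ {V} {M} w ¬V , e) =
      ▷-respʳ (cong₂ (λ M′ V′ → ⟪ M′ • x·⟪ ⟨ V′ , var zero ⟩ • covar zero ⟫ ⟫·α)
                     (sym (sub-wkᵅ σ τ M)) (sub-wkˣwkᵅ V))
              (ς-⟨,⟩ʳ (value-sub v w) (nonvalue-sub ¬V) , e)
    sub-▷ (ς-inl {M} ¬V , e) =
      ▷-respʳ (cong (λ M′ → ⟪ M′ • x·⟪ ⟨ var zero ⟩inl • covar zero ⟫ ⟫·α) (sym (sub-wkᵅ σ τ M)))
              (ς-inl (nonvalue-sub ¬V) , e)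
    sub-▷ (ς-inr {M} ¬V , e) =
      ▷-respʳ (cong (λ M′ → ⟪ M′ • x·⟪ ⟨ var zero ⟩inr • covar zero ⟫ ⟫·α) (sym (sub-wkᵅ σ τ M)))
              (ς-inr (nonvalue-sub ¬V) , e)
    sub-▷ (ς-in {C} {p} {M} ¬V , e) =
      ▷-respʳ (cong (λ M′ → ⟪ M′ • x·⟪ inμ C p (var zero) • covar zero ⟫ ⟫·α) (sym (sub-wkᵅ σ τ M)))
              (ς-in (nonvalue-sub ¬V) , e)
    sub-▷ (ς-coitr {A} {M} {N} ¬V , e) =
      ▷-respʳ (cong₂ (λ N′ M′ → ⟪ N′ • x·⟪ coitr A M′ (var zero) • covar zero ⟫ ⟫·α)
                     (sym (sub-wkᵅ σ τ N)) (sym (sub-lift-suc (λ _ → refl) (λ _ → refl) M)))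
              (ς-coitr (nonvalue-sub ¬V) , e)

ren-▷ : ∀ {k s n m n′ m′ κ} (ρ : Fin n → Fin n′) (θ : Fin m → Fin m′) {D E : Expr k s n m} →
        D ▷[ κ ] E → ren ρ θ D ▷[ κ ] ren ρ θ E
ren-▷ {κ = κ} ρ θ {D} {E} r =
  subst₂ (_▷[ κ ]_) (sym (ren-as-sub (λ _ → refl) (λ _ → refl) D))
                    (sym (ren-as-sub (λ _ → refl) (λ _ → refl) E))
                    (sub-▷ (var ∘ ρ) (covar ∘ θ) (λ _ → var) r)

value-ren : ∀ {k n m n′ m′} (ρ : Fin n → Fin n′) (θ : Fin m → Fin m′) {V : Term k n m} →
            Value V → Value (ren ρ θ V)
value-ren ρ θ {V} v =
  subst Value (sym (ren-as-sub (λ _ → refl) (λ _ → refl) V)) (value-sub (λ _ → var) v)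

value-ren⁻¹ : ∀ {k n m n′ m′} (ρ : Fin n → Fin n′) (θ : Fin m → Fin m′) (M : Term k n m) →
              Value (ren ρ θ M) → Value M
value-ren⁻¹ ρ θ M v = value-sub⁻¹ M (subst Value (ren-as-sub (λ _ → refl) (λ _ → refl) M) v)

-- One-layer congruence

-- Separating one level of congruence from the relation on the subexpressions lets parallel
-- reduction, sequences of steps, propositional equality and relations pulled back along `dual`
-- share the same case analysis.
data Layer {k} (Q : ∀ {s n m} → Rel (Expr k s n m) 0ℓ) : ∀ {s n m} → Rel (Expr k s n m) 0ℓ where
  var    : ∀ {n m} {x : Fin n} → Layer Q {n = n} {m} (var x) (var x)
  ⟨_,_⟩  : ∀ {n m} {M M′ N N′ : Term k n m} → Q M M′ → Q N N′ → Layer Q ⟨ M , N ⟩ ⟨ M′ , N′ ⟩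
  ⟨_⟩inl : ∀ {n m} {M M′ : Term k n m} → Q M M′ → Layer Q ⟨ M ⟩inl ⟨ M′ ⟩inl
  ⟨_⟩inr : ∀ {n m} {M M′ : Term k n m} → Q M M′ → Layer Q ⟨ M ⟩inr ⟨ M′ ⟩inr
  [_]not : ∀ {n m} {K K′ : Coterm k n m} → Q K K′ → Layer Q [ K ]not [ K′ ]not
  ⟪_⟫·α  : ∀ {n m} {S S′ : Statement k n (suc m)} → Q S S′ → Layer Q ⟪ S ⟫·α ⟪ S′ ⟫·α
  inμ    : ∀ {n m A} .{p} {M M′ : Term k n m} → Q M M′ → Layer Q (inμ A p M) (inμ A p M′)
  coitr  : ∀ {n m A} {M M′ : Term k (suc n) m} {N N′} → Q M M′ → Q N N′ →
           Layer Q (coitr A M N) (coitr A M′ N′)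
  covar  : ∀ {n m} {x : Fin m} → Layer Q {n = n} {m} (covar x) (covar x)
  [_,_]  : ∀ {n m} {K K′ L L′ : Coterm k n m} → Q K K′ → Q L L′ → Layer Q [ K , L ] [ K′ , L′ ]
  fst[_] : ∀ {n m} {K K′ : Coterm k n m} → Q K K′ → Layer Q fst[ K ] fst[ K′ ]
  snd[_] : ∀ {n m} {K K′ : Coterm k n m} → Q K K′ → Layer Q snd[ K ] snd[ K′ ]
  not⟨_⟩ : ∀ {n m} {M M′ : Term k n m} → Q M M′ → Layer Q not⟨ M ⟩ not⟨ M′ ⟩
  x·⟪_⟫  : ∀ {n m} {S S′ : Statement k (suc n) m} → Q S S′ → Layer Q x·⟪ S ⟫ x·⟪ S′ ⟫
  outν   : ∀ {n m A} .{p} {K K′ : Coterm k n m} → Q K K′ → Layer Q (outν A p K) (outν A p K′)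
  itr    : ∀ {n m A} {K K′ : Coterm k n (suc m)} {L L′} → Q K K′ → Q L L′ →
           Layer Q (itr A K L) (itr A K′ L′)
  _•_    : ∀ {n m} {M M′ : Term k n m} {K K′} → Q M M′ → Q K K′ → Layer Q (M • K) (M′ • K′)

module _ {k} {Q : ∀ {s n m} → Rel (Expr k s n m) 0ℓ} where

  layer-refl : (∀ {s n m} (E : Expr k s n m) → Q E E) → ∀ {s n m} (E : Expr k s n m) → Layer Q E E
  layer-refl q (var x)       = var
  layer-refl q ⟨ M , N ⟩     = ⟨ q M , q N ⟩
  layer-refl q ⟨ M ⟩inl      = ⟨ q M ⟩inl
  layer-refl q ⟨ M ⟩inr      = ⟨ q M ⟩inr
  layer-refl q [ K ]not      = [ q K ]not
  layer-refl q ⟪ S ⟫·α       = ⟪ q S ⟫·α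
  layer-refl q (inμ A p M)   = inμ (q M)
  layer-refl q (coitr A M N) = coitr (q M) (q N)
  layer-refl q (covar α)     = covar
  layer-refl q [ K , L ]     = [ q K , q L ]
  layer-refl q fst[ K ]      = fst[ q K ]
  layer-refl q snd[ K ]      = snd[ q K ]
  layer-refl q not⟨ M ⟩      = not⟨ q M ⟩
  layer-refl q x·⟪ S ⟫       = x·⟪ q S ⟫
  layer-refl q (outν A p K)  = outν (q K)
  layer-refl q (itr A K L)   = itr (q K) (q L)
  layer-refl q (M • K)       = q M • q K

  layer-dual : ∀ {s n m} {D E : Expr k s n m} → Layer (λ D E → Q (dual D) (dual E)) D E →
               Layer Q (dual D) (dual E)
  layer-dual var         = covar
  layer-dual ⟨ q , r ⟩   = [ q , r ]
  layer-dual ⟨ q ⟩inl    = fst[ q ]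
  layer-dual ⟨ q ⟩inr    = snd[ q ]
  layer-dual [ q ]not    = not⟨ q ⟩
  layer-dual ⟪ q ⟫·α     = x·⟪ q ⟫
  layer-dual (inμ q)     = outν q
  layer-dual (coitr q r) = itr q r
  layer-dual covar       = var
  layer-dual [ q , r ]   = ⟨ q , r ⟩
  layer-dual fst[ q ]    = ⟨ q ⟩inl
  layer-dual snd[ q ]    = ⟨ q ⟩inr
  layer-dual not⟨ q ⟩    = [ q ]not
  layer-dual x·⟪ q ⟫     = ⟪ q ⟫·α
  layer-dual (outν q)    = inμ q
  layer-dual (itr q r)   = coitr q r
  layer-dual (q • r)     = r • q

-- Serves as injectivity of all constructors at once. Matching an equation between renamed
-- expressions with `refl` gets stuck, whereas its layer yields equations between the parts.
≡-layer : ∀ {k s n m} {D E : Expr k s n m} → D ≡ E → Layer _≡_ D E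
≡-layer refl = layer-refl (λ _ → refl) _

-- For a fixed type `C`, `mono` is a context made of constructors, with renamed copies of `M` and
-- `N` in its holes. Closure under layers and renaming is thus all that `Q` must provide. `Q` stays
-- abstract because the call for coterms uses a relation between duals.
module MonoCong {k} (Q : ∀ {s n m} → Rel (Expr k s n m) 0ℓ)
  (close : ∀ {s n m} {D E : Expr k s n m} → Layer Q D E → Q D E)
  (rename : ∀ {s n m n′ m′} (ρ : Fin n → Fin n′) (θ : Fin m → Fin m′) {D E : Expr k s n m} →
            Q D E → Q (ren ρ θ D) (ren ρ θ E)) where

  -- The points p and q serve the same purpose as in sub-mono-acc.

  mono-acc-cong : ∀ {n m} (g : ⊤ → Ty (suc k)) (p q : ⊤) a A B {M M′ : Term k (suc n) m} {N N′} →
                  Q M M′ → Q N N′ → Q (mono-acc (g q) a A B M N) (mono-acc (g q) a A B M′ N′)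
  mono-occ-cong : ∀ {n m} C o a A B {M M′ : Term k (suc n) m} {N N′} →
                  Q M M′ → Q N N′ → Q (mono-occ C o a A B M N) (mono-occ C o a A B M′ N′)

  mono-acc-cong g p q a A B r s
    with occurs zero (g q) | id {A = occurs zero (g p) ≡ occurs zero (g q)} refl
  ... | false | _ = s
  ... | true  | o = mono-occ-cong (g p) o a A B r s

  mono-occ-cong (tvar zero) _ _ A B r s =
    close ⟪ close (rename id suc s • close x·⟪ close (rename id suc r • close covar) ⟫) ⟫·α
  mono-occ-cong (C ∧ᵗ D) _ (acc rs) A B r s = close
    ⟨ mono-acc-cong (λ _ → C) tt tt _ A B r
        (close ⟪ close (rename id suc s • close fst[ close covar ]) ⟫·α)
    , mono-acc-cong (λ _ → D) tt tt _ A B r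
        (close ⟪ close (rename id suc s • close snd[ close covar ]) ⟫·α) ⟩
  mono-occ-cong (C ∨ᵗ D) _ (acc rs) A B r s = close ⟪ close (rename id suc s • close
    [ close x·⟪ close (close ⟨ mono-acc-cong (λ _ → C) tt tt _ A B (rename (lift 1 suc) suc r) (close var) ⟩inl
                       • close covar) ⟫
    , close x·⟪ close (close ⟨ mono-acc-cong (λ _ → D) tt tt _ A B (rename (lift 1 suc) suc r) (close var) ⟩inr
                       • close covar) ⟫ ]) ⟫·α
  mono-occ-cong (¬ᵗ C) _ (acc rs) A B r s = close [ close x·⟪ close (rename suc id s • close
    not⟨ mono-acc-cong (λ _ → C) tt tt _ B A (rename (lift 1 suc) id r) (close var) ⟩) ⟫ ]not
  mono-occ-cong (μ C p) _ (acc rs) A B r s = close ⟪ close (rename id suc s • close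
    (itr (close x·⟪ close (close (inμ
           (mono-acc-cong (λ _ → C [ μ (C [ B /X]) ([/X]-Pos C B p) /Y]) tt tt _ A B
             (rename (lift 1 suc) (2 ↑ʳ_) r) (close var)))
           • close covar) ⟫)
         (close covar))) ⟫·α
  mono-occ-cong (ν C p) _ (acc rs) A B r s = close (coitr
    (mono-acc-cong (λ _ → C [ ν (C [ A /X]) ([/X]-Pos C A p) /Y]) tt tt _ A B (rename (lift 1 suc) id r)
      (close ⟪ close (close var • close (outν (close covar))) ⟫·α))
    s)

  mono-cong : ∀ {n m} C A B {M M′ : Term k (suc n) m} {N N′} → Q M M′ → Q N N′ →
              Q (mono C A B M N) (mono C A B M′ N′)
  mono-cong C A B = mono-acc-cong (λ _ → C) tt tt _ A B

  ν-contractum-cong : ∀ {n m} C .{p} A {M M′ : Term k (suc n) m} {N N′ K K′} →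
                      Q M M′ → Q N N′ → Q K K′ →
                      Q (ν-contractum C p A M N K) (ν-contractum C p A M′ N′ K′)
  ν-contractum-cong C {p} A r s t = close (s • close x·⟪ close
    (mono-cong C A (ν C p) (close (coitr (rename (lift 1 (2 ↑ʳ_)) id r) (close var))) r • rename suc id t) ⟫)

module ComonoCong {k} (Q : ∀ {s n m} → Rel (Expr k s n m) 0ℓ)
  (close : ∀ {s n m} {D E : Expr k s n m} → Layer Q D E → Q D E)
  (rename : ∀ {s n m n′ m′} (ρ : Fin n → Fin n′) (θ : Fin m → Fin m′) {D E : Expr k s n m} →
            Q D E → Q (ren ρ θ D) (ren ρ θ E)) where

  -- Since `comono` is the dual of a `mono`, the congruence of `mono` is used for the relation that
  -- holds between two expressions when `Q` holds between their duals; `layer-dual` closes that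
  -- relation under layers.
  comono-cong : ∀ {n m} C A B {K K′ : Coterm k n (suc m)} {L L′} → Q K K′ → Q L L′ →
                Q (comono C A B K L) (comono C A B K′ L′)
  comono-cong C A B r s = D.mono-cong (dualT C) (dualT B) (dualT A)
    (subst₂ Q (sym (dual-involutiveᶜ _)) (sym (dual-involutiveᶜ _)) r)
    (subst₂ Q (sym (dual-involutiveᶜ _)) (sym (dual-involutiveᶜ _)) s)
    where
    module D = MonoCong (λ D E → Q (dual D) (dual E)) (close ∘ layer-dual)
      (λ ρ θ {D} {E} q → subst₂ Q (sym (dual-ren ρ θ D)) (sym (dual-ren ρ θ E)) (rename θ ρ q))

  μ-contractum-cong : ∀ {n m} C .{p} A {M M′ : Term k n m} {K K′ L L′} →
                      Q M M′ → Q K K′ → Q L L′ →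
                      Q (μ-contractum C p M A K L) (μ-contractum C p M′ A K′ L′)
  μ-contractum-cong C {p} A r s t = close (close ⟪ close (rename id suc r •
    comono-cong C (μ C p) A (close (itr (rename id (lift 1 (2 ↑ʳ_)) s) (close covar))) s) ⟫·α • t)

-- Renaming reflects redexes

lift-pullback : ∀ {n n′ n″ o} {ρ : Fin n → Fin o} {ρ′ : Fin n′ → Fin o} {ρ″ : Fin n″ → Fin n} →
                (∀ x y → ρ x ≡ ρ′ y → ∃[ z ] x ≡ ρ″ z) →
                ∀ x y → lift 1 ρ x ≡ lift 1 ρ′ y → ∃[ z ] x ≡ lift 1 ρ″ z
lift-pullback h zero    y       e = zero , refl
lift-pullback h (suc x) (suc y) e with h x y (suc-injective e)
... | z , refl = suc z , refl

var-injective : ∀ {k n m} {x y : Fin n} → Layer {k} _≡_ {n = n} {m} (var x) (var y) → x ≡ y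
var-injective var = refl

covar-injective : ∀ {k n m} {x y : Fin m} → Layer {k} _≡_ {n = n} {m} (covar x) (covar y) → x ≡ y
covar-injective covar = refl

-- A strengthening lemma in a form that passes under binders: a name of `D` whose image is also hit
-- by the primed map must come from the doubly primed one. When the primed maps are a weakening, it
-- says that `D` is a weakening as soon as its renaming is one; η-redexes are recognised through a
-- renaming in this way.
ren-pullback : ∀ {k s n m n′ m′ n″ m″ o q} {ρ : Fin n → Fin o} {θ : Fin m → Fin q}
               {ρ′ : Fin n′ → Fin o} {θ′ : Fin m′ → Fin q} {ρ″ : Fin n″ → Fin n} {θ″ : Fin m″ → Fin m} →
               (∀ x y → ρ x ≡ ρ′ y → ∃[ z ] x ≡ ρ″ z) → (∀ x y → θ x ≡ θ′ y → ∃[ z ] x ≡ θ″ z) →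
               (D : Expr k s n m) (E : Expr k s n′ m′) → Layer _≡_ (ren ρ θ D) (ren ρ′ θ′ E) →
               ∃[ F ] D ≡ ren ρ″ θ″ F
ren-pullback h i (var x) (var y) ℓ with h x y (var-injective ℓ)
... | z , refl = var z , refl
ren-pullback h i ⟨ M , N ⟩ ⟨ M′ , N′ ⟩ ⟨ d , e ⟩
  with ren-pullback h i M M′ (≡-layer d)
     | ren-pullback h i N N′ (≡-layer e)
... | F , refl | G , refl = ⟨ F , G ⟩ , refl
ren-pullback h i ⟨ M ⟩inl ⟨ M′ ⟩inl ⟨ d ⟩inl with ren-pullback h i M M′ (≡-layer d)
... | F , refl = ⟨ F ⟩inl , refl
ren-pullback h i ⟨ M ⟩inr ⟨ M′ ⟩inr ⟨ d ⟩inr with ren-pullback h i M M′ (≡-layer d)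
... | F , refl = ⟨ F ⟩inr , refl
ren-pullback h i [ K ]not [ K′ ]not [ d ]not with ren-pullback h i K K′ (≡-layer d)
... | F , refl = [ F ]not , refl
ren-pullback h i ⟪ S ⟫·α ⟪ S′ ⟫·α ⟪ d ⟫·α with ren-pullback h (lift-pullback i) S S′ (≡-layer d)
... | F , refl = ⟪ F ⟫·α , refl
ren-pullback h i (inμ A p M) (inμ _ _ M′) (inμ d) with ren-pullback h i M M′ (≡-layer d)
... | F , refl = inμ A p F , refl
ren-pullback h i (coitr A M N) (coitr _ M′ N′) (coitr d e)
  with ren-pullback (lift-pullback h) i M M′ (≡-layer d)
     | ren-pullback h i N N′ (≡-layer e)
... | F , refl | G , refl = coitr A F G , refl
ren-pullback h i (covar x) (covar y) ℓ with i x y (covar-injective ℓ)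
... | z , refl = covar z , refl
ren-pullback h i [ K , L ] [ K′ , L′ ] [ d , e ]
  with ren-pullback h i K K′ (≡-layer d)
     | ren-pullback h i L L′ (≡-layer e)
... | F , refl | G , refl = [ F , G ] , refl
ren-pullback h i fst[ K ] fst[ K′ ] fst[ d ] with ren-pullback h i K K′ (≡-layer d)
... | F , refl = fst[ F ] , refl
ren-pullback h i snd[ K ] snd[ K′ ] snd[ d ] with ren-pullback h i K K′ (≡-layer d)
... | F , refl = snd[ F ] , refl
ren-pullback h i not⟨ M ⟩ not⟨ M′ ⟩ not⟨ d ⟩ with ren-pullback h i M M′ (≡-layer d)
... | F , refl = not⟨ F ⟩ , refl
ren-pullback h i x·⟪ S ⟫ x·⟪ S′ ⟫ x·⟪ d ⟫ with ren-pullback (lift-pullback h) i S S′ (≡-layer d)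
... | F , refl = x·⟪ F ⟫ , refl
ren-pullback h i (outν A p K) (outν _ _ K′) (outν d) with ren-pullback h i K K′ (≡-layer d)
... | F , refl = outν A p F , refl
ren-pullback h i (itr A K L) (itr _ K′ L′) (itr d e)
  with ren-pullback h (lift-pullback i) K K′ (≡-layer d)
     | ren-pullback h i L L′ (≡-layer e)
... | F , refl | G , refl = itr A F G , refl
ren-pullback h i (M • K) (M′ • K′) (d • e)
  with ren-pullback h i M M′ (≡-layer d)
     | ren-pullback h i K K′ (≡-layer e)
... | F , refl | G , refl = (F • G) , refl

-- Substituting for the fresh covariable undoes the weakening. The coterm substituted is closed,
-- because the scope may contain no covariable.
wkᵅ-injective : ∀ {k s n m} {D E : Expr k s n m} → wkᵅ D ≡ wkᵅ E → D ≡ E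
wkᵅ-injective {D = D} {E} e =
  trans (sym (wkᵅ-/α K D)) (trans (cong _[ K /α] e) (wkᵅ-/α K E))
  where K = x·⟪ var zero • not⟨ var zero ⟩ ⟫

wkˣ-injective : ∀ {k s n m} {D E : Expr k s n m} → wkˣ D ≡ wkˣ E → D ≡ E
wkˣ-injective {D = D} {E} e =
  trans (sym (wkˣ-/x M D)) (trans (cong _[ M /x] e) (wkˣ-/x M E))
  where M = ⟪ [ covar zero ]not • covar zero ⟫·α

-- The value restriction decides the classical critical pair: `⟪ S ⟫·α • x·⟪ T ⟫` is a redex of
-- `β-α` only, since `⟪ S ⟫·α` is not a value. The equation between the redexes is a separate
-- argument because two weakenings cannot be unified.
▷ᵛ-deterministic : ∀ {k s n m} {D D′ E E′ : Expr k s n m} → D ▷ᵛ E → D′ ▷ᵛ E′ → D ≡ D′ → E ≡ E′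
▷ᵛ-deterministic (β-fst _ _) (β-fst _ _) refl = refl
▷ᵛ-deterministic (β-snd _ _) (β-snd _ _) refl = refl
▷ᵛ-deterministic (β-inl _) (β-inl _) refl = refl
▷ᵛ-deterministic (β-inr _) (β-inr _) refl = refl
▷ᵛ-deterministic β-not β-not refl = refl
▷ᵛ-deterministic β-α β-α refl = refl
▷ᵛ-deterministic (β-x _) (β-x _) refl = refl
▷ᵛ-deterministic (β-μ _) (β-μ _) refl = refl
▷ᵛ-deterministic (β-ν _) (β-ν _) refl = refl
▷ᵛ-deterministic η-α η-α e with ≡-layer e
... | ⟪ d ⟫·α with ≡-layer d
... | f • _ = wkᵅ-injective f
▷ᵛ-deterministic η-x η-x e with ≡-layer e
... | x·⟪ d ⟫ with ≡-layer d
... | _ • f = wkˣ-injective f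
▷ᵛ-deterministic (ς-⟨,⟩ˡ _) (ς-⟨,⟩ˡ _) refl = refl
▷ᵛ-deterministic (ς-⟨,⟩ˡ ¬V) (ς-⟨,⟩ʳ V _) refl = contradiction V ¬V
▷ᵛ-deterministic (ς-⟨,⟩ʳ V _) (ς-⟨,⟩ˡ ¬V) refl = contradiction V ¬V
▷ᵛ-deterministic (ς-⟨,⟩ʳ _ _) (ς-⟨,⟩ʳ _ _) refl = refl
▷ᵛ-deterministic (ς-inl _) (ς-inl _) refl = refl
▷ᵛ-deterministic (ς-inr _) (ς-inr _) refl = refl
▷ᵛ-deterministic (ς-in _) (ς-in _) refl = refl
▷ᵛ-deterministic (ς-coitr _) (ς-coitr _) refl = refl

-- Only the existence of a contractum is claimed. That its renaming is the given `E` follows from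
-- determinism, and `par-ren⁻¹` concludes so.
▷-ren⁻¹ : ∀ {k s n m n′ m′ κ} (ρ : Fin n → Fin n′) (θ : Fin m → Fin m′) (D : Expr k s n m) {D′ E} →
          D′ ▷[ κ ] E → D′ ≡ ren ρ θ D → ∃[ E′ ] D ▷[ κ ] E′
▷-ren⁻¹ ρ θ (⟨ V , W ⟩ • fst[ K ]) (β-fst v w , e) refl =
  _ , β-fst (value-ren⁻¹ ρ θ V v) (value-ren⁻¹ ρ θ W w) , e
▷-ren⁻¹ ρ θ (⟨ V , W ⟩ • snd[ K ]) (β-snd v w , e) refl =
  _ , β-snd (value-ren⁻¹ ρ θ V v) (value-ren⁻¹ ρ θ W w) , e
▷-ren⁻¹ ρ θ (⟨ V ⟩inl • [ K , L ]) (β-inl v , e) refl = _ , β-inl (value-ren⁻¹ ρ θ V v) , e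
▷-ren⁻¹ ρ θ (⟨ V ⟩inr • [ K , L ]) (β-inr v , e) refl = _ , β-inr (value-ren⁻¹ ρ θ V v) , e
▷-ren⁻¹ ρ θ ([ K ]not • not⟨ M ⟩) (β-not , e) refl = _ , β-not , e
▷-ren⁻¹ ρ θ (⟪ S ⟫·α • K) (β-α , e) refl = _ , β-α , e
▷-ren⁻¹ ρ θ (V • x·⟪ S ⟫) (β-x v , e) refl = _ , β-x (value-ren⁻¹ ρ θ V v) , e
▷-ren⁻¹ ρ θ (inμ C p V • itr A K L) (β-μ v , e) refl = _ , β-μ (value-ren⁻¹ ρ θ V v) , e
▷-ren⁻¹ ρ θ (coitr A M V • outν C p K) (β-ν v , e) refl = _ , β-ν (value-ren⁻¹ ρ θ V v) , e
▷-ren⁻¹ ρ θ ⟪ M • covar zero ⟫·α (η-α {M′} , e) d with ≡-layer d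
... | ⟪ f ⟫·α with ≡-layer f
... | g • _ with ren-pullback {ρ″ = id} {θ″ = suc} (λ x y _ → x , refl)
                   (λ { zero y () ; (suc x) y _ → x , refl }) M M′ (≡-layer (sym g))
... | M″ , refl = _ , η-α , e
▷-ren⁻¹ ρ θ x·⟪ var zero • K ⟫ (η-x {K′} , e) d with ≡-layer d
... | x·⟪ f ⟫ with ≡-layer f
... | _ • g with ren-pullback {ρ″ = suc} {θ″ = id} (λ { zero y () ; (suc x) y _ → x , refl })
                   (λ x y _ → x , refl) K K′ (≡-layer (sym g))
... | K″ , refl = _ , η-x , e
▷-ren⁻¹ ρ θ ⟨ M , N ⟩ (ς-⟨,⟩ˡ ¬V , e) refl = _ , ς-⟨,⟩ˡ (¬V ∘ value-ren ρ θ) , e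
▷-ren⁻¹ ρ θ ⟨ V , M ⟩ (ς-⟨,⟩ʳ v ¬V , e) refl =
  _ , ς-⟨,⟩ʳ (value-ren⁻¹ ρ θ V v) (¬V ∘ value-ren ρ θ) , e
▷-ren⁻¹ ρ θ ⟨ M ⟩inl (ς-inl ¬V , e) refl = _ , ς-inl (¬V ∘ value-ren ρ θ) , e
▷-ren⁻¹ ρ θ ⟨ M ⟩inr (ς-inr ¬V , e) refl = _ , ς-inr (¬V ∘ value-ren ρ θ) , e
▷-ren⁻¹ ρ θ (inμ C p M) (ς-in ¬V , e) refl = _ , ς-in (¬V ∘ value-ren ρ θ) , e
▷-ren⁻¹ ρ θ (coitr A M N) (ς-coitr ¬V , e) refl = _ , ς-coitr (¬V ∘ value-ren ρ θ) , e

-- Parallel reduction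

-- In `root` the immediate subexpressions step first and the result is contracted afterwards, so a
-- redex created by the inner steps may fire too, as in a superdevelopment. Commutation then amounts
-- to moving a contraction past one layer of steps.
data Par {k} (κ : Kind) : ∀ {s n m} → Rel (Expr k s n m) 0ℓ where
  inner : ∀ {s n m} {D E : Expr k s n m} → Layer (Par κ) D E → Par κ D E
  root  : ∀ {s n m} {D D′ E : Expr k s n m} → Layer (Par κ) D D′ → D′ ▷[ κ ] E → Par κ D E

par-refl : ∀ {k s n m κ} (E : Expr k s n m) → Par κ E E
par-refl (var x)       = inner var
par-refl ⟨ M , N ⟩     = inner ⟨ par-refl M , par-refl N ⟩
par-refl ⟨ M ⟩inl      = inner ⟨ par-refl M ⟩inl
par-refl ⟨ M ⟩inr      = inner ⟨ par-refl M ⟩inr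
par-refl [ K ]not      = inner [ par-refl K ]not
par-refl ⟪ S ⟫·α       = inner ⟪ par-refl S ⟫·α
par-refl (inμ A p M)   = inner (inμ (par-refl M))
par-refl (coitr A M N) = inner (coitr (par-refl M) (par-refl N))
par-refl (covar α)     = inner covar
par-refl [ K , L ]     = inner [ par-refl K , par-refl L ]
par-refl fst[ K ]      = inner fst[ par-refl K ]
par-refl snd[ K ]      = inner snd[ par-refl K ]
par-refl not⟨ M ⟩      = inner not⟨ par-refl M ⟩
par-refl x·⟪ S ⟫       = inner x·⟪ par-refl S ⟫
par-refl (outν A p K)  = inner (outν (par-refl K))
par-refl (itr A K L)   = inner (itr (par-refl K) (par-refl L))
par-refl (M • K)       = inner (par-refl M • par-refl K)

par-ren : ∀ {k s n m n′ m′ κ} (ρ : Fin n → Fin n′) (θ : Fin m → Fin m′) {D E : Expr k s n m} →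
          Par κ D E → Par κ (ren ρ θ D) (ren ρ θ E)
layer-ren : ∀ {k s n m n′ m′ κ} (ρ : Fin n → Fin n′) (θ : Fin m → Fin m′) {D E : Expr k s n m} →
            Layer (Par κ) D E → Layer (Par κ) (ren ρ θ D) (ren ρ θ E)

par-ren ρ θ (inner ℓ)  = inner (layer-ren ρ θ ℓ)
par-ren ρ θ (root ℓ r) = root (layer-ren ρ θ ℓ) (ren-▷ ρ θ r)

layer-ren ρ θ var         = var
layer-ren ρ θ ⟨ q , r ⟩   = ⟨ par-ren ρ θ q , par-ren ρ θ r ⟩
layer-ren ρ θ ⟨ q ⟩inl    = ⟨ par-ren ρ θ q ⟩inl
layer-ren ρ θ ⟨ q ⟩inr    = ⟨ par-ren ρ θ q ⟩inr
layer-ren ρ θ [ q ]not    = [ par-ren ρ θ q ]not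
layer-ren ρ θ ⟪ q ⟫·α     = ⟪ par-ren ρ (lift 1 θ) q ⟫·α
layer-ren ρ θ (inμ q)     = inμ (par-ren ρ θ q)
layer-ren ρ θ (coitr q r) = coitr (par-ren (lift 1 ρ) θ q) (par-ren ρ θ r)
layer-ren ρ θ covar       = covar
layer-ren ρ θ [ q , r ]   = [ par-ren ρ θ q , par-ren ρ θ r ]
layer-ren ρ θ fst[ q ]    = fst[ par-ren ρ θ q ]
layer-ren ρ θ snd[ q ]    = snd[ par-ren ρ θ q ]
layer-ren ρ θ not⟨ q ⟩    = not⟨ par-ren ρ θ q ⟩
layer-ren ρ θ x·⟪ q ⟫     = x·⟪ par-ren (lift 1 ρ) θ q ⟫
layer-ren ρ θ (outν q)    = outν (par-ren ρ θ q)
layer-ren ρ θ (itr q r)   = itr (par-ren ρ (lift 1 θ) q) (par-ren ρ θ r)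
layer-ren ρ θ (q • r)     = par-ren ρ θ q • par-ren ρ θ r

value-⋫ : ∀ {k n m κ} {V E : Term k n m} → Value V → ¬ V ▷[ κ ] E
value-⋫ ⟨ V , W ⟩     (ς-⟨,⟩ˡ ¬V , _)   = ¬V V
value-⋫ ⟨ V , W ⟩     (ς-⟨,⟩ʳ _ ¬W , _) = ¬W W
value-⋫ ⟨ V ⟩inl      (ς-inl ¬V , _)    = ¬V V
value-⋫ ⟨ V ⟩inr      (ς-inr ¬V , _)    = ¬V V
value-⋫ (inμ _ _ V)   (ς-in ¬V , _)     = ¬V V
value-⋫ (coitr _ _ V) (ς-coitr ¬V , _)  = ¬V V

value-par : ∀ {k n m κ} {V V′ : Term k n m} → Value V → Par κ V V′ → Value V′
value-layer : ∀ {k n m κ} {V V′ : Term k n m} → Value V → Layer (Par κ) V V′ → Value V′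

value-par v (inner ℓ)  = value-layer v ℓ
value-par v (root ℓ r) = contradiction r (value-⋫ (value-layer v ℓ))

value-layer var           var         = var
value-layer ⟨ v , w ⟩     ⟨ q , r ⟩   = ⟨ value-par v q , value-par w r ⟩
value-layer ⟨ v ⟩inl      ⟨ q ⟩inl    = ⟨ value-par v q ⟩inl
value-layer ⟨ v ⟩inr      ⟨ q ⟩inr    = ⟨ value-par v q ⟩inr
value-layer [ _ ]not      [ q ]not    = [ _ ]not
value-layer (inμ A p v)   (inμ q)     = inμ A p (value-par v q)
value-layer (coitr A M v) (coitr q r) = coitr A _ (value-par v r)

-- β contracts statements only, and every ς-contractum has the form `⟪ S ⟫·α`, which is not a value.
-- At the root of a term, only η can create a value.
value-par⁻¹ : ∀ {k n m κ} {M M′ : Term k n m} → κ ≢ η → Par κ M M′ → Value M′ → Value M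
value-layer⁻¹ : ∀ {k n m κ} {M M′ : Term k n m} → κ ≢ η → Layer (Par κ) M M′ → Value M′ → Value M

value-par⁻¹ κ≢η (inner ℓ)            v = value-layer⁻¹ κ≢η ℓ v
value-par⁻¹ κ≢η (root ℓ (η-α , refl)) v = contradiction refl κ≢η

value-layer⁻¹ κ≢η var         var           = var
value-layer⁻¹ κ≢η ⟨ q , r ⟩   ⟨ v , w ⟩     = ⟨ value-par⁻¹ κ≢η q v , value-par⁻¹ κ≢η r w ⟩
value-layer⁻¹ κ≢η ⟨ q ⟩inl    ⟨ v ⟩inl      = ⟨ value-par⁻¹ κ≢η q v ⟩inl
value-layer⁻¹ κ≢η ⟨ q ⟩inr    ⟨ v ⟩inr      = ⟨ value-par⁻¹ κ≢η q v ⟩inr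
value-layer⁻¹ κ≢η [ q ]not    [ _ ]not      = [ _ ]not
value-layer⁻¹ κ≢η (inμ q)     (inμ A p v)   = inμ A p (value-par⁻¹ κ≢η q v)
value-layer⁻¹ κ≢η (coitr q r) (coitr A M v) = coitr A _ (value-par⁻¹ κ≢η r v)

par-⇑ˣ : ∀ {k n n′ m′ κ} {σ σ′ : Fin n → Term k n′ m′} →
         (∀ x → Par κ (σ x) (σ′ x)) → ∀ x → Par κ ((σ ⇑ˣ) x) ((σ′ ⇑ˣ) x)
par-⇑ˣ p zero    = inner var
par-⇑ˣ p (suc x) = par-ren suc id (p x)

par-⇑ᵅ : ∀ {k m n′ m′ κ} {τ τ′ : Fin m → Coterm k n′ m′} →
         (∀ x → Par κ (τ x) (τ′ x)) → ∀ x → Par κ ((τ ⇑ᵅ) x) ((τ′ ⇑ᵅ) x)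
par-⇑ᵅ p zero    = inner covar
par-⇑ᵅ p (suc x) = par-ren id suc (p x)

value-⇑ˣ : ∀ {k n n′ m′} {σ : Fin n → Term k n′ m′} →
           (∀ x → Value (σ x)) → ∀ x → Value ((σ ⇑ˣ) x)
value-⇑ˣ v zero    = var
value-⇑ˣ v (suc x) = value-ren suc id (v x)

value-⇑ᵅ : ∀ {k n n′ m′} {σ : Fin n → Term k n′ m′} →
           (∀ x → Value (σ x)) → ∀ x → Value (wkᵅ (σ x))
value-⇑ᵅ v x = value-ren id suc (v x)

root-or-inner : ∀ {k s n m n′ m′ κ} {σ′ : Fin n → Term k n′ m′} {τ′ : Fin m → Coterm k n′ m′}
               {D} {E : Expr k s n m} →
               (∀ x → Value (σ′ x)) → Layer (Par κ) D (sub σ′ τ′ E) →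
               Par κ D (sub σ′ τ′ E) × (∀ {F} → E ▷[ κ ] F → Par κ D (sub σ′ τ′ F))
root-or-inner v ℓ = inner ℓ , λ r → root ℓ (sub-▷ _ _ v r)

par-sub : ∀ {k s n m n′ m′ κ} {σ σ′ : Fin n → Term k n′ m′} {τ τ′ : Fin m → Coterm k n′ m′} →
          (∀ x → Value (σ′ x)) → (∀ x → Par κ (σ x) (σ′ x)) → (∀ x → Par κ (τ x) (τ′ x)) →
          {D E : Expr k s n m} → Par κ D E → Par κ (sub σ τ D) (sub σ′ τ′ E)
par-subˣ : ∀ {k s n m n′ m′ κ} {σ σ′ : Fin n → Term k n′ m′} {τ τ′ : Fin m → Coterm k n′ m′} →
           (∀ x → Value (σ′ x)) → (∀ x → Par κ (σ x) (σ′ x)) → (∀ x → Par κ (τ x) (τ′ x)) →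
           {D E : Expr k s (suc n) m} → Par κ D E →
           Par κ (sub (σ ⇑ˣ) (wkˣ ∘ τ) D) (sub (σ′ ⇑ˣ) (wkˣ ∘ τ′) E)
par-subᵅ : ∀ {k s n m n′ m′ κ} {σ σ′ : Fin n → Term k n′ m′} {τ τ′ : Fin m → Coterm k n′ m′} →
           (∀ x → Value (σ′ x)) → (∀ x → Par κ (σ x) (σ′ x)) → (∀ x → Par κ (τ x) (τ′ x)) →
           {D E : Expr k s n (suc m)} → Par κ D E →
           Par κ (sub (wkᵅ ∘ σ) (τ ⇑ᵅ) D) (sub (wkᵅ ∘ σ′) (τ′ ⇑ᵅ) E)
-- At a variable the substituted expressions need not be related by a layer, so layers are not
-- simply mapped to layers; but a variable is no redex either. The outcomes without and with a final
-- contraction are therefore delivered together. At all other heads the contraction follows the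
-- layer, and it survives `σ′` because the entries of `σ′` are values.
par-subˡ : ∀ {k s n m n′ m′ κ} {σ σ′ : Fin n → Term k n′ m′} {τ τ′ : Fin m → Coterm k n′ m′} →
           (∀ x → Value (σ′ x)) → (∀ x → Par κ (σ x) (σ′ x)) → (∀ x → Par κ (τ x) (τ′ x)) →
           {D E : Expr k s n m} → Layer (Par κ) D E →
           Par κ (sub σ τ D) (sub σ′ τ′ E) ×
           (∀ {F} → E ▷[ κ ] F → Par κ (sub σ τ D) (sub σ′ τ′ F))

par-subˣ v p q = par-sub (value-⇑ˣ v) (par-⇑ˣ p) (λ x → par-ren suc id (q x))
par-subᵅ v p q = par-sub (value-⇑ᵅ v) (λ x → par-ren id suc (p x)) (par-⇑ᵅ q)
par-sub v p q (inner ℓ)  = proj₁ (par-subˡ v p q ℓ)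
par-sub v p q (root ℓ r) = proj₂ (par-subˡ v p q ℓ) r
par-subˡ v p q var         = p _ , λ r → contradiction r (value-⋫ var)
par-subˡ v p q covar       = q _ , λ { (() , _) }
par-subˡ v p q ⟨ r , s ⟩   = root-or-inner v ⟨ par-sub v p q r , par-sub v p q s ⟩
par-subˡ v p q ⟨ r ⟩inl    = root-or-inner v ⟨ par-sub v p q r ⟩inl
par-subˡ v p q ⟨ r ⟩inr    = root-or-inner v ⟨ par-sub v p q r ⟩inr
par-subˡ v p q [ r ]not    = root-or-inner v [ par-sub v p q r ]not
par-subˡ v p q ⟪ r ⟫·α     = root-or-inner v ⟪ par-subᵅ v p q r ⟫·α
par-subˡ v p q (inμ r)     = root-or-inner v (inμ (par-sub v p q r))
par-subˡ v p q (coitr r s) = root-or-inner v (coitr (par-subˣ v p q r) (par-sub v p q s))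
par-subˡ v p q [ r , s ]   = root-or-inner v [ par-sub v p q r , par-sub v p q s ]
par-subˡ v p q fst[ r ]    = root-or-inner v fst[ par-sub v p q r ]
par-subˡ v p q snd[ r ]    = root-or-inner v snd[ par-sub v p q r ]
par-subˡ v p q not⟨ r ⟩    = root-or-inner v not⟨ par-sub v p q r ⟩
par-subˡ v p q x·⟪ r ⟫     = root-or-inner v x·⟪ par-subˣ v p q r ⟫
par-subˡ v p q (outν r)    = root-or-inner v (outν (par-sub v p q r))
par-subˡ v p q (itr r s)   = root-or-inner v (itr (par-subᵅ v p q r) (par-sub v p q s))
par-subˡ v p q (r • s)     = root-or-inner v (par-sub v p q r • par-sub v p q s)

-- Steps create no free names. The η-redexes depend on this: after a step inside one, the term or
-- coterm in it must still be a weakening.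
par-ren⁻¹ : ∀ {k s n m n′ m′ κ} (ρ : Fin n → Fin n′) (θ : Fin m → Fin m′) (D : Expr k s n m) {E} →
            Par κ (ren ρ θ D) E → ∃[ E′ ] E ≡ ren ρ θ E′ × Par κ D E′
layer-ren⁻¹ : ∀ {k s n m n′ m′ κ} (ρ : Fin n → Fin n′) (θ : Fin m → Fin m′) (D : Expr k s n m) {E} →
              Layer (Par κ) (ren ρ θ D) E → ∃[ E′ ] E ≡ ren ρ θ E′ × Layer (Par κ) D E′

par-ren⁻¹ ρ θ D (inner ℓ) with layer-ren⁻¹ ρ θ D ℓ
... | E′ , e , ℓ′ = E′ , e , inner ℓ′
par-ren⁻¹ ρ θ D (root ℓ r) with layer-ren⁻¹ ρ θ D ℓ
... | D′ , refl , ℓ′ with ▷-ren⁻¹ ρ θ D′ r refl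
... | E′ , r′ = E′ , ▷ᵛ-deterministic (proj₁ r) (proj₁ (ren-▷ ρ θ r′)) refl , root ℓ′ r′

layer-ren⁻¹ ρ θ (var x) var = _ , refl , var
layer-ren⁻¹ ρ θ ⟨ M , N ⟩ ⟨ q , r ⟩ with par-ren⁻¹ ρ θ M q | par-ren⁻¹ ρ θ N r
... | _ , refl , q′ | _ , refl , r′ = _ , refl , ⟨ q′ , r′ ⟩
layer-ren⁻¹ ρ θ ⟨ M ⟩inl ⟨ q ⟩inl with par-ren⁻¹ ρ θ M q
... | _ , refl , q′ = _ , refl , ⟨ q′ ⟩inl
layer-ren⁻¹ ρ θ ⟨ M ⟩inr ⟨ q ⟩inr with par-ren⁻¹ ρ θ M q
... | _ , refl , q′ = _ , refl , ⟨ q′ ⟩inr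
layer-ren⁻¹ ρ θ [ K ]not [ q ]not with par-ren⁻¹ ρ θ K q
... | _ , refl , q′ = _ , refl , [ q′ ]not
layer-ren⁻¹ ρ θ ⟪ S ⟫·α ⟪ q ⟫·α with par-ren⁻¹ ρ (lift 1 θ) S q
... | _ , refl , q′ = _ , refl , ⟪ q′ ⟫·α
layer-ren⁻¹ ρ θ (inμ A p M) (inμ q) with par-ren⁻¹ ρ θ M q
... | _ , refl , q′ = _ , refl , (inμ q′)
layer-ren⁻¹ ρ θ (coitr A M N) (coitr q r) with par-ren⁻¹ (lift 1 ρ) θ M q | par-ren⁻¹ ρ θ N r
... | _ , refl , q′ | _ , refl , r′ = _ , refl , (coitr q′ r′)
layer-ren⁻¹ ρ θ (covar α) covar = _ , refl , covar
layer-ren⁻¹ ρ θ [ K , L ] [ q , r ] with par-ren⁻¹ ρ θ K q | par-ren⁻¹ ρ θ L r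
... | _ , refl , q′ | _ , refl , r′ = _ , refl , [ q′ , r′ ]
layer-ren⁻¹ ρ θ fst[ K ] fst[ q ] with par-ren⁻¹ ρ θ K q
... | _ , refl , q′ = _ , refl , fst[ q′ ]
layer-ren⁻¹ ρ θ snd[ K ] snd[ q ] with par-ren⁻¹ ρ θ K q
... | _ , refl , q′ = _ , refl , snd[ q′ ]
layer-ren⁻¹ ρ θ not⟨ M ⟩ not⟨ q ⟩ with par-ren⁻¹ ρ θ M q
... | _ , refl , q′ = _ , refl , not⟨ q′ ⟩
layer-ren⁻¹ ρ θ x·⟪ S ⟫ x·⟪ q ⟫ with par-ren⁻¹ (lift 1 ρ) θ S q
... | _ , refl , q′ = _ , refl , x·⟪ q′ ⟫
layer-ren⁻¹ ρ θ (outν A p K) (outν q) with par-ren⁻¹ ρ θ K q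
... | _ , refl , q′ = _ , refl , (outν q′)
layer-ren⁻¹ ρ θ (itr A K L) (itr q r) with par-ren⁻¹ ρ (lift 1 θ) K q | par-ren⁻¹ ρ θ L r
... | _ , refl , q′ | _ , refl , r′ = _ , refl , (itr q′ r′)
layer-ren⁻¹ ρ θ (M • K) (q • r) with par-ren⁻¹ ρ θ M q | par-ren⁻¹ ρ θ K r
... | _ , refl , q′ | _ , refl , r′ = _ , refl , (q′ • r′)

-- Contractions against one layer of parallel steps

value-inner : ∀ {k n m κ} {V V′ : Term k n m} → Value V → Par κ V V′ → Layer (Par κ) V V′
value-inner v (inner ℓ)  = ℓ
value-inner v (root ℓ r) = contradiction r (value-⋫ (value-layer v ℓ))

par-/α : ∀ {k s n m κ} {E E′ : Expr k s n (suc m)} {K K′ : Coterm k n m} →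
         Par κ E E′ → Par κ K K′ → Par κ (E [ K /α]) (E′ [ K′ /α])
par-/α p q = par-sub (λ _ → var) (λ _ → inner var) (λ { zero → q ; (suc x) → inner covar }) p

par-/x : ∀ {k s n m κ} {E E′ : Expr k s (suc n) m} {V V′ : Term k n m} → Value V →
         Par κ E E′ → Par κ V V′ → Par κ (E [ V /x]) (E′ [ V′ /x])
par-/x v p q = par-sub (λ { zero → value-par v q ; (suc x) → var })
                       (λ { zero → q ; (suc x) → inner var }) (λ _ → inner covar) p

-- The second alternative arises when the inner step contracts an overlapping
-- redex with the same effect.

β-local : ∀ {k s n m κ} {D D′ E : Expr k s n m} → D ▷[ β ] E → Layer (Par κ) D D′ →
          ∃[ E′ ] Par κ E E′ × (D′ ▷[ β ] E′ ⊎ κ ≡ η × D′ ≡ E′)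
β-local (β-fst v w , _) (p • inner fst[ q ]) with value-inner ⟨ v , w ⟩ p
... | ⟨ p₁ , p₂ ⟩ = _ , inner (p₁ • q) , inj₁ (β-fst (value-par v p₁) (value-par w p₂) , refl)
β-local (β-fst _ _ , _) (_ • root fst[ _ ] (() , _))
β-local (β-snd v w , _) (p • inner snd[ q ]) with value-inner ⟨ v , w ⟩ p
... | ⟨ p₁ , p₂ ⟩ = _ , inner (p₂ • q) , inj₁ (β-snd (value-par v p₁) (value-par w p₂) , refl)
β-local (β-snd _ _ , _) (_ • root snd[ _ ] (() , _))
β-local (β-inl v , _) (p • inner [ q₁ , q₂ ]) with value-inner ⟨ v ⟩inl p
... | ⟨ p′ ⟩inl = _ , inner (p′ • q₁) , inj₁ (β-inl (value-par v p′) , refl)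
β-local (β-inl _ , _) (_ • root [ _ , _ ] (() , _))
β-local (β-inr v , _) (p • inner [ q₁ , q₂ ]) with value-inner ⟨ v ⟩inr p
... | ⟨ p′ ⟩inr = _ , inner (p′ • q₂) , inj₁ (β-inr (value-par v p′) , refl)
β-local (β-inr _ , _) (_ • root [ _ , _ ] (() , _))
β-local (β-not , _) (p • inner not⟨ q ⟩) with value-inner [ _ ]not p
... | [ p′ ]not = _ , inner (q • p′) , inj₁ (β-not , refl)
β-local (β-not , _) (_ • root not⟨ _ ⟩ (() , _))
β-local (β-α , _) (inner ⟪ p ⟫·α • q) = _ , par-/α p q , inj₁ (β-α , refl)
β-local {κ = κ} (β-α {S} {K} , _) (_•_ {K′ = K′} (root ⟪ p ⟫·α (η-α {M} , e)) q) =
  _ , subst (λ M → Par κ (S [ K /α]) (M • K′)) (wkᵅ-/α K′ M) (par-/α p q) , inj₂ (sym e , refl)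
β-local (β-x v , _) (p • inner x·⟪ q ⟫) = _ , par-/x v q p , inj₁ (β-x (value-par v p) , refl)
β-local {κ = κ} (β-x {V} {S} v , _) (_•_ {M′ = V′} p (root x·⟪ q ⟫ (η-x {K} , e))) =
  _ , subst (λ K → Par κ (S [ V /x]) (V′ • K)) (wkˣ-/x V′ K) (par-/x v q p) , inj₂ (sym e , refl)
-- The contractum contains `K` both inside `itr` and as the coterm lifted by `comono`. Congruence of
-- the contractum performs the steps of `K` in every copy.
β-local (β-μ {C} {c} {A = A} v , _) (p • inner (itr q₁ q₂)) with value-inner (inμ _ _ v) p
... | inμ p′ = _ , ComonoCong.μ-contractum-cong (Par _) inner par-ren C {c} A p′ q₁ q₂
                 , inj₁ (β-μ (value-par v p′) , refl)
β-local (β-μ _ , _) (_ • root (itr _ _) (() , _))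
β-local (β-ν {C} {c} {A = A} v , _) (p • inner (outν q)) with value-inner (coitr _ _ v) p
... | coitr p₁ p₂ = _ , MonoCong.ν-contractum-cong (Par _) inner par-ren C {c} A p₁ p₂ q
                      , inj₁ (β-ν (value-par v p₂) , refl)
β-local (β-ν _ , _) (_ • root (outν _) (() , _))

-- The layer can interfere only by contracting the body of the η-redex itself. With a covariable on
-- the right this must be `β-α`, so `M` is some `⟪ S ⟫·α`, and the contraction merely renames the
-- bound covariable and gives `M` back. The case of `η-x` is symmetric, with `β-x`.
η-local : ∀ {k s n m κ} {D D′ E : Expr k s n m} → D ▷[ η ] E → Layer (Par κ) D D′ →
          ∃[ E′ ] Par κ E E′ × (D′ ▷[ η ] E′ ⊎ κ ≡ β × D′ ≡ E′)
η-local (η-α {M} , _) ⟪ inner (p • inner covar) ⟫·α with par-ren⁻¹ id suc M p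
... | M′ , refl , p′ = M′ , p′ , inj₁ (η-α , refl)
η-local (η-α {M} , _) ⟪ root (p • inner covar) r ⟫·α with par-ren⁻¹ id suc M p
... | M′ , refl , p′ = M′ , p′ , inj₂ (contracts M′ r)
  where
  contracts : ∀ {k n m κ} (M : Term k n m) {S} → wkᵅ M • covar zero ▷[ κ ] S →
              κ ≡ β × ⟪ S ⟫·α ≡ M
  contracts ⟪ S ⟫·α (β-α , e) = sym e , cong ⟪_⟫·α
    (trans (sub-ren (λ _ → refl) (λ _ → refl) S)
           (sub-id (λ _ → refl) (λ { zero → refl ; (suc x) → refl }) S))
η-local (η-α , _) ⟪ inner (_ • root covar (() , _)) ⟫·α
η-local (η-α , _) ⟪ root (_ • root covar (() , _)) _ ⟫·α
η-local (η-x {K} , _) x·⟪ inner (q • p) ⟫ with value-inner var q | par-ren⁻¹ suc id K p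
... | var | K′ , refl , p′ = K′ , p′ , inj₁ (η-x , refl)
η-local (η-x {K} , _) x·⟪ root (q • p) r ⟫ with value-inner var q | par-ren⁻¹ suc id K p
... | var | K′ , refl , p′ = K′ , p′ , inj₂ (contracts K′ r)
  where
  contracts : ∀ {k n m κ} (K : Coterm k n m) {S} → var zero • wkˣ K ▷[ κ ] S →
              κ ≡ β × x·⟪ S ⟫ ≡ K
  contracts x·⟪ S ⟫ (β-x v , e) = sym e , cong x·⟪_⟫
    (trans (sub-ren (λ _ → refl) (λ _ → refl) S)
           (sub-id (λ { zero → refl ; (suc x) → refl }) (λ _ → refl) S))

ς-cong : ∀ {k} (Q : ∀ {s n m} → Rel (Expr k s n m) 0ℓ) →
         (∀ {s n m} {D E : Expr k s n m} → Layer Q D E → Q D E) →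
         (∀ {s n m n′ m′} (ρ : Fin n → Fin n′) (θ : Fin m → Fin m′) {D E : Expr k s n m} →
          Q D E → Q (ren ρ θ D) (ren ρ θ E)) →
         ∀ {n m} {M M′ : Term k n m} {F F′} → Q M M′ → Layer Q F F′ →
         Q ⟪ wkᵅ M • x·⟪ F • covar zero ⟫ ⟫·α ⟪ wkᵅ M′ • x·⟪ F′ • covar zero ⟫ ⟫·α
ς-cong Q close rename p ℓ =
  close ⟪ close (rename id suc p • close x·⟪ close (close ℓ • close covar) ⟫) ⟫·α

ς-local : ∀ {k s n m κ} {D D′ E : Expr k s n m} → κ ≢ η → D ▷[ ς ] E → Layer (Par κ) D D′ →
          ∃[ E′ ] Par κ E E′ × D′ ▷[ ς ] E′
ς-local κ≢η (ς-⟨,⟩ˡ ¬v , _) ⟨ p , q ⟩ =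
  _ , ς-cong (Par _) inner par-ren p ⟨ inner var , par-ren suc id (par-ren id suc q) ⟩
    , ς-⟨,⟩ˡ (¬v ∘ value-par⁻¹ κ≢η p) , refl
ς-local κ≢η (ς-⟨,⟩ʳ v ¬v , _) ⟨ p , q ⟩ =
  _ , ς-cong (Par _) inner par-ren q ⟨ par-ren suc id (par-ren id suc p) , inner var ⟩
    , ς-⟨,⟩ʳ (value-par v p) (¬v ∘ value-par⁻¹ κ≢η q) , refl
ς-local κ≢η (ς-inl ¬v , _) ⟨ p ⟩inl =
  _ , ς-cong (Par _) inner par-ren p ⟨ inner var ⟩inl , ς-inl (¬v ∘ value-par⁻¹ κ≢η p) , refl
ς-local κ≢η (ς-inr ¬v , _) ⟨ p ⟩inr =
  _ , ς-cong (Par _) inner par-ren p ⟨ inner var ⟩inr , ς-inr (¬v ∘ value-par⁻¹ κ≢η p) , refl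
ς-local κ≢η (ς-in ¬v , _) (inμ p) =
  _ , ς-cong (Par _) inner par-ren p (inμ (inner var)) , ς-in (¬v ∘ value-par⁻¹ κ≢η p) , refl
ς-local κ≢η (ς-coitr ¬v , _) (coitr p q) =
  _ , ς-cong (Par _) inner par-ren q (coitr (par-ren (lift 1 suc) suc p) (inner var))
    , ς-coitr (¬v ∘ value-par⁻¹ κ≢η q) , refl

-- Commutation of parallel reductions

-- Layers are commuted before roots are contracted, so the hypotheses only concern a contraction
-- against a layer. An equation `D′ ≡ E′` there means that the contractum joins the result of the
-- layer directly, with no contraction left to perform. `Q` stands for the closing `B`-steps: it is
-- `Par B`, except for ς against η, where β-steps and η-steps are both required.
module Commutation {k} (A B : Kind) (Q : ∀ {s n m} → Rel (Expr k s n m) 0ℓ)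
  (close : ∀ {s n m} {D E : Expr k s n m} → Layer Q D E → Q D E)
  (close-▷ : ∀ {s n m} {D D′ E : Expr k s n m} → Layer Q D D′ → D′ ▷[ B ] E → Q D E)
  (localᴬ : ∀ {s n m} {D D′ E : Expr k s n m} → D ▷[ A ] E → Layer Q D D′ →
            ∃[ E′ ] Q E E′ × (D′ ▷[ A ] E′ ⊎ D′ ≡ E′))
  (localᴮ : ∀ {s n m} {D D′ E : Expr k s n m} → D ▷[ B ] E → Layer (Par A) D D′ →
            ∃[ E′ ] Par A E E′ × (D′ ▷[ B ] E′ ⊎ D′ ≡ E′))
  (localᴬᴮ : ∀ {s n m} {D₁ D₂ D₃ E₁ E₂ : Expr k s n m} → D₁ ▷[ A ] E₁ → D₂ ▷[ B ] E₂ →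
             Layer Q D₁ D₃ → Layer (Par A) D₂ D₃ → ∃[ E₃ ] Q E₁ E₃ × Par A E₂ E₃)
  where

  commute : ∀ {s n m} {D E₁ E₂ : Expr k s n m} → Par A D E₁ → Par B D E₂ →
            ∃[ E₃ ] Q E₁ E₃ × Par A E₂ E₃
  commute-layer : ∀ {s n m} {D E₁ E₂ : Expr k s n m} → Layer (Par A) D E₁ → Layer (Par B) D E₂ →
                  ∃[ E₃ ] Layer Q E₁ E₃ × Layer (Par A) E₂ E₃

  commute (inner ℓ) (inner ℓ′) with commute-layer ℓ ℓ′
  ... | _ , q , p = _ , close q , inner p
  commute (root ℓ r) (inner ℓ′) with commute-layer ℓ ℓ′
  ... | _ , q , p with localᴬ r q
  ... | _ , q′ , inj₁ r′   = _ , q′ , root p r′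
  ... | _ , q′ , inj₂ refl = _ , q′ , inner p
  commute (inner ℓ) (root ℓ′ r) with commute-layer ℓ ℓ′
  ... | _ , q , p with localᴮ r p
  ... | _ , p′ , inj₁ r′   = _ , close-▷ q r′ , p′
  ... | _ , p′ , inj₂ refl = _ , close q , p′
  commute (root ℓ r) (root ℓ′ r′) with commute-layer ℓ ℓ′
  ... | _ , q , p = localᴬᴮ r r′ q p

  commute-layer var var = _ , var , var
  commute-layer ⟨ p₁ , p₂ ⟩ ⟨ q₁ , q₂ ⟩ with commute p₁ q₁ | commute p₂ q₂
  ... | _ , q₁′ , p₁′ | _ , q₂′ , p₂′ = _ , ⟨ q₁′ , q₂′ ⟩ , ⟨ p₁′ , p₂′ ⟩
  commute-layer ⟨ p ⟩inl ⟨ q ⟩inl with commute p q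
  ... | _ , q′ , p′ = _ , ⟨ q′ ⟩inl , ⟨ p′ ⟩inl
  commute-layer ⟨ p ⟩inr ⟨ q ⟩inr with commute p q
  ... | _ , q′ , p′ = _ , ⟨ q′ ⟩inr , ⟨ p′ ⟩inr
  commute-layer [ p ]not [ q ]not with commute p q
  ... | _ , q′ , p′ = _ , [ q′ ]not , [ p′ ]not
  commute-layer ⟪ p ⟫·α ⟪ q ⟫·α with commute p q
  ... | _ , q′ , p′ = _ , ⟪ q′ ⟫·α , ⟪ p′ ⟫·α
  commute-layer (inμ p) (inμ q) with commute p q
  ... | _ , q′ , p′ = _ , inμ q′ , inμ p′
  commute-layer (coitr p₁ p₂) (coitr q₁ q₂) with commute p₁ q₁ | commute p₂ q₂
  ... | _ , q₁′ , p₁′ | _ , q₂′ , p₂′ = _ , coitr q₁′ q₂′ , coitr p₁′ p₂′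
  commute-layer covar covar = _ , covar , covar
  commute-layer [ p₁ , p₂ ] [ q₁ , q₂ ] with commute p₁ q₁ | commute p₂ q₂
  ... | _ , q₁′ , p₁′ | _ , q₂′ , p₂′ = _ , [ q₁′ , q₂′ ] , [ p₁′ , p₂′ ]
  commute-layer fst[ p ] fst[ q ] with commute p q
  ... | _ , q′ , p′ = _ , fst[ q′ ] , fst[ p′ ]
  commute-layer snd[ p ] snd[ q ] with commute p q
  ... | _ , q′ , p′ = _ , snd[ q′ ] , snd[ p′ ]
  commute-layer not⟨ p ⟩ not⟨ q ⟩ with commute p q
  ... | _ , q′ , p′ = _ , not⟨ q′ ⟩ , not⟨ p′ ⟩
  commute-layer x·⟪ p ⟫ x·⟪ q ⟫ with commute p q
  ... | _ , q′ , p′ = _ , x·⟪ q′ ⟫ , x·⟪ p′ ⟫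
  commute-layer (outν p) (outν q) with commute p q
  ... | _ , q′ , p′ = _ , outν q′ , outν p′
  commute-layer (itr p₁ p₂) (itr q₁ q₂) with commute p₁ q₁ | commute p₂ q₂
  ... | _ , q₁′ , p₁′ | _ , q₂′ , p₂′ = _ , itr q₁′ q₂′ , itr p₁′ p₂′
  commute-layer (p₁ • p₂) (q₁ • q₂) with commute p₁ q₁ | commute p₂ q₂
  ... | _ , q₁′ , p₁′ | _ , q₂′ , p₂′ = _ , (q₁′ • q₂′) , (p₁′ • p₂′)

β-on-statements : ∀ {k s n m} {D E : Expr k s n m} → D ▷[ β ] E → s ≡ statement
β-on-statements (β-fst _ _ , _) = refl
β-on-statements (β-snd _ _ , _) = refl
β-on-statements (β-inl _ , _) = refl
β-on-statements (β-inr _ , _) = refl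
β-on-statements (β-not , _) = refl
β-on-statements (β-α , _) = refl
β-on-statements (β-x _ , _) = refl
β-on-statements (β-μ _ , _) = refl
β-on-statements (β-ν _ , _) = refl

statement-kind : ∀ {k n m κ} {D E : Statement k n m} → D ▷[ κ ] E → κ ≡ β
statement-kind (β-fst _ _ , e) = sym e
statement-kind (β-snd _ _ , e) = sym e
statement-kind (β-inl _ , e) = sym e
statement-kind (β-inr _ , e) = sym e
statement-kind (β-not , e) = sym e
statement-kind (β-α , e) = sym e
statement-kind (β-x _ , e) = sym e
statement-kind (β-μ _ , e) = sym e
statement-kind (β-ν _ , e) = sym e

-- β acts on statements, η and ς on terms and coterms. Hence β never competes with another kind for
-- the same root.
β-disjoint : ∀ {k s n m κ} {D D′ E E′ : Expr k s n m} → D ▷[ β ] E → D′ ▷[ κ ] E′ → κ ≡ β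
β-disjoint r r′ with β-on-statements r
... | refl = statement-kind r′

weaken : ∀ {k s n m} {D′ E′ : Expr k s n m} {P : Set} {R : Set} → R ⊎ P × D′ ≡ E′ → R ⊎ D′ ≡ E′
weaken (inj₁ r)       = inj₁ r
weaken (inj₂ (_ , e)) = inj₂ e

-- When both steps end in a root contraction, each contraction is moved to the common result `D₃` of
-- the two layers, where determinism identifies the contracta.
par-diamond : ∀ {k κ} →
  (∀ {s n m} {D D′ E : Expr k s n m} → D ▷[ κ ] E → Layer (Par κ) D D′ →
   ∃[ E′ ] Par κ E E′ × D′ ▷[ κ ] E′) →
  ∀ {s n m} {D E₁ E₂ : Expr k s n m} → Par κ D E₁ → Par κ D E₂ → ∃[ E₃ ] Par κ E₁ E₃ × Par κ E₂ E₃
par-diamond {k} {κ} local = Commutation.commute κ κ (Par κ) inner root local′ local′ local″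
  where
  local′ : ∀ {s n m} {D D′ E : Expr k s n m} → D ▷[ κ ] E → Layer (Par κ) D D′ →
           ∃[ E′ ] Par κ E E′ × (D′ ▷[ κ ] E′ ⊎ D′ ≡ E′)
  local′ r ℓ with local r ℓ
  ... | _ , p , r′ = _ , p , inj₁ r′
  local″ : ∀ {s n m} {D₁ D₂ D₃ E₁ E₂ : Expr k s n m} → D₁ ▷[ κ ] E₁ → D₂ ▷[ κ ] E₂ →
           Layer (Par κ) D₁ D₃ → Layer (Par κ) D₂ D₃ → ∃[ E₃ ] Par κ E₁ E₃ × Par κ E₂ E₃
  local″ r₁ r₂ ℓ₁ ℓ₂ with local r₁ ℓ₁ | local r₂ ℓ₂
  ... | _ , p₁ , r₁′ | _ , p₂ , r₂′ with ▷ᵛ-deterministic (proj₁ r₁′) (proj₁ r₂′) refl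
  ... | refl = _ , p₁ , p₂

β-diamond : ∀ {k s n m} {D E₁ E₂ : Expr k s n m} → Par β D E₁ → Par β D E₂ →
            ∃[ E₃ ] Par β E₁ E₃ × Par β E₂ E₃
β-diamond = par-diamond λ r ℓ → case β-local r ℓ of λ { (_ , p , inj₁ r′) → _ , p , r′ }

η-diamond : ∀ {k s n m} {D E₁ E₂ : Expr k s n m} → Par η D E₁ → Par η D E₂ →
            ∃[ E₃ ] Par η E₁ E₃ × Par η E₂ E₃
η-diamond = par-diamond λ r ℓ → case η-local r ℓ of λ { (_ , p , inj₁ r′) → _ , p , r′ }

ς-diamond : ∀ {k s n m} {D E₁ E₂ : Expr k s n m} → Par ς D E₁ → Par ς D E₂ →
            ∃[ E₃ ] Par ς E₁ E₃ × Par ς E₂ E₃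
ς-diamond = par-diamond (ς-local λ ())

β-η-commute : ∀ {k s n m} {D E₁ E₂ : Expr k s n m} → Par β D E₁ → Par η D E₂ →
              ∃[ E₃ ] Par η E₁ E₃ × Par β E₂ E₃
β-η-commute = Commutation.commute β η (Par η) inner root
  (λ r ℓ → map₂ (map₂ weaken) (β-local r ℓ)) (λ r ℓ → map₂ (map₂ weaken) (η-local r ℓ))
  (λ r r′ → contradiction (β-disjoint r r′) λ ())

ς-β-commute : ∀ {k s n m} {D E₁ E₂ : Expr k s n m} → Par ς D E₁ → Par β D E₂ →
              ∃[ E₃ ] Par β E₁ E₃ × Par ς E₂ E₃
ς-β-commute = Commutation.commute ς β (Par β) inner root
  (λ r ℓ → map₂ (map₂ inj₁) (ς-local (λ ()) r ℓ)) (λ r ℓ → map₂ (map₂ weaken) (β-local r ℓ))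
  (λ r r′ → contradiction (β-disjoint r′ r) λ ())

-- Commutation of ς with η inside the union of β and η

infix 4 _⇛_

_⇛_ : ∀ {k s n m} → Rel (Expr k s n m) 0ℓ
D ⇛ E = Σ[ κ ∈ Kind ] κ ≢ ς × Par κ D E

⇛-map : ∀ {k s s′ n m n′ m′} (f : Expr k s n m → Expr k s′ n′ m′) →
        (∀ {κ D E} → Par κ D E → Par κ (f D) (f E)) → ∀ {D E} → Star _⇛_ D E → Star _⇛_ (f D) (f E)
⇛-map f g = gmap f λ { (κ , κ≢ς , p) → κ , κ≢ς , g p }

⇛-ren : ∀ {k s n m n′ m′} (ρ : Fin n → Fin n′) (θ : Fin m → Fin m′) {D E : Expr k s n m} →
        Star _⇛_ D E → Star _⇛_ (ren ρ θ D) (ren ρ θ E)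
⇛-ren ρ θ = ⇛-map (ren ρ θ) (par-ren ρ θ)

⇛-close : ∀ {k s n m} {D E : Expr k s n m} → Layer (Star _⇛_) D E → Star _⇛_ D E
⇛-close var         = ε
⇛-close ⟨ p , q ⟩   = ⇛-map ⟨_, _ ⟩ (λ p → inner ⟨ p , par-refl _ ⟩) p
                   ◅◅ ⇛-map ⟨ _ ,_⟩ (λ q → inner ⟨ par-refl _ , q ⟩) q
⇛-close ⟨ p ⟩inl    = ⇛-map ⟨_⟩inl (λ p → inner ⟨ p ⟩inl) p
⇛-close ⟨ p ⟩inr    = ⇛-map ⟨_⟩inr (λ p → inner ⟨ p ⟩inr) p
⇛-close [ p ]not    = ⇛-map [_]not (λ p → inner [ p ]not) p
⇛-close ⟪ p ⟫·α     = ⇛-map ⟪_⟫·α (λ p → inner ⟪ p ⟫·α) p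
⇛-close (inμ {A = A} {c} p) = ⇛-map (inμ A c) (λ p → inner (inμ p)) p
⇛-close (coitr p q) = ⇛-map (λ M → coitr _ M _) (λ p → inner (coitr p (par-refl _))) p
                   ◅◅ ⇛-map (coitr _ _) (λ q → inner (coitr (par-refl _) q)) q
⇛-close covar       = ε
⇛-close [ p , q ]   = ⇛-map [_, _ ] (λ p → inner [ p , par-refl _ ]) p
                   ◅◅ ⇛-map [ _ ,_] (λ q → inner [ par-refl _ , q ]) q
⇛-close fst[ p ]    = ⇛-map fst[_] (λ p → inner fst[ p ]) p
⇛-close snd[ p ]    = ⇛-map snd[_] (λ p → inner snd[ p ]) p
⇛-close not⟨ p ⟩    = ⇛-map not⟨_⟩ (λ p → inner not⟨ p ⟩) p
⇛-close x·⟪ p ⟫     = ⇛-map x·⟪_⟫ (λ p → inner x·⟪ p ⟫) p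
⇛-close (outν {A = A} {c} p) = ⇛-map (outν A c) (λ p → inner (outν p)) p
⇛-close (itr p q)   = ⇛-map (λ K → itr _ K _) (λ p → inner (itr p (par-refl _))) p
                   ◅◅ ⇛-map (itr _ _) (λ q → inner (itr (par-refl _) q)) q
⇛-close (p • q)     = ⇛-map (_• _) (λ p → inner (p • par-refl _)) p
                   ◅◅ ⇛-map (_ •_) (λ q → inner (par-refl _ • q)) q

value-⇛ : ∀ {k n m} {V V′ : Term k n m} → Value V → Star _⇛_ V V′ → Value V′
value-⇛ v ε                 = v
value-⇛ v ((_ , _ , p) ◅ s) = value-⇛ (value-par v p) s

-- Joins a ς-step with the η-step that turns M into the value V.

ς-undo : ∀ {k n m} {V G : Term k n m} {F : Term k (suc n) (suc m)} → Value V →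
         F [ wkᵅ V /x] ≡ wkᵅ G → Star _⇛_ ⟪ wkᵅ V • x·⟪ F • covar zero ⟫ ⟫·α G
ς-undo {G = G} {F} v e =
  (β , (λ ()) , inner ⟪ root (layer-refl par-refl _) (β-x (value-ren id suc v) , refl) ⟫·α) ◅
  (η , (λ ()) , root (layer-refl par-refl _)
                  (subst (λ M → ⟪ M • covar zero ⟫·α ▷[ η ] G) (sym e) (η-α , refl))) ◅ ε

ς-cong-⇛ : ∀ {k n m} {M M′ : Term k n m} {F F′} → Star _⇛_ M M′ → Layer (Star _⇛_) F F′ →
           Star _⇛_ ⟪ wkᵅ M • x·⟪ F • covar zero ⟫ ⟫·α ⟪ wkᵅ M′ • x·⟪ F′ • covar zero ⟫ ⟫·α
ς-cong-⇛ = ς-cong (Star _⇛_) ⇛-close ⇛-ren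

-- The case distinction is on the reduct of the sequenced argument. As a non-value it leaves a
-- ς-redex in place; as a value it lets `ς-undo` take the contractum back to `D′` itself, whether or
-- not `D′` is a ς-redex at its other component.
ς-local-⇛ : ∀ {k s n m} {D D′ E : Expr k s n m} → D ▷[ ς ] E → Layer (Star _⇛_) D D′ →
            ∃[ E′ ] Star _⇛_ E E′ × (D′ ▷[ ς ] E′ ⊎ D′ ≡ E′)
ς-local-⇛ (ς-⟨,⟩ˡ _ , _) (⟨_,_⟩ {M′ = M′} {N′ = N′} p q)
  with value? M′ | ς-cong-⇛ p ⟨ ε , ⇛-ren suc id (⇛-ren id suc q) ⟩
... | no ¬v | c = _ , c , inj₁ (ς-⟨,⟩ˡ ¬v , refl)
... | yes v | c = _ , c ◅◅ ς-undo v (cong ⟨ wkᵅ M′ ,_⟩ (wkˣ-/x _ (wkᵅ N′))) , inj₂ refl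
ς-local-⇛ (ς-⟨,⟩ʳ w _ , _) (⟨_,_⟩ {M′ = M′} {N′ = N′} p q)
  with value? N′ | ς-cong-⇛ q ⟨ ⇛-ren suc id (⇛-ren id suc p) , ε ⟩
... | no ¬v | c = _ , c , inj₁ (ς-⟨,⟩ʳ (value-⇛ w p) ¬v , refl)
... | yes v | c = _ , c ◅◅ ς-undo v (cong ⟨_, wkᵅ N′ ⟩ (wkˣ-/x _ (wkᵅ M′))) , inj₂ refl
ς-local-⇛ (ς-inl _ , _) (⟨_⟩inl {M′ = M′} p) with value? M′ | ς-cong-⇛ p ⟨ ε ⟩inl
... | no ¬v | c = _ , c , inj₁ (ς-inl ¬v , refl)
... | yes v | c = _ , c ◅◅ ς-undo v refl , inj₂ refl
ς-local-⇛ (ς-inr _ , _) (⟨_⟩inr {M′ = M′} p) with value? M′ | ς-cong-⇛ p ⟨ ε ⟩inr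
... | no ¬v | c = _ , c , inj₁ (ς-inr ¬v , refl)
... | yes v | c = _ , c ◅◅ ς-undo v refl , inj₂ refl
ς-local-⇛ (ς-in _ , _) (inμ {A = C} {c₀} {M′ = M′} p) with value? M′ | ς-cong-⇛ p (inμ {A = C} {c₀} ε)
... | no ¬v | c = _ , c , inj₁ (ς-in ¬v , refl)
... | yes v | c = _ , c ◅◅ ς-undo v refl , inj₂ refl
ς-local-⇛ (ς-coitr _ , _) (coitr {A = A} {M′ = M′} {N′ = N′} p q)
  with value? N′ | ς-cong-⇛ q (coitr {A = A} (⇛-ren (lift 1 suc) suc p) ε)
... | no ¬v | c = _ , c , inj₁ (ς-coitr ¬v , refl)
... | yes v | c = _ , c ◅◅ ς-undo v (cong (λ M → coitr A M (wkᵅ N′))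
  (trans (sub-ren {σ′ = var} (λ { zero → refl ; (suc x) → refl }) (λ _ → refl) M′)
         (sym (ren-as-sub (λ { zero → refl ; (suc x) → refl }) (λ _ → refl) M′)))) , inj₂ refl

ς-η-commute : ∀ {k s n m} {D E₁ E₂ : Expr k s n m} → Par ς D E₁ → Par η D E₂ →
              ∃[ E₃ ] Star _⇛_ E₁ E₃ × Par ς E₂ E₃
ς-η-commute = Commutation.commute ς η (Star _⇛_) ⇛-close
  (λ ℓ r → ⇛-close ℓ ◅◅ (η , (λ ()) , root (layer-refl par-refl _) r) ◅ ε)
  ς-local-⇛ (λ r ℓ → map₂ (map₂ weaken) (η-local r ℓ))
  -- A layer keeps the head constructor. An η-redex has the head `⟪_⟫·α` or `x·⟪_⟫`, a ς-redex any
  -- of the heads listed here, so the two never meet at one root.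
  λ { (ς-⟨,⟩ˡ _ , _)   (η-α , _) ⟨ _ , _ ⟩   ()
    ; (ς-⟨,⟩ʳ _ _ , _) (η-α , _) ⟨ _ , _ ⟩   ()
    ; (ς-inl _ , _)    (η-α , _) ⟨ _ ⟩inl    ()
    ; (ς-inr _ , _)    (η-α , _) ⟨ _ ⟩inr    ()
    ; (ς-in _ , _)     (η-α , _) (inμ _)     ()
    ; (ς-coitr _ , _)  (η-α , _) (coitr _ _) () }

-- Abstract rewriting

module _ {A : Set} where

  Diamond : Rel A 0ℓ → Set
  Diamond R = ∀ {a b c} → R a b → R a c → ∃[ d ] R b d × R c d

  module _ {R S : Rel A 0ℓ} where

    -- The `S`-side closes in exactly one step, so one `S`-step can be carried along a sequence of
    -- `R`-steps by induction on that sequence, however many `R`-steps each square produces. A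
    -- square of ς against η indeed needs several, since `ς-undo` is a β-step followed by an η-step.
    commute-star : (∀ {a b c} → S a b → R a c → ∃[ d ] Star R b d × S c d) →
                   ∀ {a b c} → Star S a b → Star R a c → ∃[ d ] Star R b d × Star S c d
    commute-star h = go
      where
      strip : ∀ {a b c} → S a b → Star R a c → ∃[ d ] Star R b d × S c d
      strip s ε = _ , ε , s
      strip s (r ◅ rs) with h s r
      ... | _ , rs′ , s′ with strip s′ rs
      ... | _ , rs″ , s″ = _ , rs′ ◅◅ rs″ , s″
      go : ∀ {a b c} → Star S a b → Star R a c → ∃[ d ] Star R b d × Star S c d
      go ε rs = _ , rs , ε
      go (s ◅ ss) rs with strip s rs
      ... | _ , rs′ , s′ with go ss rs′
      ... | _ , rs″ , ss′ = _ , rs″ , s′ ◅ ss′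

  diamond⇒confluent : ∀ {R : Rel A 0ℓ} → Diamond R → Confluent R
  diamond⇒confluent ◇ = commute-star λ r s → map₂ (map₁ (_◅ ε)) (◇ r s)

  confluent-sandwich : ∀ {R S : Rel A 0ℓ} → (∀ {a b} → R a b → Star S a b) → (∀ {a b} → S a b → Star R a b) →
                       Confluent S → Confluent R
  confluent-sandwich R⊆S S⊆R conf rs rs′ 
    with conf (kleisliStar id R⊆S rs) (kleisliStar id R⊆S rs′)
  ... | _ , ss , ss′ = _ , kleisliStar id S⊆R ss , kleisliStar id S⊆R ss′

  -- `Comp`, a sequence of `R`-steps followed by one of `S`-steps, has the diamond property: the
  -- peak is filled by confluence of `R`, two commutation rectangles, and confluence of `S`. It lies
  -- between the union and its reflexive transitive closure in the sense of `confluent-sandwich`.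
  hindley-rosen : ∀ {R S : Rel A 0ℓ} → Diamond R → Diamond S →
                  (∀ {a b c} → S a b → R a c → ∃[ d ] Star R b d × S c d) →
                  Confluent (λ a b → R a b ⊎ S a b)
  hindley-rosen {R} {S} ◇ᴿ ◇ˢ h = confluent-sandwich union⊆comp comp⊆union (diamond⇒confluent ◇)
    where
    Comp : Rel A 0ℓ
    Comp a b = ∃[ c ] Star R a c × Star S c b
    ◇ : Diamond Comp
    ◇ (_ , r , s) (_ , r′ , s′) with diamond⇒confluent ◇ᴿ r r′
    ... | _ , t , t′ with commute-star h s t | commute-star h s′ t′
    ... | _ , u , v | _ , u′ , v′ with diamond⇒confluent ◇ˢ v v′
    ... | _ , w , w′ = _ , (_ , u , w) , (_ , u′ , w′)
    union⊆comp : ∀ {a b} → R a b ⊎ S a b → Star Comp a b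
    union⊆comp (inj₁ r) = (_ , r ◅ ε , ε) ◅ ε
    union⊆comp (inj₂ s) = (_ , ε , s ◅ ε) ◅ ε
    comp⊆union : ∀ {a b} → Comp a b → Star (λ a b → R a b ⊎ S a b) a b
    comp⊆union (_ , r , s) = gmap id inj₁ r ◅◅ gmap id inj₂ s

confluent-retract : ∀ {A B : Set} {R : Rel A 0ℓ} {S : Rel B 0ℓ} (f : A → B) (g : B → A) →
                    (∀ a → g (f a) ≡ a) → (∀ {a b} → R a b → S (f a) (f b)) →
                    (∀ {a b} → S a b → R (g a) (g b)) → Confluent S → Confluent R
confluent-retract {R = R} f g gf R→S S→R conf rs rs′ with conf (gmap f R→S rs) (gmap f R→S rs′)
... | d , ss , ss′ = g d , subst (λ a → Star R a (g d)) (gf _) (gmap g S→R ss)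
                         , subst (λ a → Star R a (g d)) (gf _) (gmap g S→R ss′)

-- Confluence of call by value

⇛-diamond : ∀ {k s n m} → Diamond (_⇛_ {k} {s} {n} {m})
⇛-diamond (β , _ , p) (β , _ , q) with β-diamond p q
... | _ , p′ , q′ = _ , (β , (λ ()) , p′) , (β , (λ ()) , q′)
⇛-diamond (β , _ , p) (η , _ , q) with β-η-commute p q
... | _ , p′ , q′ = _ , (η , (λ ()) , p′) , (β , (λ ()) , q′)
⇛-diamond (η , _ , p) (β , _ , q) with β-η-commute q p
... | _ , q′ , p′ = _ , (β , (λ ()) , p′) , (η , (λ ()) , q′)
⇛-diamond (η , _ , p) (η , _ , q) with η-diamond p q
... | _ , p′ , q′ = _ , (η , (λ ()) , p′) , (η , (λ ()) , q′)
⇛-diamond (ς , ς≢ς , _) _ = contradiction refl ς≢ς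
⇛-diamond _ (ς , ς≢ς , _) = contradiction refl ς≢ς

ς-⇛-commute : ∀ {k s n m} {D E₁ E₂ : Expr k s n m} → Par ς D E₁ → D ⇛ E₂ →
              ∃[ E₃ ] Star _⇛_ E₁ E₃ × Par ς E₂ E₃
ς-⇛-commute p (β , κ≢ς , q) with ς-β-commute p q
... | _ , q′ , p′ = _ , (β , κ≢ς , q′) ◅ ε , p′
ς-⇛-commute p (η , _ , q) = ς-η-commute p q
ς-⇛-commute p (ς , ς≢ς , _) = contradiction refl ς≢ς

CBV⊆par : ∀ {k s n m} {D E : Expr k s n m} → CBV D E → ∃[ κ ] Par κ D E
CBV⊆par (rule r)       = kind r , root (layer-refl par-refl _) (r , refl)
CBV⊆par (⟨ r , N ⟩ˡ)     = map₂ (λ p → inner ⟨ p , par-refl N ⟩) (CBV⊆par r)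
CBV⊆par (⟨ M , r ⟩ʳ)     = map₂ (λ p → inner ⟨ par-refl M , p ⟩) (CBV⊆par r)
CBV⊆par ⟨ r ⟩inl       = map₂ (λ p → inner ⟨ p ⟩inl) (CBV⊆par r)
CBV⊆par ⟨ r ⟩inr       = map₂ (λ p → inner ⟨ p ⟩inr) (CBV⊆par r)
CBV⊆par [ r ]not       = map₂ (λ p → inner [ p ]not) (CBV⊆par r)
CBV⊆par ⟪ r ⟫·α        = map₂ (λ p → inner ⟪ p ⟫·α) (CBV⊆par r)
CBV⊆par (inμ A c r)    = map₂ (λ p → inner (inμ p)) (CBV⊆par r)
CBV⊆par (coitrˡ A r N) = map₂ (λ p → inner (coitr p (par-refl N))) (CBV⊆par r)
CBV⊆par (coitrʳ A M r) = map₂ (λ p → inner (coitr (par-refl M) p)) (CBV⊆par r)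
CBV⊆par ([ r , L ]ˡ)     = map₂ (λ p → inner [ p , par-refl L ]) (CBV⊆par r)
CBV⊆par ([ K , r ]ʳ)     = map₂ (λ p → inner [ par-refl K , p ]) (CBV⊆par r)
CBV⊆par fst[ r ]       = map₂ (λ p → inner fst[ p ]) (CBV⊆par r)
CBV⊆par snd[ r ]       = map₂ (λ p → inner snd[ p ]) (CBV⊆par r)
CBV⊆par not⟨ r ⟩       = map₂ (λ p → inner not⟨ p ⟩) (CBV⊆par r)
CBV⊆par x·⟪ r ⟫        = map₂ (λ p → inner x·⟪ p ⟫) (CBV⊆par r)
CBV⊆par (outν A c r)   = map₂ (λ p → inner (outν p)) (CBV⊆par r)
CBV⊆par (itrˡ A r L)   = map₂ (λ p → inner (itr p (par-refl L))) (CBV⊆par r)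
CBV⊆par (itrʳ A K r)   = map₂ (λ p → inner (itr (par-refl K) p)) (CBV⊆par r)
CBV⊆par (r •ˡ K)       = map₂ (λ p → inner (p • par-refl K)) (CBV⊆par r)
CBV⊆par (M •ʳ r)       = map₂ (λ p → inner (par-refl M • p)) (CBV⊆par r)

par⊆CBV* : ∀ {k s n m κ} {D E : Expr k s n m} → Par κ D E → Star CBV D E
layer⊆CBV* : ∀ {k s n m κ} {D E : Expr k s n m} → Layer (Par κ) D E → Star CBV D E

par⊆CBV* (inner ℓ)        = layer⊆CBV* ℓ
par⊆CBV* (root ℓ (r , _)) = layer⊆CBV* ℓ ◅◅ rule r ◅ ε

layer⊆CBV* var         = ε
layer⊆CBV* ⟨ p , q ⟩   = gmap ⟨_, _ ⟩ ⟨_, _ ⟩ˡ (par⊆CBV* p) ◅◅ gmap ⟨ _ ,_⟩ ⟨ _ ,_⟩ʳ (par⊆CBV* q)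
layer⊆CBV* ⟨ p ⟩inl    = gmap ⟨_⟩inl ⟨_⟩inl (par⊆CBV* p)
layer⊆CBV* ⟨ p ⟩inr    = gmap ⟨_⟩inr ⟨_⟩inr (par⊆CBV* p)
layer⊆CBV* [ p ]not    = gmap [_]not [_]not (par⊆CBV* p)
layer⊆CBV* ⟪ p ⟫·α     = gmap ⟪_⟫·α ⟪_⟫·α (par⊆CBV* p)
layer⊆CBV* (inμ {A = A} {c} p) = gmap (inμ A c) (inμ A c) (par⊆CBV* p)
layer⊆CBV* (coitr p q) = gmap (λ M → coitr _ M _) (λ r → coitrˡ _ r _) (par⊆CBV* p)
                      ◅◅ gmap (coitr _ _) (coitrʳ _ _) (par⊆CBV* q)
layer⊆CBV* covar       = ε
layer⊆CBV* [ p , q ]   = gmap [_, _ ] [_, _ ]ˡ (par⊆CBV* p) ◅◅ gmap [ _ ,_] [ _ ,_]ʳ (par⊆CBV* q)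
layer⊆CBV* fst[ p ]    = gmap fst[_] fst[_] (par⊆CBV* p)
layer⊆CBV* snd[ p ]    = gmap snd[_] snd[_] (par⊆CBV* p)
layer⊆CBV* not⟨ p ⟩    = gmap not⟨_⟩ not⟨_⟩ (par⊆CBV* p)
layer⊆CBV* x·⟪ p ⟫     = gmap x·⟪_⟫ x·⟪_⟫ (par⊆CBV* p)
layer⊆CBV* (outν {A = A} {c} p) = gmap (outν A c) (outν A c) (par⊆CBV* p)
layer⊆CBV* (itr p q)   = gmap (λ K → itr _ K _) (λ r → itrˡ _ r _) (par⊆CBV* p)
                      ◅◅ gmap (itr _ _) (itrʳ _ _) (par⊆CBV* q)
layer⊆CBV* (p • q)     = gmap (_• _) (_•ˡ _) (par⊆CBV* p) ◅◅ gmap (_ •_) (_ •ʳ_) (par⊆CBV* q)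

CBV-confluent : ∀ {k s n m} → Confluent (CBV {k} {s} {n} {m})
CBV-confluent = confluent-sandwich
  (λ r → split (CBV⊆par r) ◅ ε)
  (λ { (inj₁ (_ , _ , p)) → par⊆CBV* p ; (inj₂ p) → par⊆CBV* p })
  (hindley-rosen ⇛-diamond ς-diamond ς-⇛-commute)
  where
  split : ∀ {D E} → ∃[ κ ] Par κ D E → D ⇛ E ⊎ Par ς D E
  split (β , p) = inj₁ (β , (λ ()) , p)
  split (η , p) = inj₁ (η , (λ ()) , p)
  split (ς , p) = inj₂ p

-- Duality exchanges the two strategies

value-dual : ∀ {k n m} {V : Term k n m} → Value V → Covalue (dual V)
value-dual var           = covar
value-dual ⟨ v , w ⟩     = [ value-dual v , value-dual w ]
value-dual ⟨ v ⟩inl      = fst[ value-dual v ]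
value-dual ⟨ v ⟩inr      = snd[ value-dual v ]
value-dual [ K ]not      = not⟨ dual K ⟩
value-dual (inμ A p v)   = outν (dualT A) (dualT-Pos A p) (value-dual v)
value-dual (coitr A M v) = itr (dualT A) (dual M) (value-dual v)

covalue-dual : ∀ {k n m} {P : Coterm k n m} → Covalue P → Value (dual P)
covalue-dual covar        = var
covalue-dual [ p , q ]    = ⟨ covalue-dual p , covalue-dual q ⟩
covalue-dual fst[ p ]     = ⟨ covalue-dual p ⟩inl
covalue-dual snd[ p ]     = ⟨ covalue-dual p ⟩inr
covalue-dual not⟨ M ⟩     = [ dual M ]not
covalue-dual (outν A c p) = inμ (dualT A) (dualT-Pos A c) (covalue-dual p)
covalue-dual (itr A K p)  = coitr (dualT A) (dual K) (covalue-dual p)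

nonvalue-dual : ∀ {k n m} {M : Term k n m} → ¬ Value M → ¬ Covalue (dual M)
nonvalue-dual {M = M} ¬v p = ¬v (subst Value (dual-involutiveᵗ M) (covalue-dual p))

noncovalue-dual : ∀ {k n m} {K : Coterm k n m} → ¬ Covalue K → ¬ Value (dual K)
noncovalue-dual {K = K} ¬p v = ¬p (subst Covalue (dual-involutiveᶜ K) (value-dual v))

dual-/α : ∀ {k s n m} (E : Expr k s n (suc m)) (K : Coterm k n m) → dual (E [ K /α]) ≡ dual E [ dual K /x]
dual-/α E K = dual-sub (λ { zero → refl ; (suc x) → refl }) (λ _ → refl) E

dual-/x : ∀ {k s n m} (E : Expr k s (suc n) m) (M : Term k n m) → dual (E [ M /x]) ≡ dual E [ dual M /α]
dual-/x E M = dual-sub (λ _ → refl) (λ { zero → refl ; (suc x) → refl }) E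

-- Dualising meets the outer `dual` in the definition of `comono`, and the two cancel. What remains
-- agrees by computation up to moving `dual` past renamings.
dual-μ-contractum : ∀ {k n m} C .p (M : Term k n m) A K L →
  dual (μ-contractum C p M A K L) ≡
  ν-contractum (dualT C) (dualT-Pos C p) (dualT A) (dual K) (dual L) (dual M)
dual-μ-contractum C p M A K L = cong₂ (λ F M → dual L • x·⟪ F • M ⟫)
  (trans (dual-involutiveᵗ _)
         (cong (λ K′ → mono (dualT C) (dualT A) (dualT (μ C p)) (coitr (dualT A) K′ (var zero)) (dual K))
               (dual-ren id (lift 1 (2 ↑ʳ_)) K)))
  (dual-ren id suc M)

-- Unfolding the right-hand side would produce a `comono` with doubly dualised arguments. The μ-case
-- for the dual data, dualised once more, gives the equation once the double duals are removed.
dual-ν-contractum : ∀ {k n m} C .p A (M : Term k (suc n) m) N K →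
  dual (ν-contractum C p A M N K) ≡
  μ-contractum (dualT C) (dualT-Pos C p) (dual K) (dualT A) (dual M) (dual N)
dual-ν-contractum C p A M N K =
  trans (cong dual (sym (trans (dual-μ-contractum (dualT C) (dualT-Pos C p) (dual K) (dualT A) (dual M) (dual N))
    (ν-contractum-≡ (dualT-involutive C) (dualT-involutive A)
                    (dual-involutiveᵗ M) (dual-involutiveᵗ N) (dual-involutiveᶜ K)))))
        (dual-involutiveˢ _)
  where
  ν-contractum-≡ : ∀ {k n m C C′} .{p} .{p′} {A A′} {M M′ : Term k (suc n) m} {N N′ K K′} →
                   C ≡ C′ → A ≡ A′ → M ≡ M′ → N ≡ N′ → K ≡ K′ →
                   ν-contractum C p A M N K ≡ ν-contractum C′ p′ A′ M′ N′ K′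
  ν-contractum-≡ refl refl refl refl refl = refl

dual-wkˣwkᵅ : ∀ {k s n m} (E : Expr k s n m) → dual (wkˣ (wkᵅ E)) ≡ wkᵅ (wkˣ (dual E))
dual-wkˣwkᵅ E = trans (dual-ren suc id (wkᵅ E)) (cong wkᵅ (dual-ren id suc E))

dual-wkᵅwkˣ : ∀ {k s n m} (E : Expr k s n m) → dual (wkᵅ (wkˣ E)) ≡ wkˣ (wkᵅ (dual E))
dual-wkᵅwkˣ E = trans (dual-ren id suc (wkˣ E)) (cong wkˣ (dual-ren suc id E))

respʳ : ∀ {A : Set} (R : Rel A 0ℓ) {x y z} → z ≡ y → R x y → R x z
respʳ R refl r = r

respˡ : ∀ {A : Set} (R : Rel A 0ℓ) {x y z} → z ≡ x → R x y → R z y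
respˡ R refl r = r

▷ᵛ-dual : ∀ {k s n m} {D E : Expr k s n m} → D ▷ᵛ E → dual D ▷ⁿ dual E
▷ᵛ-dual (β-fst v w) = β-inl (value-dual v) (value-dual w)
▷ᵛ-dual (β-snd v w) = β-inr (value-dual v) (value-dual w)
▷ᵛ-dual (β-inl v)   = β-fst (value-dual v)
▷ᵛ-dual (β-inr v)   = β-snd (value-dual v)
▷ᵛ-dual β-not       = β-not
▷ᵛ-dual (β-α {S} {K}) = respʳ _▷ⁿ_ (dual-/α S K) β-x
▷ᵛ-dual (β-x {V} {S} v) = respʳ _▷ⁿ_ (dual-/x S V) (β-α (value-dual v))
▷ᵛ-dual (β-μ {C} {p} {V} {A} {K} {L} v) =
  respʳ _▷ⁿ_ (dual-μ-contractum C p V A K L) (β-ν (value-dual v))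
▷ᵛ-dual (β-ν {C} {p} {A} {M} {V} {K} v) =
  respʳ _▷ⁿ_ (dual-ν-contractum C p A M V K) (β-μ (value-dual v))
▷ᵛ-dual (η-α {M}) = respˡ _▷ⁿ_ (cong (λ K → x·⟪ var zero • K ⟫) (dual-ren id suc M)) η-x
▷ᵛ-dual (η-x {K}) = respˡ _▷ⁿ_ (cong (λ M → ⟪ M • covar zero ⟫·α) (dual-ren suc id K)) η-α
▷ᵛ-dual (ς-⟨,⟩ˡ {M} {N} ¬v) = respʳ _▷ⁿ_
  (cong₂ (λ N M → x·⟪ ⟪ var zero • [ covar zero , N ] ⟫·α • M ⟫) (dual-wkˣwkᵅ N) (dual-ren id suc M))
  (ς-[,]ˡ (nonvalue-dual ¬v))
▷ᵛ-dual (ς-⟨,⟩ʳ {V} {M} v ¬v) = respʳ _▷ⁿ_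
  (cong₂ (λ V M → x·⟪ ⟪ var zero • [ V , covar zero ] ⟫·α • M ⟫) (dual-wkˣwkᵅ V) (dual-ren id suc M))
  (ς-[,]ʳ (value-dual v) (nonvalue-dual ¬v))
▷ᵛ-dual (ς-inl {M} ¬v) = respʳ _▷ⁿ_
  (cong (λ M → x·⟪ ⟪ var zero • fst[ covar zero ] ⟫·α • M ⟫) (dual-ren id suc M))
  (ς-fst (nonvalue-dual ¬v))
▷ᵛ-dual (ς-inr {M} ¬v) = respʳ _▷ⁿ_
  (cong (λ M → x·⟪ ⟪ var zero • snd[ covar zero ] ⟫·α • M ⟫) (dual-ren id suc M))
  (ς-snd (nonvalue-dual ¬v))
▷ᵛ-dual (ς-in {C} {p} {M} ¬v) = respʳ _▷ⁿ_
  (cong (λ M → x·⟪ ⟪ var zero • outν (dualT C) (dualT-Pos C p) (covar zero) ⟫·α • M ⟫) (dual-ren id suc M))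
  (ς-out (nonvalue-dual ¬v))
▷ᵛ-dual (ς-coitr {A} {M} {N} ¬v) = respʳ _▷ⁿ_
  (cong₂ (λ M N → x·⟪ ⟪ var zero • itr (dualT A) M (covar zero) ⟫·α • N ⟫)
              (dual-ren (lift 1 suc) suc M) (dual-ren id suc N))
  (ς-itr (nonvalue-dual ¬v))

▷ⁿ-dual : ∀ {k s n m} {D E : Expr k s n m} → D ▷ⁿ E → dual D ▷ᵛ dual E
▷ⁿ-dual (β-fst p)   = β-inl (covalue-dual p)
▷ⁿ-dual (β-snd p)   = β-inr (covalue-dual p)
▷ⁿ-dual (β-inl p q) = β-fst (covalue-dual p) (covalue-dual q)
▷ⁿ-dual (β-inr p q) = β-snd (covalue-dual p) (covalue-dual q)
▷ⁿ-dual β-not       = β-not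
▷ⁿ-dual (β-α {S} {P} p) = respʳ _▷ᵛ_ (dual-/α S P) (β-x (covalue-dual p))
▷ⁿ-dual (β-x {M} {S}) = respʳ _▷ᵛ_ (dual-/x S M) β-α
▷ⁿ-dual (β-μ {C} {c} {M} {A} {K} {P} p) =
  respʳ _▷ᵛ_ (dual-μ-contractum C c M A K P) (β-ν (covalue-dual p))
▷ⁿ-dual (β-ν {C} {c} {A} {M} {N} {P} p) =
  respʳ _▷ᵛ_ (dual-ν-contractum C c A M N P) (β-μ (covalue-dual p))
▷ⁿ-dual (η-α {M}) = respˡ _▷ᵛ_ (cong (λ K → x·⟪ var zero • K ⟫) (dual-ren id suc M)) η-x
▷ⁿ-dual (η-x {K}) = respˡ _▷ᵛ_ (cong (λ M → ⟪ M • covar zero ⟫·α) (dual-ren suc id K)) η-α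
▷ⁿ-dual (ς-[,]ˡ {K} {L} ¬p) = respʳ _▷ᵛ_
  (cong₂ (λ K L → ⟪ K • x·⟪ ⟨ var zero , L ⟩ • covar zero ⟫ ⟫·α) (dual-ren suc id K) (dual-wkᵅwkˣ L))
  (ς-⟨,⟩ˡ (noncovalue-dual ¬p))
▷ⁿ-dual (ς-[,]ʳ {P} {K} p ¬p) = respʳ _▷ᵛ_
  (cong₂ (λ K P → ⟪ K • x·⟪ ⟨ P , var zero ⟩ • covar zero ⟫ ⟫·α) (dual-ren suc id K) (dual-wkᵅwkˣ P))
  (ς-⟨,⟩ʳ (covalue-dual p) (noncovalue-dual ¬p))
▷ⁿ-dual (ς-fst {K} ¬p) = respʳ _▷ᵛ_
  (cong (λ K → ⟪ K • x·⟪ ⟨ var zero ⟩inl • covar zero ⟫ ⟫·α) (dual-ren suc id K))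
  (ς-inl (noncovalue-dual ¬p))
▷ⁿ-dual (ς-snd {K} ¬p) = respʳ _▷ᵛ_
  (cong (λ K → ⟪ K • x·⟪ ⟨ var zero ⟩inr • covar zero ⟫ ⟫·α) (dual-ren suc id K))
  (ς-inr (noncovalue-dual ¬p))
▷ⁿ-dual (ς-out {C} {c} {K} ¬p) = respʳ _▷ᵛ_
  (cong (λ K → ⟪ K • x·⟪ inμ (dualT C) (dualT-Pos C c) (var zero) • covar zero ⟫ ⟫·α) (dual-ren suc id K))
  (ς-in (noncovalue-dual ¬p))
▷ⁿ-dual (ς-itr {A} {K} {L} ¬p) = respʳ _▷ᵛ_
  (cong₂ (λ K L → ⟪ L • x·⟪ coitr (dualT A) K (var zero) • covar zero ⟫ ⟫·α)
              (dual-ren suc (lift 1 suc) K) (dual-ren suc id L))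
  (ς-coitr (noncovalue-dual ¬p))

compatible-dual : ∀ {k} {R S : ∀ {s n m} → Rel (Expr k s n m) 0ℓ} →
  (∀ {s n m} {D E : Expr k s n m} → R D E → S (dual D) (dual E)) →
  ∀ {s n m} {D E : Expr k s n m} → Compatible R D E → Compatible S (dual D) (dual E)
compatible-dual h (rule r)       = rule (h r)
compatible-dual h (⟨ r , N ⟩ˡ)   = [ compatible-dual h r , dual N ]ˡ
compatible-dual h (⟨ M , r ⟩ʳ)   = [ dual M , compatible-dual h r ]ʳ
compatible-dual h ⟨ r ⟩inl       = fst[ compatible-dual h r ]
compatible-dual h ⟨ r ⟩inr       = snd[ compatible-dual h r ]
compatible-dual h [ r ]not       = not⟨ compatible-dual h r ⟩
compatible-dual h ⟪ r ⟫·α        = x·⟪ compatible-dual h r ⟫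
compatible-dual h (inμ A p r)    = outν (dualT A) (dualT-Pos A p) (compatible-dual h r)
compatible-dual h (coitrˡ A r N) = itrˡ (dualT A) (compatible-dual h r) (dual N)
compatible-dual h (coitrʳ A M r) = itrʳ (dualT A) (dual M) (compatible-dual h r)
compatible-dual h ([ r , L ]ˡ)   = ⟨ compatible-dual h r , dual L ⟩ˡ
compatible-dual h ([ K , r ]ʳ)   = ⟨ dual K , compatible-dual h r ⟩ʳ
compatible-dual h fst[ r ]       = ⟨ compatible-dual h r ⟩inl
compatible-dual h snd[ r ]       = ⟨ compatible-dual h r ⟩inr
compatible-dual h not⟨ r ⟩       = [ compatible-dual h r ]not
compatible-dual h x·⟪ r ⟫        = ⟪ compatible-dual h r ⟫·α
compatible-dual h (outν A p r)   = inμ (dualT A) (dualT-Pos A p) (compatible-dual h r)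
compatible-dual h (itrˡ A r L)   = coitrˡ (dualT A) (compatible-dual h r) (dual L)
compatible-dual h (itrʳ A K r)   = coitrʳ (dualT A) (dual K) (compatible-dual h r)
compatible-dual h (r •ˡ K)       = dual K •ʳ compatible-dual h r
compatible-dual h (M •ʳ r)       = compatible-dual h r •ˡ dual M

CBN-confluent : ∀ {k s n m} → Confluent (CBN {k} {s} {n} {m})
-- On a concrete sort `dual` returns to the sort it started from, so it can serve as both maps of
-- the retraction.
CBN-confluent {s = term} =
  confluent-retract dual dual dual-involutiveᵗ (compatible-dual ▷ⁿ-dual) (compatible-dual ▷ᵛ-dual) CBV-confluent
CBN-confluent {s = coterm} =
  confluent-retract dual dual dual-involutiveᶜ (compatible-dual ▷ⁿ-dual) (compatible-dual ▷ᵛ-dual) CBV-confluent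
CBN-confluent {s = statement} =
  confluent-retract dual dual dual-involutiveˢ (compatible-dual ▷ⁿ-dual) (compatible-dual ▷ᵛ-dual) CBV-confluent

theorem7p26 : (∀ k s n m → Confluent (CBV {k} {s} {n} {m})) × (∀ k s n m → Confluent (CBN {k} {s} {n} {m}))
theorem7p26 = (λ k s n m → CBV-confluent) , (λ k s n m → CBN-confluent)
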